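{- Principal conducts are closed under $\otimes$ and $\mathbin{\mathrm{par}}$ (for conducts on disjoint vertex sets, as these operations require), and bi-principal conducts constitute a non-trivial model of Multiplicative Linear Logic (MLL). Thus, there is a model of MLL whose conducts all admit generators whose number of edges is at most quadratic in the number of vertices (with no parallel edges allowed, it is bounded by the number of ordered pairs of vertices).
   Context: Graphs are directed multigraphs: a vertex set $V(G)$, an edge set $E(G)$, and source and target maps $s,t:E(G)\to V(G)$, where $s\times t$ need not be injective. A coherence relation is a symmetric reflexive binary relation. A coherent graph is a graph $G$ with a coherence relation on $E(G)$. Coherent graphs $G, G'$ are identified, written $G\equiv G'$, when $V(G)=V(G')$ and there is a bijection $E(G)\to E(G')$ preserving sources and targets and preserving and reflecting coherence. Plugging: $G \mathbin{\square} H$ has vertex set $V(G)\cup V(H)$ and edge set the coproduct $E(G)+E(H)$, remembering the provenance of edges. Its coherence relation restricts to those of $G$ and $H$, and every edge of $G$ is coherent with every edge of $H$. A path is a finite sequence $v_0,e_1,v_1,\dots,e_n,v_n$ with $n\ge 1$, $s(e_i)=v_{i-1}$, $t(e_i)=v_i$; a cycle is a path with $v_n=v_0$. A path in $G\mathbin{\square}H$ is alternating if, of any two consecutive edges, exactly one is in $E(G)$; for a cycle, the last edge and the first edge also count as consecutive. A path or cycle is coherent if its edges are pairwise coherent. Two coherent paths are mutually coherent if every edge of one is coherent with every edge of the other. Execution: $G :: H$ has vertex set $V(G)\mathbin{\triangle}V(H)$ (symmetric difference), and one edge from $u$ to $v$ for each coherent alternating path from $u$ to $v$ in $G\mathbin{\square}H$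 with $u,v\in V(G)\mathbin{\triangle}V(H)$; the coherence of edges is mutual coherence of paths. If $V(G)\cap V(H)=\emptyset$, write $G\otimes H$ for $G::H$ (the disjoint union, with all edges of $G$ coherent with all edges of $H$). Orthogonality: if $V(G)=V(H)$, then $G\perp H$ means that $G\mathbin{\square}H$ contains no coherent alternating cycle. For a set $X$ of coherent graphs on a common vertex set, $X^\perp$ is the set of coherent graphs on that vertex set orthogonal to all elements of $X$. A conduct $\mathbf{A}$ on a vertex set $V(\mathbf{A})$ is a set of coherent graphs with vertex set $V(\mathbf{A})$ such that $\mathbf{A}=\mathbf{A}^{\perp\perp}$. For conducts on disjoint vertex sets: $\mathbf{A}\otimes\mathbf{B}=\{G\otimes H : G\in\mathbf{A},H\in\mathbf{B}\}^{\perp\perp}$, $\mathbf{A}\mathbin{\mathrm{par}}\mathbf{B}=(\mathbf{A}^\perp\otimes\mathbf{B}^\perp)^\perp$, $\mathbf{A}\multimap\mathbf{B}=(\mathbf{A}\otimes\mathbf{B}^\perp)^\perp$. Model of MLL: the ambient model is the following $*$-autonomous category. Objects are conducts; morphisms $\mathbf{A}\to\mathbf{B}$ are coherent graphs in $\phi(\mathbf{A})\multimap\psi(\mathbf{B})$, where $\phi,\psi$ rename vertices so that the vertex sets become disjoint; composition is execution (modulo renaming of vertices); the monoidal product is $\otimes$ (after renaming to disjoint vertex sets); dualization is $(-)^\perp$. That bi-principal conducts constitute a model of MLL means that MLL can be interpreted in this way using only bi-principal conducts as objects. A generator of a conduct $\mathbf{A}$ is a coherent graph $G\in\mathbf{A}^\perp$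 such that $\mathbf{A}=\{G\}^\perp$. A conduct is principal if it admits a generator without parallel edges, i.e. without multiple edges having both the same source and the same target. A conduct $\mathbf{A}$ is bi-principal if both $\mathbf{A}$ and $\mathbf{A}^\perp$ are principal. "Non-trivial" is used informally, with no formal definition. The authors' explanation is that the conduct on the one-vertex set $\{*\}$ (which they call the unique conduct on $\{*\}$, and describe as not containing any coherent graph) is bi-principal, and that a "truly non-empty" bi-principal conduct is then obtained by taking any provable MLL formula and interpreting every atom by $\{*\}$. -}

module Defs where

open import Data.Empty using (⊥)
open import Data.List.Base using (List; []; _∷_; _++_; _∷ʳ_)
open import Data.List.NonEmpty.Base as List⁺ using (List⁺; _∷⁺_; head; toList)
open import Data.List.Properties using (map-++)
open import Data.List.Relation.Binary.Permutation.Propositional using (_↭_)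
open import Data.List.Relation.Unary.All as All using (All)
import Data.List.Relation.Unary.All.Properties as All
open import Data.List.Relation.Unary.Linked as Linked using (Linked)
import Data.List.Relation.Unary.Linked.Properties as Linked
open import Data.Nat.Base using (ℕ)
open import Data.Product using (Σ; ∃; ∃₂; Σ-syntax; _×_; _,_; proj₁; proj₂; <_,_>)
open import Data.Sum.Base as Sum using (_⊎_; inj₁; inj₂; [_,_]; swap)
open import Data.Unit.Base using (⊤; tt)
open import Function.Base using (id; _∘_)
open import Function.Bundles using (_↔_; _⇔_; module Inverse)
open import Function.Definitions using (Injective)
open import Level using (Level; _⊔_; 0ℓ) renaming (suc to lsuc)
open import Relation.Binary.Core using (Rel)
open import Relation.Binary.Definitions using (Reflexive; Symmetric; Irrelevant)
open import Relation.Binary.PropositionalEquality using (_≡_; refl; sym; cong; subst)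
open import Relation.Binary.Structures using (IsEquivalence)
open import Relation.Nullary.Negation.Core using (¬_)
open import Relation.Unary using (Pred; _∈_; _≐_; ｛_｝)

private variable
  A B C D U V W : Set

infix  4 _≅_ _⟂_
infixl 6 _□_ _⊗ᵍ_ _∷∷_
infix  8 _^⊥
infixr 6 _⊗_ _⅋_
infixr 5 _⊸_

-- Coherence is proof-irrelevant: a relation in the ordinary sense, so
-- that an edge of an execution is a path and not a path together with a
-- choice of coherence witnesses.
record CohGraph (V : Set) : Set₁ where
  infix 4 _⌢_
  field
    Edge         : Set
    source       : Edge → V
    target       : Edge → V
    _⌢_          : Rel Edge 0ℓ
    ⌢-refl       : Reflexive _⌢_
    ⌢-sym        : Symmetric _⌢_
    ⌢-irrelevant : Irrelevant _⌢_

open CohGraph public using (Edge; source; target)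

record _≅_ (G H : CohGraph V) : Set where
  private
    module G = CohGraph G
    module H = CohGraph H
  field
    bijection : Edge G ↔ Edge H
  open Inverse bijection using (to)
  field
    source-≡  : ∀ e → source H (to e) ≡ source G e
    target-≡  : ∀ e → target H (to e) ≡ target G e
    coherence : ∀ e f → (e G.⌢ f) ⇔ (to e H.⌢ to f)

Simple : CohGraph V → Set
Simple G = Injective _≡_ _≡_ < source G , target G >

rename : (V → W) → CohGraph V → CohGraph W
rename f G = record
  { CohGraph G
  ; source = f ∘ source G
  ; target = f ∘ target G
  }

-- Two graphs with different vertex sets are plugged after both have been
-- renamed along the inclusions into the union of these sets.
_□_ : CohGraph U → CohGraph U → CohGraph U
G □ H = record
  { Edge         = Edge G ⊎ Edge H
  ; source       = [ source G , source H ]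
  ; target       = [ target G , target H ]
  ; _⌢_          = _⌢_
  ; ⌢-refl       = λ { {inj₁ _} → G.⌢-refl ; {inj₂ _} → H.⌢-refl }
  ; ⌢-sym        = λ {e} {f} → ⌢-sym e f
  ; ⌢-irrelevant = λ {e} {f} → ⌢-irrelevant e f
  }
  where
  module G = CohGraph G
  module H = CohGraph H

  _⌢_ : Rel (Edge G ⊎ Edge H) 0ℓ
  inj₁ e ⌢ inj₁ f = e G.⌢ f
  inj₂ e ⌢ inj₂ f = e H.⌢ f
  inj₁ _ ⌢ inj₂ _ = ⊤
  inj₂ _ ⌢ inj₁ _ = ⊤

  ⌢-sym : ∀ e f → e ⌢ f → f ⌢ e
  ⌢-sym (inj₁ _) (inj₁ _) = G.⌢-sym
  ⌢-sym (inj₂ _) (inj₂ _) = H.⌢-sym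
  ⌢-sym (inj₁ _) (inj₂ _) = id
  ⌢-sym (inj₂ _) (inj₁ _) = id

  ⌢-irrelevant : ∀ e f (c d : e ⌢ f) → c ≡ d
  ⌢-irrelevant (inj₁ _) (inj₁ _) = G.⌢-irrelevant
  ⌢-irrelevant (inj₂ _) (inj₂ _) = H.⌢-irrelevant
  ⌢-irrelevant (inj₁ _) (inj₂ _) = λ _ _ → refl
  ⌢-irrelevant (inj₂ _) (inj₁ _) = λ _ _ → refl

module _ (G : CohGraph V) where
  open CohGraph G using (_⌢_)

  data Path : V → V → Set where
    edge : ∀ {u v} e → source G e ≡ u → target G e ≡ v → Path u v
    step : ∀ {u v w} e → source G e ≡ u → target G e ≡ v →
           Path v w → Path u w

  edges : ∀ {u v} → Path u v → List⁺ (Edge G)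
  edges (edge e _ _)   = List⁺.[ e ]
  edges (step e _ _ p) = e ∷⁺ edges p

  Coherent² : Rel (List (Edge G)) 0ℓ
  Coherent² es fs = All (λ e → All (e ⌢_) fs) es

  MutuallyCoherent : ∀ {u v u′ v′} → Path u v → Path u′ v′ → Set
  MutuallyCoherent p q = Coherent² (toList (edges p)) (toList (edges q))

  Coherent : ∀ {u v} → Path u v → Set
  Coherent p = MutuallyCoherent p p

  Coherent²-sym : ∀ es fs → Coherent² es fs → Coherent² fs es
  Coherent²-sym es fs c =
    All.map (λ {f} → All.map (λ {e} → CohGraph.⌢-sym G {e} {f})) (All.All-swap c)

Opposite : Rel (A ⊎ B) 0ℓ
Opposite (inj₁ _) (inj₁ _) = ⊥
Opposite (inj₂ _) (inj₂ _) = ⊥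
Opposite (inj₁ _) (inj₂ _) = ⊤
Opposite (inj₂ _) (inj₁ _) = ⊤

Opposite-irrelevant : Irrelevant (Opposite {A} {B})
Opposite-irrelevant {x = inj₁ _} {y = inj₂ _} _ _ = refl
Opposite-irrelevant {x = inj₂ _} {y = inj₁ _} _ _ = refl

module _ (G H : CohGraph U) where

  AlternatingPath : ∀ {u v} → Path (G □ H) u v → Set
  AlternatingPath p = Linked Opposite (toList (edges (G □ H) p))

  -- Repeating the first edge at the end makes it consecutive to the last
  -- one; in particular a cycle of length one is not alternating.
  AlternatingCycle : ∀ {v} → Path (G □ H) v v → Set
  AlternatingCycle p = Linked Opposite (toList es ∷ʳ head es)
    where es = edges (G □ H) p

  CoherentAlternatingPath : U → U → Set
  CoherentAlternatingPath u v =
    Σ[ p ∈ Path (G □ H) u v ] AlternatingPath p × Coherent (G □ H) p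

  CoherentAlternatingCycle : Set
  CoherentAlternatingCycle =
    ∃ λ v → Σ[ p ∈ Path (G □ H) v v ] AlternatingCycle p × Coherent (G □ H) p

-- The vertex sets A ⊎ B and B ⊎ C have intersection B, union A ⊎ B ⊎ C
-- and symmetric difference A ⊎ C.
_∷∷_ : CohGraph (A ⊎ B) → CohGraph (B ⊎ C) → CohGraph (A ⊎ C)
_∷∷_ {A} {B} {C} G H = record
  { Edge         = ∃₂ λ u v → CoherentAlternatingPath G′ H′ (ι u) (ι v)
  ; source       = λ (u , _ , _) → u
  ; target       = λ (_ , v , _) → v
  ; _⌢_          = λ (_ , _ , p , _) (_ , _ , q , _) → MutuallyCoherent K p q
  ; ⌢-refl       = λ { {_ , _ , _ , _ , coherent} → coherent }
  ; ⌢-sym        = λ {e} {f} → Coherent²-sym K (labels e) (labels f)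
  ; ⌢-irrelevant = All.irrelevant λ {e} →
                   All.irrelevant λ {f} → CohGraph.⌢-irrelevant K {e} {f}
  }
  where
  G′ H′ K : CohGraph (A ⊎ B ⊎ C)
  G′ = rename (Sum.map₂ inj₁) G
  H′ = rename inj₂ H
  K  = G′ □ H′

  ι : A ⊎ C → A ⊎ B ⊎ C
  ι = Sum.map₂ inj₂

  labels : (∃₂ λ u v → CoherentAlternatingPath G′ H′ (ι u) (ι v)) →
           List (Edge K)
  labels (_ , _ , p , _) = toList (edges K p)

-- Execution of graphs with disjoint vertex sets: no path of length two or
-- more alternates, so this is their disjoint union, all edges of one being
-- coherent with all edges of the other.
_⊗ᵍ_ : CohGraph V → CohGraph W → CohGraph (V ⊎ W)
G ⊗ᵍ H = rename inj₁ G □ rename inj₂ H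

_⟂_ : Rel (CohGraph V) 0ℓ
G ⟂ H = ¬ CoherentAlternatingCycle G H

Orth : Pred (CohGraph V) (lsuc 0ℓ) → Pred (CohGraph V) (lsuc 0ℓ)
Orth X G = ∀ H → H ∈ X → G ⟂ H

module _ (G H : CohGraph V) where
  private
    swapPath : ∀ {u v} → Path (G □ H) u v → Path (H □ G) u v
    swapPath (edge (inj₁ e) s t)   = edge (inj₂ e) s t
    swapPath (edge (inj₂ e) s t)   = edge (inj₁ e) s t
    swapPath (step (inj₁ e) s t p) = step (inj₂ e) s t (swapPath p)
    swapPath (step (inj₂ e) s t p) = step (inj₁ e) s t (swapPath p)

    edges-swapPath : ∀ {u v} (p : Path (G □ H) u v) →
                     edges (H □ G) (swapPath p) ≡
                     List⁺.map swap (edges (G □ H) p)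
    edges-swapPath (edge (inj₁ _) _ _)   = refl
    edges-swapPath (edge (inj₂ _) _ _)   = refl
    edges-swapPath (step (inj₁ e) _ _ p) = cong (inj₂ e ∷⁺_) (edges-swapPath p)
    edges-swapPath (step (inj₂ e) _ _ p) = cong (inj₁ e ∷⁺_) (edges-swapPath p)

    opposite-swap : ∀ {x y : Edge G ⊎ Edge H} →
                    Opposite x y → Opposite (swap x) (swap y)
    opposite-swap {inj₁ _} {inj₂ _} o = o
    opposite-swap {inj₂ _} {inj₁ _} o = o

    coherent-swap : ∀ x y → CohGraph._⌢_ (G □ H) x y →
                    CohGraph._⌢_ (H □ G) (swap x) (swap y)
    coherent-swap (inj₁ _) (inj₁ _) c = c
    coherent-swap (inj₂ _) (inj₂ _) c = c
    coherent-swap (inj₁ _) (inj₂ _) c = c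
    coherent-swap (inj₂ _) (inj₁ _) c = c

  swapCycle : CoherentAlternatingCycle G H → CoherentAlternatingCycle H G
  swapCycle (v , p , alternating , coherent) =
    v , swapPath p ,
    subst (λ es → Linked Opposite (toList es ∷ʳ head es))
          (sym (edges-swapPath p))
          (subst (Linked Opposite) (map-++ swap (toList es₀) (head es₀ ∷ []))
            (Linked.map⁺ (Linked.map opposite-swap alternating))) ,
    subst (λ es → Coherent² (H □ G) (toList es) (toList es))
          (sym (edges-swapPath p))
          (All.map⁺ (All.map (λ {x} → All.map⁺ ∘ All.map (λ {y} → coherent-swap x y))
                            coherent))
    where es₀ = edges (G □ H) p

⟂-sym : {G H : CohGraph V} → G ⟂ H → H ⟂ G
⟂-sym {G = G} {H = H} G⟂H cycle = G⟂H (swapCycle H G cycle)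

record Conduct (V : Set) : Set₂ where
  field
    carrier : Pred (CohGraph V) (lsuc 0ℓ)
    closed  : carrier ≐ Orth (Orth carrier)

open Conduct public using (carrier)

orth : Pred (CohGraph V) (lsuc 0ℓ) → Conduct V
orth X = record
  { carrier = Orth X
  ; closed  = (λ {G} G∈ H H∈ → ⟂-sym {G = H} {H = G} (H∈ G G∈))
            , (λ {G} G∈ H H∈ → G∈ H λ K K∈ → ⟂-sym {G = K} {H = H} (K∈ H H∈))
  }

_^⊥ : Conduct V → Conduct V
𝑨 ^⊥ = orth (carrier 𝑨)

_⊗_ : Conduct V → Conduct W → Conduct (V ⊎ W)
𝑨 ⊗ 𝑩 = orth (λ F → ∃₂ λ G H → G ∈ carrier 𝑨 × H ∈ carrier 𝑩 × F ≡ G ⊗ᵍ H) ^⊥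

_⅋_ : Conduct V → Conduct W → Conduct (V ⊎ W)
𝑨 ⅋ 𝑩 = (𝑨 ^⊥ ⊗ 𝑩 ^⊥) ^⊥

_⊸_ : Conduct V → Conduct W → Conduct (V ⊎ W)
𝑨 ⊸ 𝑩 = (𝑨 ⊗ 𝑩 ^⊥) ^⊥

Generator : Conduct V → Pred (CohGraph V) (lsuc 0ℓ)
Generator 𝑨 G = G ∈ carrier (𝑨 ^⊥) × carrier 𝑨 ≐ Orth ｛ G ｝

Principal : Conduct V → Set₁
Principal 𝑨 = ∃ λ G → Generator 𝑨 G × Simple G

BiPrincipal : Conduct V → Set₁
BiPrincipal 𝑨 = Principal 𝑨 × Principal (𝑨 ^⊥)

record IsCategory
  {o ℓ e : Level} {Obj : Set o} (_⇒_ : Obj → Obj → Set ℓ)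
  (_≈_  : ∀ {X Y} → Rel (X ⇒ Y) e)
  (_∘′_ : ∀ {X Y Z} → Y ⇒ Z → X ⇒ Y → X ⇒ Z)
  : Set (o ⊔ ℓ ⊔ e) where
  field
    ≈-equiv   : ∀ {X Y} → IsEquivalence (_≈_ {X} {Y})
    ∘-cong    : ∀ {X Y Z} {g g′ : Y ⇒ Z} {f f′ : X ⇒ Y} →
                g ≈ g′ → f ≈ f′ → (g ∘′ f) ≈ (g′ ∘′ f′)
    ∘-assoc   : ∀ {X Y Z T} (h : Z ⇒ T) (g : Y ⇒ Z) (f : X ⇒ Y) →
                ((h ∘′ g) ∘′ f) ≈ (h ∘′ (g ∘′ f))
    1ₘ        : ∀ {X} → X ⇒ X
    identityˡ : ∀ {X Y} (f : X ⇒ Y) → (1ₘ ∘′ f) ≈ f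
    identityʳ : ∀ {X Y} (f : X ⇒ Y) → (f ∘′ 1ₘ) ≈ f

  record _≃_ (X Y : Obj) : Set (ℓ ⊔ e) where
    field
      fwd  : X ⇒ Y
      bwd  : Y ⇒ X
      isoˡ : (bwd ∘′ fwd) ≈ 1ₘ
      isoʳ : (fwd ∘′ bwd) ≈ 1ₘ

-- Barr's definition: a symmetric monoidal category with a full and
-- faithful contravariant functor _* and a natural bijection between
-- X ⊗ Y ⇒ Z * and X ⇒ (Y ⊗ Z) *.
record IsStarAutonomous
  {o ℓ e : Level} {Obj : Set o} (_⇒_ : Obj → Obj → Set ℓ)
  (_≈_  : ∀ {X Y} → Rel (X ⇒ Y) e)
  (_∘′_ : ∀ {X Y Z} → Y ⇒ Z → X ⇒ Y → X ⇒ Z)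
  (_⊗₀_ : Obj → Obj → Obj)
  (_⊗₁_ : ∀ {X Y X′ Y′} → X ⇒ Y → X′ ⇒ Y′ → (X ⊗₀ X′) ⇒ (Y ⊗₀ Y′))
  (_*   : Obj → Obj)
  (_*₁  : ∀ {X Y} → X ⇒ Y → (Y *) ⇒ (X *))
  : Set (o ⊔ ℓ ⊔ e) where
  field
    isCategory : IsCategory _⇒_ _≈_ _∘′_

  open IsCategory isCategory public
  open _≃_ public

  field
    ⊗-cong : ∀ {X Y X′ Y′} {f g : X ⇒ Y} {f′ g′ : X′ ⇒ Y′} →
             f ≈ g → f′ ≈ g′ → (f ⊗₁ f′) ≈ (g ⊗₁ g′)
    ⊗-1    : ∀ {X Y} → (1ₘ {X} ⊗₁ 1ₘ {Y}) ≈ 1ₘ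
    ⊗-∘    : ∀ {X Y Z X′ Y′ Z′} (g : Y ⇒ Z) (f : X ⇒ Y)
             (g′ : Y′ ⇒ Z′) (f′ : X′ ⇒ Y′) →
             ((g ∘′ f) ⊗₁ (g′ ∘′ f′)) ≈ ((g ⊗₁ g′) ∘′ (f ⊗₁ f′))

    unit : Obj
    α    : ∀ X Y Z → ((X ⊗₀ Y) ⊗₀ Z) ≃ (X ⊗₀ (Y ⊗₀ Z))
    l    : ∀ X → (unit ⊗₀ X) ≃ X
    r    : ∀ X → (X ⊗₀ unit) ≃ X
    σ    : ∀ X Y → (X ⊗₀ Y) ≃ (Y ⊗₀ X)

    α-natural : ∀ {X Y Z X′ Y′ Z′} (f : X ⇒ X′) (g : Y ⇒ Y′) (h : Z ⇒ Z′) →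
                (fwd (α X′ Y′ Z′) ∘′ ((f ⊗₁ g) ⊗₁ h)) ≈
                ((f ⊗₁ (g ⊗₁ h)) ∘′ fwd (α X Y Z))
    l-natural : ∀ {X Y} (f : X ⇒ Y) →
                (fwd (l Y) ∘′ (1ₘ ⊗₁ f)) ≈ (f ∘′ fwd (l X))
    r-natural : ∀ {X Y} (f : X ⇒ Y) →
                (fwd (r Y) ∘′ (f ⊗₁ 1ₘ)) ≈ (f ∘′ fwd (r X))
    σ-natural : ∀ {X Y X′ Y′} (f : X ⇒ X′) (g : Y ⇒ Y′) →
                (fwd (σ X′ Y′) ∘′ (f ⊗₁ g)) ≈ ((g ⊗₁ f) ∘′ fwd (σ X Y))

    σ-involutive : ∀ X Y → (fwd (σ Y X) ∘′ fwd (σ X Y)) ≈ 1ₘ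
    triangle     : ∀ X Y → ((1ₘ ⊗₁ fwd (l Y)) ∘′ fwd (α X unit Y)) ≈
                           (fwd (r X) ⊗₁ 1ₘ)
    pentagon     : ∀ X Y Z T →
                   (fwd (α X Y (Z ⊗₀ T)) ∘′ fwd (α (X ⊗₀ Y) Z T)) ≈
                   ((1ₘ ⊗₁ fwd (α Y Z T)) ∘′
                     (fwd (α X (Y ⊗₀ Z) T) ∘′ (fwd (α X Y Z) ⊗₁ 1ₘ)))
    hexagon      : ∀ X Y Z →
                   (fwd (α Y Z X) ∘′ (fwd (σ X (Y ⊗₀ Z)) ∘′ fwd (α X Y Z))) ≈
                   ((1ₘ ⊗₁ fwd (σ X Z)) ∘′
                     (fwd (α Y X Z) ∘′ (fwd (σ X Y) ⊗₁ 1ₘ)))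

    *-cong     : ∀ {X Y} {f g : X ⇒ Y} → f ≈ g → (f *₁) ≈ (g *₁)
    *-1        : ∀ {X} → (1ₘ {X} *₁) ≈ 1ₘ
    *-∘        : ∀ {X Y Z} (g : Y ⇒ Z) (f : X ⇒ Y) →
                 ((g ∘′ f) *₁) ≈ ((f *₁) ∘′ (g *₁))
    *-faithful : ∀ {X Y} {f g : X ⇒ Y} → (f *₁) ≈ (g *₁) → f ≈ g
    *-full     : ∀ {X Y} (h : (Y *) ⇒ (X *)) → Σ[ f ∈ (X ⇒ Y) ] (f *₁) ≈ h

    curry         : ∀ {X Y Z} → (X ⊗₀ Y) ⇒ (Z *) → X ⇒ ((Y ⊗₀ Z) *)
    uncurry       : ∀ {X Y Z} → X ⇒ ((Y ⊗₀ Z) *) → (X ⊗₀ Y) ⇒ (Z *)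
    curry-cong    : ∀ {X Y Z} {f g : (X ⊗₀ Y) ⇒ (Z *)} →
                    f ≈ g → curry f ≈ curry g
    uncurry-cong  : ∀ {X Y Z} {f g : X ⇒ ((Y ⊗₀ Z) *)} →
                    f ≈ g → uncurry f ≈ uncurry g
    uncurry-curry : ∀ {X Y Z} (f : (X ⊗₀ Y) ⇒ (Z *)) → uncurry (curry f) ≈ f
    curry-uncurry : ∀ {X Y Z} (f : X ⇒ ((Y ⊗₀ Z) *)) → curry (uncurry f) ≈ f
    curry-natural : ∀ {X Y Z X′ Y′ Z′} (f : (X ⊗₀ Y) ⇒ (Z *))
                    (x : X′ ⇒ X) (y : Y′ ⇒ Y) (z : Z′ ⇒ Z) →
                    curry ((z *₁) ∘′ (f ∘′ (x ⊗₁ y))) ≈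
                    (((y ⊗₁ z) *₁) ∘′ (curry f ∘′ x))

record Object (P : ∀ {V} → Conduct V → Set₁) : Set₂ where
  constructor object
  field
    {vertices} : Set
    conduct    : Conduct vertices
    property   : P conduct

interchange : (A ⊎ B) ⊎ (C ⊎ D) → (A ⊎ C) ⊎ (B ⊎ D)
interchange = [ Sum.map inj₁ inj₁ , Sum.map inj₂ inj₂ ]

-- Only the operations that conducts themselves determine are prescribed;
-- identities, unit and structural isomorphisms, with their laws, are
-- provided by isStarAutonomous.
record ModelOfMLL (P : ∀ {V} → Conduct V → Set₁) : Set₂ where
  field
    ⊗-closed : (𝑨 : Conduct V) (𝑩 : Conduct W) → P 𝑨 → P 𝑩 → P (𝑨 ⊗ 𝑩)
    ⊥-closed : (𝑨 : Conduct V) → P 𝑨 → P (𝑨 ^⊥)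

  open Object

  _⇒_ : Object P → Object P → Set₁
  X ⇒ Y = ∃ λ F → F ∈ carrier (conduct X ⊸ conduct Y)

  _≈_ : ∀ {X Y} → Rel (X ⇒ Y) 0ℓ
  (F , _) ≈ (G , _) = F ≅ G

  _⊗₀_ : Object P → Object P → Object P
  object 𝑨 p ⊗₀ object 𝑩 q = object (𝑨 ⊗ 𝑩) (⊗-closed 𝑨 𝑩 p q)

  _* : Object P → Object P
  object 𝑨 p * = object (𝑨 ^⊥) (⊥-closed 𝑨 p)

  field
    execution-∈ : ∀ X Y Z ((F , _) : X ⇒ Y) ((G , _) : Y ⇒ Z) →
                  F ∷∷ G ∈ carrier (conduct X ⊸ conduct Z)
    tensor-∈    : ∀ X Y X′ Y′ ((F , _) : X ⇒ Y) ((G , _) : X′ ⇒ Y′) →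
                  rename interchange (F ⊗ᵍ G) ∈
                  carrier ((conduct X ⊗ conduct X′) ⊸ (conduct Y ⊗ conduct Y′))
    dual-∈      : ∀ X Y ((F , _) : X ⇒ Y) →
                  rename swap F ∈ carrier (conduct Y ^⊥ ⊸ conduct X ^⊥)

  _∘′_ : ∀ {X Y Z} → Y ⇒ Z → X ⇒ Y → X ⇒ Z
  _∘′_ {X} {Y} {Z} g f = proj₁ f ∷∷ proj₁ g , execution-∈ X Y Z f g

  _⊗₁_ : ∀ {X Y X′ Y′} → X ⇒ Y → X′ ⇒ Y′ → (X ⊗₀ X′) ⇒ (Y ⊗₀ Y′)
  _⊗₁_ {X} {Y} {X′} {Y′} f g =
    rename interchange (proj₁ f ⊗ᵍ proj₁ g) , tensor-∈ X Y X′ Y′ f g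

  _*₁ : ∀ {X Y} → X ⇒ Y → (Y *) ⇒ (X *)
  _*₁ {X} {Y} f = rename swap (proj₁ f) , dual-∈ X Y f

  field
    isStarAutonomous : IsStarAutonomous _⇒_
      (λ {X} {Y} → _≈_ {X} {Y}) (λ {X} {Y} {Z} → _∘′_ {X} {Y} {Z})
      _⊗₀_ (λ {X} {Y} {X′} {Y′} → _⊗₁_ {X} {Y} {X′} {Y′})
      _* (λ {X} {Y} → _*₁ {X} {Y})

-- With units the formula 1 would be provable and have no vertices, hence
-- no edges in any graph of its interpretation.
data Formula : Set where
  atom natom : ℕ → Formula
  _⊗ᶠ_ _⅋ᶠ_  : Formula → Formula → Formula

dual : Formula → Formula
dual (atom n)  = natom n
dual (natom n) = atom n
dual (F ⊗ᶠ G)  = dual F ⅋ᶠ dual G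
dual (F ⅋ᶠ G)  = dual F ⊗ᶠ dual G

infix 3 ⊢_

data ⊢_ : List Formula → Set where
  ax  : ∀ F → ⊢ F ∷ dual F ∷ []
  cut : ∀ {Γ Δ} F → ⊢ F ∷ Γ → ⊢ dual F ∷ Δ → ⊢ Γ ++ Δ
  ex  : ∀ {Γ Δ} → Γ ↭ Δ → ⊢ Γ → ⊢ Δ
  ten : ∀ {Γ Δ} F G → ⊢ F ∷ Γ → ⊢ G ∷ Δ → ⊢ (F ⊗ᶠ G) ∷ Γ ++ Δ
  par : ∀ {Γ} F G → ⊢ F ∷ G ∷ Γ → ⊢ (F ⅋ᶠ G) ∷ Γ

Provable : Formula → Set
Provable F = ⊢ F ∷ []

module _ (ρ : ℕ → ∃ Conduct) where

  ∣_∣ : Formula → Set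
  ∣ atom n  ∣ = proj₁ (ρ n)
  ∣ natom n ∣ = proj₁ (ρ n)
  ∣ F ⊗ᶠ G  ∣ = ∣ F ∣ ⊎ ∣ G ∣
  ∣ F ⅋ᶠ G  ∣ = ∣ F ∣ ⊎ ∣ G ∣

  ⟦_⟧ : (F : Formula) → Conduct ∣ F ∣
  ⟦ atom n  ⟧ = proj₂ (ρ n)
  ⟦ natom n ⟧ = proj₂ (ρ n) ^⊥
  ⟦ F ⊗ᶠ G  ⟧ = ⟦ F ⟧ ⊗ ⟦ G ⟧
  ⟦ F ⅋ᶠ G  ⟧ = ⟦ F ⟧ ⅋ ⟦ G ⟧

-- If G and H generate 𝑨 and 𝑩, then G ⊗ H generates 𝑨 ⅋ 𝑩, because testing F
-- against a ⊗ b amounts to testing a single-sided execution of F and a against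
-- b. The conduct 𝑨 ⊗ 𝑩 is generated by G and H together with one edge from each
-- vertex of either side to each vertex of the other, edges of different kinds
-- being incoherent: the new edges forbid elements with edges between the sides.
--
-- An edge of an execution is determined by its list of edges, so the laws of
-- execution reduce to relabelling and regrouping lists. All structural
-- isomorphisms are graphs of bijections, and executing F against the graph of
-- a bijection only renames the vertices of F.
--
-- Over the conduct 𝑺 whose elements have no edge, the interpretation of a
-- formula has an element with an edge unless the formula is a tensor of
-- positive atoms; the latter is not provable, since a provable formula has as
-- many positive atoms as negative ones.
module Submission where

open import Defs
open import Axiom.UniquenessOfIdentityProofs.WithK using (uip)
open import Data.Empty using (⊥; ⊥-elim)
open import Data.Fin.Base using (Fin; combine)
open import Data.Fin.Properties using (combine-injective; injective⇒≤)
open import Data.List.Base as List using (List; []; _∷_; _++_; _∷ʳ_; concatMap)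
open import Data.List.Membership.Propositional using () renaming (_∈_ to _∈ᴸ_)
open import Data.List.Membership.Propositional.Properties using (∈-++⁺ˡ; ∈-++⁺ʳ; ∈-++⁻; ∈-map⁻)
open import Data.List.NonEmpty.Base as List⁺ using (List⁺; _∷_; head; toList)
open import Data.List.Properties using (++-identityʳ; ∷-injectiveˡ; ∷-injectiveʳ; map-++; map-injective)
open import Data.List.Relation.Binary.Permutation.Propositional using (↭-sym)
open import Data.List.Relation.Binary.Permutation.Propositional.Properties using () renaming (map⁺ to ↭-map⁺)
open import Data.List.Relation.Unary.All as All using (All; []; _∷_)
import Data.List.Relation.Unary.All.Properties as All
open import Data.List.Relation.Unary.Any using (here; there)
open import Data.List.Relation.Unary.Linked as Linked using (Linked; []; [-]; _∷_)
open import Data.Nat.Base using (ℕ; _+_; _*_; _≤_; _<_; s≤s; z≤n)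
open import Data.Nat.ListAction using (sum)
open import Data.Nat.ListAction.Properties using (sum-++; sum-↭)
open import Data.Nat.Properties using (+-assoc; +-cancelˡ-≡; +-identityʳ; m≤n⇒m≤n+o; <-irrefl)
open import Data.Nat.Tactic.RingSolver using (solve-∀)
open import Data.Product using (∃; ∃₂; Σ-syntax; _×_; _,_; proj₁; proj₂)
open import Data.Sum.Base as Sum using (_⊎_; inj₁; inj₂; [_,_]; swap; assocʳ; assocˡ)
open import Data.Sum.Properties using (inj₁-injective; inj₂-injective; swap-involutive)
open import Data.Unit.Base using (⊤; tt)
open import Function.Base using (id; _∘_)
open import Function.Bundles using (_↔_; _⇔_; _↣_; mk⇔; mk↔ₛ′; mk↣; module Equivalence; module Injection; module Inverse)
open import Function.Definitions using (Injective)
open import Level using (0ℓ) renaming (suc to lsuc)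
open import Relation.Binary.Core using (Rel)
open import Relation.Binary.Definitions using (Irrelevant)
open import Relation.Binary.PropositionalEquality hiding ([_])
open import Relation.Nullary.Negation.Core using (¬_)
open import Relation.Unary using (Pred; _∈_; _⊆_; _≐_; ｛_｝)

-- Execution loses information: a cycle closed between `F` and `a` leaves no trace in `act F a`.
-- Testing `F` against `a ⊗ᵍ b` is therefore testing `act F a` against `b` together with the absence
-- of such closed cycles. The second condition does not mention `b`, so one known test settles it,
-- and one is always at hand because every conduct contains `empty`.
--
-- Alternation speaks of two graphs and loses its meaning once three are plugged together. Routes
-- are therefore taken in a `System`, where an arbitrary relation says which edge may follow which,
-- and different bracketings of an execution are compared through systems over all edges at once.
-- `Nest` cuts routes into segments and yields isomorphisms; `Substitute` does so for cycles and
-- yields orthogonality, where only the existence of a cycle counts.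
--
-- Vertex sets may be infinite and without decidable equality; case distinctions go by the
-- provenance of edges and by the tags of disjoint sums.

private variable
  A A′ B B′ C C′ D I M N N′ U U′ V V′ W W′ : Set

-- Isomorphisms of coherent graphs

Coh : (G : CohGraph V) → Rel (Edge G) 0ℓ
Coh G = CohGraph._⌢_ G

-- A right inverse read off from the preimages is two-sided by injectivity. For executions, whose
-- edges are long dependent tuples, this is easier to supply than a pair of mutually inverse maps.
mk≅ : {G H : CohGraph V} (f : Edge G → Edge H) →
      Injective _≡_ _≡_ f → (∀ y → ∃ λ x → f x ≡ y) →
      (∀ e → source H (f e) ≡ source G e) →
      (∀ e → target H (f e) ≡ target G e) →
      (∀ e e′ → Coh G e e′ ⇔ Coh H (f e) (f e′)) → G ≅ H
mk≅ f inj surj s t c = record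
  { bijection = mk↔ₛ′ f (proj₁ ∘ surj) (proj₂ ∘ surj) (λ x → inj (proj₂ (surj (f x))))
  ; source-≡  = s
  ; target-≡  = t
  ; coherence = c
  }

≅-refl : {G : CohGraph V} → G ≅ G
≅-refl = mk≅ id id (_, refl) (λ _ → refl) (λ _ → refl) (λ _ _ → mk⇔ id id)

≅-sym : {G H : CohGraph V} → G ≅ H → H ≅ G
≅-sym {G = G} {H} G≅H = record
  { bijection = mk↔ₛ′ from to strictlyInverseʳ strictlyInverseˡ
  ; source-≡  = λ e → trans (sym (source-≡ (from e))) (cong (source H) (strictlyInverseˡ e))
  ; target-≡  = λ e → trans (sym (target-≡ (from e))) (cong (target H) (strictlyInverseˡ e))
  ; coherence = λ e f → mk⇔
      (Equivalence.from (coherence (from e) (from f)) ∘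
       subst₂ (Coh H) (sym (strictlyInverseˡ e)) (sym (strictlyInverseˡ f)))
      (subst₂ (Coh H) (strictlyInverseˡ e) (strictlyInverseˡ f) ∘
       Equivalence.to (coherence (from e) (from f)))
  }
  where
  open _≅_ G≅H
  open Inverse bijection

≅-trans : {G H K : CohGraph V} → G ≅ H → H ≅ K → G ≅ K
≅-trans {K = K} G≅H H≅K = record
  { bijection = mk↔ₛ′ (H.to ∘ G.to) (G.from ∘ H.from)
      (λ y → trans (cong H.to (G.strictlyInverseˡ (H.from y))) (H.strictlyInverseˡ y))
      (λ x → trans (cong G.from (H.strictlyInverseʳ (G.to x))) (G.strictlyInverseʳ x))
  ; source-≡  = λ e → trans (_≅_.source-≡ H≅K (G.to e)) (_≅_.source-≡ G≅H e)
  ; target-≡  = λ e → trans (_≅_.target-≡ H≅K (G.to e)) (_≅_.target-≡ G≅H e)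
  ; coherence = λ e f →
      let g = _≅_.coherence G≅H e f
          h = _≅_.coherence H≅K (G.to e) (G.to f)
      in mk⇔ (Equivalence.to h ∘ Equivalence.to g) (Equivalence.from g ∘ Equivalence.from h)
  }
  where
  module G = Inverse (_≅_.bijection G≅H)
  module H = Inverse (_≅_.bijection H≅K)

infixr 2 _≅⟨_⟩_
infix  3 _≅∎

_≅⟨_⟩_ : (G : CohGraph V) {H K : CohGraph V} → G ≅ H → H ≅ K → G ≅ K
_ ≅⟨ G≅H ⟩ H≅K = ≅-trans G≅H H≅K

_≅∎ : (G : CohGraph V) → G ≅ G
_ ≅∎ = ≅-refl

rename-cong : (f : V → W) {G H : CohGraph V} → G ≅ H → rename f G ≅ rename f H
rename-cong f G≅H = record
  { bijection = bijection
  ; source-≡  = cong f ∘ source-≡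
  ; target-≡  = cong f ∘ target-≡
  ; coherence = coherence
  }
  where open _≅_ G≅H

rename-≗ : {f g : V → W} (G : CohGraph V) → f ≗ g → rename f G ≅ rename g G
rename-≗ G f≗g = mk≅ id id (_, refl) (sym ∘ f≗g ∘ source G) (sym ∘ f≗g ∘ target G)
                 (λ _ _ → mk⇔ id id)

rename-id : {f : V → V} (G : CohGraph V) → (∀ v → f v ≡ v) → rename f G ≅ G
rename-id G f≗id = rename-≗ G f≗id

□-cong : {G G′ H H′ : CohGraph V} → G ≅ G′ → H ≅ H′ → G □ H ≅ G′ □ H′
□-cong G≅G′ H≅H′ = record
  { bijection = mk↔ₛ′ (Sum.map G.to H.to) (Sum.map G.from H.from)
      [ cong inj₁ ∘ G.strictlyInverseˡ , cong inj₂ ∘ H.strictlyInverseˡ ]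
      [ cong inj₁ ∘ G.strictlyInverseʳ , cong inj₂ ∘ H.strictlyInverseʳ ]
  ; source-≡  = [ _≅_.source-≡ G≅G′ , _≅_.source-≡ H≅H′ ]
  ; target-≡  = [ _≅_.target-≡ G≅G′ , _≅_.target-≡ H≅H′ ]
  ; coherence = λ { (inj₁ e) (inj₁ f) → _≅_.coherence G≅G′ e f
                  ; (inj₂ e) (inj₂ f) → _≅_.coherence H≅H′ e f
                  ; (inj₁ _) (inj₂ _) → mk⇔ id id
                  ; (inj₂ _) (inj₁ _) → mk⇔ id id }
  }
  where
  module G = Inverse (_≅_.bijection G≅G′)
  module H = Inverse (_≅_.bijection H≅H′)

-- Routes and execution

-- e ↝ f means that f may follow e on a route.
record System (U : Set) : Set₁ where
  field
    graph        : CohGraph U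
    _↝_          : Rel (Edge graph) 0ℓ
    ↝-irrelevant : Irrelevant _↝_

  open CohGraph graph public using () renaming (Edge to E; source to s; target to t; _⌢_ to _⌢_)


plug : CohGraph U → CohGraph U → System U
plug G H = record
  { graph        = G □ H
  ; _↝_          = Opposite
  ; ↝-irrelevant = λ {e} {f} → Opposite-irrelevant {x = e} {y = f}
  }

module _ (S : System U) where
  open System S

  -- Unlike a path, a route is determined by its edges.
  data Route : U → List E → U → Set where
    last : ∀ {u v e} → s e ≡ u → t e ≡ v → Route u (e ∷ []) v
    next : ∀ {u v e f es} → s e ≡ u → e ↝ f → Route (t e) (f ∷ es) v →
           Route u (e ∷ f ∷ es) v

  -- Edges record vertices of the interface `I` and only their images in `U` bound the route, so
  -- sources and targets come without a proof that a vertex is outer.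
  Exec : (I → U) → CohGraph I
  Exec ι = record
    { Edge         = ∃₂ λ u v → ∃ λ es → Route (ι u) es (ι v) × Coherent² graph es es
    ; source       = λ (u , _ , _) → u
    ; target       = λ (_ , v , _) → v
    ; _⌢_          = λ (_ , _ , es , _) (_ , _ , fs , _) → Coherent² graph es fs
    ; ⌢-refl       = λ { {_ , _ , _ , _ , coherent} → coherent }
    ; ⌢-sym        = λ { {_ , _ , es , _} {_ , _ , fs , _} → Coherent²-sym graph es fs }
    ; ⌢-irrelevant = All.irrelevant λ {e} →
                     All.irrelevant λ {f} → CohGraph.⌢-irrelevant graph {e} {f}
    }

module _ {S : System U} where
  open System S

  Coherent²-irrelevant : ∀ {es fs} → (c d : Coherent² graph es fs) → c ≡ d
  Coherent²-irrelevant = All.irrelevant λ {e} →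
    All.irrelevant λ {f} → CohGraph.⌢-irrelevant graph {e} {f}

  -- Axiom K identifies the endpoint equations, and `↝-irrelevant` the adjacency proofs; for this
  -- purpose it is a field of `System`.
  route-irrelevant : ∀ {u es v} → (p q : Route S u es v) → p ≡ q
  route-irrelevant (last a b)   (last c d)    = cong₂ last (uip a c) (uip b d)
  route-irrelevant (next a r p) (next b r′ q)
    rewrite uip a b | ↝-irrelevant r r′ | route-irrelevant p q = refl

  route-source : ∀ {u e es v} → Route S u (e ∷ es) v → s e ≡ u
  route-source (last a _)   = a
  route-source (next a _ _) = a

  Exec-≡ : {ι : I → U} {x y : Edge (Exec S ι)} → proj₁ x ≡ proj₁ y →
           proj₁ (proj₂ x) ≡ proj₁ (proj₂ y) →
           proj₁ (proj₂ (proj₂ x)) ≡ proj₁ (proj₂ (proj₂ y)) → x ≡ y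
  Exec-≡ {x = u , v , es , p , c} {_ , _ , _ , q , d} refl refl refl
    rewrite route-irrelevant p q | Coherent²-irrelevant {es} {es} c d = refl

  labels : {ι : I → U} → Edge (Exec S ι) → List E
  labels = proj₁ ∘ proj₂ ∘ proj₂

module _ {G H : CohGraph U} where

  path-≡ : ∀ {u v} {p q : Path (G □ H) u v} →
           toList (edges (G □ H) p) ≡ toList (edges (G □ H) q) → p ≡ q
  path-≡ {p = edge _ refl refl} {edge _ a b} eq with refl ← ∷-injectiveˡ eq | refl ← a | refl ← b = refl
  path-≡ {p = step _ refl refl p} {step _ a b q} eq
    with refl ← ∷-injectiveˡ eq | refl ← a | refl ← b = cong (step _ refl refl) (path-≡ (∷-injectiveʳ eq))

  path⇒route : ∀ {u v} (p : Path (G □ H) u v) → AlternatingPath G H p →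
               Route (plug G H) u (toList (edges (G □ H) p)) v
  path⇒route (edge e s t)   _       = last s t
  path⇒route (step e s refl p) (o ∷ a) = next s o (path⇒route p a)

  route⇒path : ∀ {u es v} → Route (plug G H) u es v →
               Σ[ p ∈ Path (G □ H) u v ] AlternatingPath G H p × toList (edges (G □ H) p) ≡ es
  route⇒path (last s t)   = edge _ s t , [-] , refl
  route⇒path (next {e = e} s o r) with route⇒path r
  ... | p , a , eq = step e s refl p
                   , subst (Linked Opposite) (cong (e ∷_) (sym eq)) (o ∷ subst (Linked Opposite) eq a)
                   , cong (e ∷_) eq

-- This replaces paths by routes once and for all. Routes carry alternation step by step and remain
-- meaningful for adjacency relations other than `Opposite`, which plugging three graphs requires.
∷∷≅Exec : (G : CohGraph (A ⊎ B)) (H : CohGraph (B ⊎ C)) →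
          G ∷∷ H ≅ Exec (plug (rename (Sum.map₂ inj₁) G) (rename inj₂ H)) (Sum.map₂ inj₂)
∷∷≅Exec {A} {B} {C} G H = mk≅ to injective surjective (λ _ → refl) (λ _ → refl) (λ _ _ → mk⇔ id id)
  where
  G′ = rename {W = A ⊎ B ⊎ C} (Sum.map₂ inj₁) G
  H′ = rename {W = A ⊎ B ⊎ C} inj₂ H
  X = Exec (plug G′ H′) (Sum.map₂ inj₂)

  to : Edge (G ∷∷ H) → Edge X
  to (u , v , p , a , c) = u , v , _ , path⇒route p a , c

  injective : Injective _≡_ _≡_ to
  injective {u , v , p , a , c} {u′ , v′ , q , b , d} eq
    with refl ← cong proj₁ eq | refl ← cong (proj₁ ∘ proj₂) eq
    with refl ← path-≡ {p = p} {q} (cong (proj₁ ∘ proj₂ ∘ proj₂) eq)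
    rewrite Linked.irrelevant (λ {e} {f} → Opposite-irrelevant {x = e} {y = f}) a b
          | Coherent²-irrelevant {S = plug G′ H′} c d = refl

  surjective : ∀ y → ∃ λ x → to x ≡ y
  surjective (u , v , es , r , c) with route⇒path r
  ... | p , a , refl = (u , v , p , a , c) , Exec-≡ refl refl refl

-- An isomorphism onto the part of S′ that is reachable from the image of j.
record Embedding (S : System U) (S′ : System U′) (j : U → U′) : Set where
  private
    module S = System S
    module S′ = System S′
  field
    on-edges    : S.E → S′.E
    on-source   : ∀ e → S′.s (on-edges e) ≡ j (S.s e)
    on-target   : ∀ e → S′.t (on-edges e) ≡ j (S.t e)
    injective-E : Injective _≡_ _≡_ on-edges
    injective-V : Injective _≡_ _≡_ j
    lift        : ∀ e′ u → S′.s e′ ≡ j u → ∃ λ e → on-edges e ≡ e′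
    -- Adjacency is compared only for edges that actually meet: regrouping graphs may change it for
    -- edges with disjoint sets of vertices.
    ↝⁺          : ∀ e f → S.t e ≡ S.s f → e S.↝ f → on-edges e S′.↝ on-edges f
    ↝⁻          : ∀ e f → S.t e ≡ S.s f → on-edges e S′.↝ on-edges f → e S.↝ f
    coherence   : ∀ e f → (e S.⌢ f) ⇔ (on-edges e S′.⌢ on-edges f)

  route⁺ : ∀ {u es v} → Route S u es v → Route S′ (j u) (List.map on-edges es) (j v)
  route⁺ (last {e = e} refl refl) = last (on-source e) (on-target e)
  route⁺ (next {e = e} {f} {es} refl r p) =
    next (on-source e) (↝⁺ e f (sym (route-source p)) r)
         (subst (λ w → Route S′ w (List.map on-edges (f ∷ es)) _) (sym (on-target e)) (route⁺ p))

  route⁻ : ∀ {u u′ es′ v′} → u′ ≡ j u → Route S′ u′ es′ v′ →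
           ∃₂ λ es v → List.map on-edges es ≡ es′ × j v ≡ v′ × Route S u es v
  route⁻ {u} u′≡ju (last {e = e′} a refl) with lift e′ u (trans a u′≡ju)
  ... | e , refl = e ∷ [] , _ , refl , sym (on-target e) ,
                   last (injective-V (trans (sym (on-source e)) (trans a u′≡ju))) refl
  route⁻ {u} u′≡ju (next {e = e′} a r p) with lift e′ u (trans a u′≡ju)
  ... | e , refl with route⁻ (on-target e) p
  ... | f ∷ es , v , refl , eq , q = e ∷ f ∷ es , v , refl , eq ,
    next (injective-V (trans (sym (on-source e)) (trans a u′≡ju)))
         (↝⁻ e f (sym (route-source q)) r) q

  coherent⁺ : ∀ {es fs} → Coherent² S.graph es fs →
              Coherent² S′.graph (List.map on-edges es) (List.map on-edges fs)
  coherent⁺ = All.map⁺ ∘ All.map λ {e} → All.map⁺ ∘ All.map λ {f} → Equivalence.to (coherence e f)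

  coherent⁻ : ∀ {es fs} → Coherent² S′.graph (List.map on-edges es) (List.map on-edges fs) →
              Coherent² S.graph es fs
  coherent⁻ = All.map (λ {e} → All.map (λ {f} → Equivalence.from (coherence e f)) ∘ All.map⁻) ∘ All.map⁻

  module _ {I I′ : Set} {ι : I → U} {ι′ : I′ → U′} {θ : I → I′}
           (commutes : j ∘ ι ≗ ι′ ∘ θ) (θ-injective : Injective _≡_ _≡_ θ) where

    exec⁺ : Edge (Exec S ι) → Edge (Exec S′ ι′)
    exec⁺ (u , v , es , p , c) = θ u , θ v , _ ,
      subst₂ (λ x y → Route S′ x _ y) (commutes u) (commutes v) (route⁺ p) , coherent⁺ c

    exec⁺-injective : Injective _≡_ _≡_ exec⁺
    exec⁺-injective eq = Exec-≡ (θ-injective (cong proj₁ eq)) (θ-injective (cong (proj₁ ∘ proj₂) eq))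
      (map-injective injective-E (cong (proj₁ ∘ proj₂ ∘ proj₂) eq))

    -- Starting in the image is enough: `lift` keeps the whole route inside, and the pullback
    -- condition turns its last vertex into one of the interface `I`. For one factor of a tensor `θ`
    -- is not onto, so the start has to be assumed.
    exec⁺-surjective : (∀ v i′ → j v ≡ ι′ i′ → ∃ λ i → θ i ≡ i′ × ι i ≡ v) →
                       ∀ y u → source (Exec S′ ι′) y ≡ θ u → ∃ λ x → exec⁺ x ≡ y
    exec⁺-surjective pullback (_ , v , es , p , c) u refl
      with route⁻ (sym (commutes u)) p
    ... | es , w , refl , eq , q with pullback w v eq
    ... | i , refl , refl = (u , i , es , q , coherent⁻ c) , Exec-≡ refl refl refl

    Exec-≅ : (θ⁻¹ : I′ → I) → (∀ i → θ (θ⁻¹ i) ≡ i) → rename θ (Exec S ι) ≅ Exec S′ ι′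
    Exec-≅ θ⁻¹ inverse = mk≅ exec⁺ exec⁺-injective
      (λ y → exec⁺-surjective (λ v i′ eq → θ⁻¹ i′ , inverse i′ ,
                injective-V (trans (trans (commutes _) (cong ι′ (inverse i′))) (sym eq)))
               y (θ⁻¹ (proj₁ y)) (sym (inverse (proj₁ y))))
      (λ _ → refl) (λ _ → refl) (λ _ _ → mk⇔ coherent⁺ coherent⁻)

-- Execution under isomorphism, reversal and tensor

∷∷-cong : {F F′ : CohGraph (A ⊎ B)} {G G′ : CohGraph (B ⊎ C)} →
          F ≅ F′ → G ≅ G′ → F ∷∷ G ≅ F′ ∷∷ G′
∷∷-cong {A} {B} {C} {F} {F′} {G} {G′} F≅F′ G≅G′ =
  ≅-trans (∷∷≅Exec F G) (≅-trans
    (Embedding.Exec-≅ relabel (λ _ → refl) id id (λ _ → refl))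
    (≅-sym (∷∷≅Exec F′ G′)))
  where
  iso : rename {W = A ⊎ B ⊎ C} (Sum.map₂ inj₁) F □ rename inj₂ G ≅
        rename (Sum.map₂ inj₁) F′ □ rename inj₂ G′
  iso = □-cong (rename-cong (Sum.map₂ inj₁) F≅F′) (rename-cong inj₂ G≅G′)
  open _≅_ iso
  open Inverse bijection

  relabel : Embedding (plug (rename {W = A ⊎ B ⊎ C} (Sum.map₂ inj₁) F) (rename inj₂ G))
                      (plug (rename (Sum.map₂ inj₁) F′) (rename inj₂ G′)) id
  relabel = record
    { on-edges    = to
    ; on-source   = source-≡
    ; on-target   = target-≡
    ; injective-E = λ {x} {y} eq → trans (sym (strictlyInverseʳ x)) (trans (cong from eq) (strictlyInverseʳ y))
    ; injective-V = id
    ; lift        = λ e′ _ _ → from e′ , strictlyInverseˡ e′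
    ; ↝⁺          = λ { (inj₁ _) (inj₂ _) _ o → o ; (inj₂ _) (inj₁ _) _ o → o }
    ; ↝⁻          = λ { (inj₁ _) (inj₂ _) _ o → o ; (inj₂ _) (inj₁ _) _ o → o }
    ; coherence   = coherence
    }

-- Plugging is symmetric, so exchanging the two graphs keeps each route in its direction and only
-- renames tags and vertices. Mirror images of one-sided laws of execution are obtained from this.
rev-∷∷ : (F : CohGraph (A ⊎ B)) (G : CohGraph (B ⊎ C)) →
         rename swap (F ∷∷ G) ≅ rename swap G ∷∷ rename swap F
rev-∷∷ {A} {B} {C} F G =
  ≅-trans (rename-cong swap (∷∷≅Exec F G)) (≅-trans
    (Embedding.Exec-≅ relabel (λ { (inj₁ _) → refl ; (inj₂ _) → refl })
       (λ {x} {y} eq → trans (sym (swap-involutive x)) (trans (cong swap eq) (swap-involutive y)))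
       swap swap-involutive)
    (≅-sym (∷∷≅Exec (rename swap G) (rename swap F))))
  where
  j : A ⊎ B ⊎ C → C ⊎ B ⊎ A
  j (inj₁ a)        = inj₂ (inj₂ a)
  j (inj₂ (inj₁ b)) = inj₂ (inj₁ b)
  j (inj₂ (inj₂ c)) = inj₁ c

  j-injective : ∀ x y → j x ≡ j y → x ≡ y
  j-injective (inj₁ _)        (inj₁ _)        refl = refl
  j-injective (inj₂ (inj₁ _)) (inj₂ (inj₁ _)) refl = refl
  j-injective (inj₂ (inj₂ _)) (inj₂ (inj₂ _)) refl = refl
  j-injective (inj₁ _)        (inj₂ (inj₁ _)) ()
  j-injective (inj₁ _)        (inj₂ (inj₂ _)) ()

  jF : ∀ x → inj₂ (swap x) ≡ j (Sum.map₂ inj₁ x)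
  jF (inj₁ _) = refl
  jF (inj₂ _) = refl

  jG : ∀ x → Sum.map₂ inj₁ (swap x) ≡ j (inj₂ x)
  jG (inj₁ _) = refl
  jG (inj₂ _) = refl

  relabel : Embedding (plug (rename {W = A ⊎ B ⊎ C} (Sum.map₂ inj₁) F) (rename inj₂ G))
                      (plug (rename (Sum.map₂ inj₁) (rename swap G)) (rename inj₂ (rename swap F))) j
  relabel = record
    { on-edges    = swap
    ; on-source   = [ jF ∘ source F , jG ∘ source G ]
    ; on-target   = [ jF ∘ target F , jG ∘ target G ]
    ; injective-E = λ {x} {y} eq → trans (sym (swap-involutive x)) (trans (cong swap eq) (swap-involutive y))
    ; injective-V = j-injective _ _
    ; lift        = λ e′ _ _ → swap e′ , swap-involutive e′
    ; ↝⁺          = λ { (inj₁ _) (inj₂ _) _ o → o ; (inj₂ _) (inj₁ _) _ o → o }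
    ; ↝⁻          = λ { (inj₁ _) (inj₂ _) _ o → o ; (inj₂ _) (inj₁ _) _ o → o }
    ; coherence   = λ { (inj₁ _) (inj₁ _) → mk⇔ id id ; (inj₁ _) (inj₂ _) → mk⇔ id id
                      ; (inj₂ _) (inj₁ _) → mk⇔ id id ; (inj₂ _) (inj₂ _) → mk⇔ id id }
    }

-- Neither tensor factor can be left along a route of the tensor.
⊗ᵍ-∷∷ : (F : CohGraph (A ⊎ B)) (G : CohGraph (B ⊎ C)) (F′ : CohGraph (A′ ⊎ B′)) (G′ : CohGraph (B′ ⊎ C′)) →
        rename interchange ((F ∷∷ G) ⊗ᵍ (F′ ∷∷ G′)) ≅
        rename interchange (F ⊗ᵍ F′) ∷∷ rename interchange (G ⊗ᵍ G′)
⊗ᵍ-∷∷ {A} {B} {C} {A′} {B′} {C′} F G F′ G′ =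
  ≅-trans (rename-cong interchange (□-cong (rename-cong inj₁ (∷∷≅Exec F G)) (rename-cong inj₂ (∷∷≅Exec F′ G′))))
    (≅-trans both (≅-sym (∷∷≅Exec (rename interchange (F ⊗ᵍ F′)) (rename interchange (G ⊗ᵍ G′)))))
  where
  S₁ = plug (rename {W = A ⊎ B ⊎ C} (Sum.map₂ inj₁) F) (rename inj₂ G)
  S₂ = plug (rename {W = A′ ⊎ B′ ⊎ C′} (Sum.map₂ inj₁) F′) (rename inj₂ G′)
  S  = plug (rename {W = (A ⊎ A′) ⊎ (B ⊎ B′) ⊎ (C ⊎ C′)} (Sum.map₂ inj₁) (rename interchange (F ⊗ᵍ F′)))
            (rename inj₂ (rename interchange (G ⊗ᵍ G′)))

  j₁ : A ⊎ B ⊎ C → (A ⊎ A′) ⊎ (B ⊎ B′) ⊎ (C ⊎ C′)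
  j₁ = Sum.map inj₁ (Sum.map inj₁ inj₁)

  j₂ : A′ ⊎ B′ ⊎ C′ → (A ⊎ A′) ⊎ (B ⊎ B′) ⊎ (C ⊎ C′)
  j₂ = Sum.map inj₂ (Sum.map inj₂ inj₂)

  F₁ : ∀ x → Sum.map₂ inj₁ (interchange (inj₁ x)) ≡ j₁ (Sum.map₂ inj₁ x)
  F₁ (inj₁ _) = refl
  F₁ (inj₂ _) = refl
  G₁ : ∀ x → inj₂ (interchange (inj₁ x)) ≡ j₁ (inj₂ x)
  G₁ (inj₁ _) = refl
  G₁ (inj₂ _) = refl
  F₂ : ∀ x → Sum.map₂ inj₁ (interchange (inj₂ x)) ≡ j₂ (Sum.map₂ inj₁ x)
  F₂ (inj₁ _) = refl
  F₂ (inj₂ _) = refl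
  G₂ : ∀ x → inj₂ (interchange (inj₂ x)) ≡ j₂ (inj₂ x)
  G₂ (inj₁ _) = refl
  G₂ (inj₂ _) = refl

  disjoint : ∀ x y → j₁ x ≡ j₂ y → ⊥
  disjoint (inj₁ _)        (inj₁ _)        ()
  disjoint (inj₂ (inj₁ _)) (inj₂ (inj₁ _)) ()
  disjoint (inj₂ (inj₂ _)) (inj₂ (inj₂ _)) ()

  left : Embedding S₁ S j₁
  left = record
    { on-edges    = Sum.map inj₁ inj₁
    ; on-source   = [ F₁ ∘ source F , G₁ ∘ source G ]
    ; on-target   = [ F₁ ∘ target F , G₁ ∘ target G ]
    ; injective-E = λ { {inj₁ _} {inj₁ _} refl → refl ; {inj₂ _} {inj₂ _} refl → refl }
    ; injective-V = λ { {inj₁ _} {inj₁ _} refl → refl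
                      ; {inj₂ (inj₁ _)} {inj₂ (inj₁ _)} refl → refl
                      ; {inj₂ (inj₂ _)} {inj₂ (inj₂ _)} refl → refl }
    ; lift        = λ { (inj₁ (inj₁ e)) _ _ → inj₁ e , refl
                      ; (inj₂ (inj₁ e)) _ _ → inj₂ e , refl
                      ; (inj₁ (inj₂ e)) u eq → ⊥-elim (disjoint u (Sum.map₂ inj₁ (source F′ e)) (trans (sym eq) (F₂ (source F′ e))))
                      ; (inj₂ (inj₂ e)) u eq → ⊥-elim (disjoint u (inj₂ (source G′ e)) (trans (sym eq) (G₂ (source G′ e)))) }
    ; ↝⁺          = λ { (inj₁ _) (inj₂ _) _ o → o ; (inj₂ _) (inj₁ _) _ o → o }
    ; ↝⁻          = λ { (inj₁ _) (inj₂ _) _ o → o ; (inj₂ _) (inj₁ _) _ o → o }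
    ; coherence   = λ { (inj₁ _) (inj₁ _) → mk⇔ id id ; (inj₁ _) (inj₂ _) → mk⇔ id id
                      ; (inj₂ _) (inj₁ _) → mk⇔ id id ; (inj₂ _) (inj₂ _) → mk⇔ id id }
    }

  right : Embedding S₂ S j₂
  right = record
    { on-edges    = Sum.map inj₂ inj₂
    ; on-source   = [ F₂ ∘ source F′ , G₂ ∘ source G′ ]
    ; on-target   = [ F₂ ∘ target F′ , G₂ ∘ target G′ ]
    ; injective-E = λ { {inj₁ _} {inj₁ _} refl → refl ; {inj₂ _} {inj₂ _} refl → refl }
    ; injective-V = λ { {inj₁ _} {inj₁ _} refl → refl
                      ; {inj₂ (inj₁ _)} {inj₂ (inj₁ _)} refl → refl
                      ; {inj₂ (inj₂ _)} {inj₂ (inj₂ _)} refl → refl }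
    ; lift        = λ { (inj₁ (inj₂ e)) _ _ → inj₁ e , refl
                      ; (inj₂ (inj₂ e)) _ _ → inj₂ e , refl
                      ; (inj₁ (inj₁ e)) u eq → ⊥-elim (disjoint (Sum.map₂ inj₁ (source F e)) u (trans (sym (F₁ (source F e))) eq))
                      ; (inj₂ (inj₁ e)) u eq → ⊥-elim (disjoint (inj₂ (source G e)) u (trans (sym (G₁ (source G e))) eq)) }
    ; ↝⁺          = λ { (inj₁ _) (inj₂ _) _ o → o ; (inj₂ _) (inj₁ _) _ o → o }
    ; ↝⁻          = λ { (inj₁ _) (inj₂ _) _ o → o ; (inj₂ _) (inj₁ _) _ o → o }
    ; coherence   = λ { (inj₁ _) (inj₁ _) → mk⇔ id id ; (inj₁ _) (inj₂ _) → mk⇔ id id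
                      ; (inj₂ _) (inj₁ _) → mk⇔ id id ; (inj₂ _) (inj₂ _) → mk⇔ id id }
    }

  module L = Embedding left
  module R = Embedding right

  ι₁ : A ⊎ C → A ⊎ B ⊎ C
  ι₁ = Sum.map₂ inj₂
  ι₂ : A′ ⊎ C′ → A′ ⊎ B′ ⊎ C′
  ι₂ = Sum.map₂ inj₂
  ι : (A ⊎ A′) ⊎ (C ⊎ C′) → (A ⊎ A′) ⊎ (B ⊎ B′) ⊎ (C ⊎ C′)
  ι = Sum.map₂ inj₂

  θ₁ : A ⊎ C → (A ⊎ A′) ⊎ (C ⊎ C′)
  θ₁ = interchange ∘ inj₁
  θ₂ : A′ ⊎ C′ → (A ⊎ A′) ⊎ (C ⊎ C′)
  θ₂ = interchange ∘ inj₂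

  commutes₁ : j₁ ∘ ι₁ ≗ ι ∘ θ₁
  commutes₁ (inj₁ _) = refl
  commutes₁ (inj₂ _) = refl
  commutes₂ : j₂ ∘ ι₂ ≗ ι ∘ θ₂
  commutes₂ (inj₁ _) = refl
  commutes₂ (inj₂ _) = refl

  θ₁-injective : Injective _≡_ _≡_ θ₁
  θ₁-injective {inj₁ _} {inj₁ _} refl = refl
  θ₁-injective {inj₂ _} {inj₂ _} refl = refl
  θ₂-injective : Injective _≡_ _≡_ θ₂
  θ₂-injective {inj₁ _} {inj₁ _} refl = refl
  θ₂-injective {inj₂ _} {inj₂ _} refl = refl

  θ-disjoint : ∀ x y → θ₁ x ≡ θ₂ y → ⊥
  θ-disjoint (inj₁ _) (inj₁ _) ()
  θ-disjoint (inj₂ _) (inj₂ _) ()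

  θ-cover : ∀ i → (∃ λ x → i ≡ θ₁ x) ⊎ (∃ λ x → i ≡ θ₂ x)
  θ-cover (inj₁ (inj₁ a)) = inj₁ (inj₁ a , refl)
  θ-cover (inj₁ (inj₂ a)) = inj₂ (inj₁ a , refl)
  θ-cover (inj₂ (inj₁ c)) = inj₁ (inj₂ c , refl)
  θ-cover (inj₂ (inj₂ c)) = inj₂ (inj₂ c , refl)

  exec₁ : Edge (Exec S₁ ι₁) → Edge (Exec S ι)
  exec₁ = L.exec⁺ commutes₁ θ₁-injective
  exec₂ : Edge (Exec S₂ ι₂) → Edge (Exec S ι)
  exec₂ = R.exec⁺ commutes₂ θ₂-injective

  to : Edge (Exec S₁ ι₁) ⊎ Edge (Exec S₂ ι₂) → Edge (Exec S ι)
  to = [ exec₁ , exec₂ ]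

  injective : Injective _≡_ _≡_ to
  injective {inj₁ x} {inj₁ y} eq = cong inj₁ (L.exec⁺-injective commutes₁ θ₁-injective eq)
  injective {inj₂ x} {inj₂ y} eq = cong inj₂ (R.exec⁺-injective commutes₂ θ₂-injective eq)
  injective {inj₁ x} {inj₂ y} eq = ⊥-elim (θ-disjoint (proj₁ x) (proj₁ y) (cong proj₁ eq))
  injective {inj₂ x} {inj₁ y} eq = ⊥-elim (θ-disjoint (proj₁ y) (proj₁ x) (cong proj₁ (sym eq)))

  surjective : ∀ y → ∃ λ x → to x ≡ y
  surjective y with θ-cover (proj₁ y)
  ... | inj₁ (u , eq) with L.exec⁺-surjective commutes₁ θ₁-injective
    (λ { (inj₁ _) (inj₁ (inj₁ _)) refl → inj₁ _ , refl , refl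
       ; (inj₂ (inj₂ _)) (inj₂ (inj₁ _)) refl → inj₂ _ , refl , refl }) y u eq
  ... | x , eq′ = inj₁ x , eq′
  surjective y | inj₂ (u , eq) with R.exec⁺-surjective commutes₂ θ₂-injective
    (λ { (inj₁ _) (inj₁ (inj₂ _)) refl → inj₁ _ , refl , refl
       ; (inj₂ (inj₂ _)) (inj₂ (inj₂ _)) refl → inj₂ _ , refl , refl }) y u eq
  ... | x , eq′ = inj₂ x , eq′

  separate : ∀ x y → Coh (System.graph S) (Sum.map inj₁ inj₁ x) (Sum.map inj₂ inj₂ y)
  separate (inj₁ _) (inj₁ _) = tt
  separate (inj₁ _) (inj₂ _) = tt
  separate (inj₂ _) (inj₁ _) = tt
  separate (inj₂ _) (inj₂ _) = tt

  separated : ∀ xs ys → Coherent² (System.graph S) (List.map L.on-edges xs) (List.map R.on-edges ys)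
  separated xs ys = All.map⁺ (All.universal (λ x → All.map⁺ (All.universal (separate x) ys)) xs)

  both : rename interchange (Exec S₁ ι₁ ⊗ᵍ Exec S₂ ι₂) ≅ Exec S ι
  both = mk≅ to injective surjective
    (λ { (inj₁ _) → refl ; (inj₂ _) → refl }) (λ { (inj₁ _) → refl ; (inj₂ _) → refl })
    λ { (inj₁ _) (inj₁ _) → mk⇔ L.coherent⁺ L.coherent⁻
      ; (inj₂ _) (inj₂ _) → mk⇔ R.coherent⁺ R.coherent⁻
      ; (inj₁ (_ , _ , xs , _)) (inj₂ (_ , _ , ys , _)) → mk⇔ (λ _ → separated xs ys) (λ _ → tt)
      ; (inj₂ (_ , _ , xs , _)) (inj₁ (_ , _ , ys , _)) →
          mk⇔ (λ _ → Coherent²-sym (System.graph S) _ _ (separated ys xs)) (λ _ → tt) }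

-- Associativity of execution

-- Lists of routes are never empty, so the first and last edge fix the ends. With an injective
-- interface, an edge of an execution is thus recovered from its labels alone.
route-endpoints : {S : System U} → ∀ {u es v u′ v′} → Route S u es v → Route S u′ es v′ → u ≡ u′ × v ≡ v′
route-endpoints (last a b)   (last c d)   = trans (sym a) c , trans (sym b) d
route-endpoints (next a _ p) (next b _ q) = trans (sym a) b , proj₂ (route-endpoints p q)

-- Executing S first and plugging the result with K amounts to executing
-- both at once: a route of the latter is uniquely cut into maximal routes
-- of S and edges of K. The square formed by ι₁, j, k₁, k₂ is a pullback:
-- the two parts can only meet in the vertices of the interface I₁.
module Nest {U₁ I₁ M U : Set} (S : System U₁) (ι₁ : I₁ → U₁) (K : CohGraph M)
            (j : I₁ → M) (k₁ : U₁ → U) (k₂ : M → U) (commutes : k₁ ∘ ι₁ ≗ k₂ ∘ j)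
            (k₁-injective : Injective _≡_ _≡_ k₁) (k₂-injective : Injective _≡_ _≡_ k₂)
            (ι₁-injective : Injective _≡_ _≡_ ι₁)
            (pullback : ∀ a m → k₁ a ≡ k₂ m → ∃ λ i → ι₁ i ≡ a × j i ≡ m) where

  open System S using (E; s; t; _↝_; ↝-irrelevant) renaming (graph to H)

  X : CohGraph I₁
  X = Exec S ι₁

  nested : System M
  nested = plug (rename j X) K

  -- Between edges of `S` adjacency is inherited rather than alternation with `K`, since a segment
  -- of `S` becomes a single edge of `X`. Two edges of `K` in a row stay forbidden, as in the nested
  -- system.
  flat : System U
  flat = record
    { graph        = rename k₁ H □ rename k₂ K
    ; _↝_          = _⇝_
    ; ↝-irrelevant = λ {e} {f} → irrelevant e f
    }
    where
    _⇝_ : Rel (E ⊎ Edge K) 0ℓ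
    inj₁ e ⇝ inj₁ f = e ↝ f
    inj₁ _ ⇝ inj₂ _ = ⊤
    inj₂ _ ⇝ inj₁ _ = ⊤
    inj₂ _ ⇝ inj₂ _ = ⊥

    irrelevant : ∀ e f (p q : e ⇝ f) → p ≡ q
    irrelevant (inj₁ _) (inj₁ _) = ↝-irrelevant
    irrelevant (inj₁ _) (inj₂ _) = λ _ _ → refl
    irrelevant (inj₂ _) (inj₁ _) = λ _ _ → refl

  label : Edge X ⊎ Edge K → List (E ⊎ Edge K)
  label (inj₁ x) = List.map inj₁ (labels {S = S} {ι = ι₁} x)
  label (inj₂ e) = inj₂ e ∷ []

  flatten : List (Edge X ⊎ Edge K) → List (E ⊎ Edge K)
  flatten = concatMap label

  embed : ∀ {u es v} → Route S u es v → Route flat (k₁ u) (List.map inj₁ es) (k₁ v)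
  embed (last refl refl) = last refl refl
  embed (next refl r p)  = next refl r (embed p)

  join : ∀ {u es v e fs w} → Route S u es v → Route flat (k₁ v) (inj₂ e ∷ fs) w →
         Route flat (k₁ u) (List.map inj₁ es ++ inj₂ e ∷ fs) w
  join (last refl refl) q = next refl tt q
  join (next refl r p)  q = next refl r (join p q)

  flatten⁺ : ∀ {u ns v} → Route nested u ns v → Route flat (k₂ u) (flatten ns) (k₂ v)
  flatten⁺ (last {e = inj₁ (a , b , es , r , c)} refl refl) =
    subst₂ (λ x y → Route flat x (flatten (inj₁ (a , b , es , r , c) ∷ [])) y) (commutes a) (commutes b)
      (subst (λ fs → Route flat (k₁ (ι₁ a)) fs (k₁ (ι₁ b))) (sym (++-identityʳ _)) (embed r))
  flatten⁺ (last {e = inj₂ _} refl refl) = last refl refl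
  flatten⁺ {v = v} (next {e = inj₁ (a , b , es , r , _)} {inj₂ f} {ns} refl _ p) =
    subst (λ x → Route flat x (List.map inj₁ es ++ flatten (inj₂ f ∷ ns)) (k₂ v)) (commutes a)
      (join r (subst (λ x → Route flat x (flatten (inj₂ f ∷ ns)) (k₂ v)) (sym (commutes b)) (flatten⁺ p)))
  flatten⁺ (next {e = inj₂ e} {inj₁ (_ , _ , _ ∷ _ , _)} refl _ p) = next refl tt (flatten⁺ p)

  private
    NoSegment : List (E ⊎ Edge K) → Set
    NoSegment (inj₁ _ ∷ _) = ⊥
    NoSegment _            = ⊤

    -- The end of a segment is visible in the flat list: alternation forbids two segments in a row,
    -- so what follows is empty or begins with an edge of `K`. Hence the cut is unique.
    segment-≡ : ∀ es fs {gs hs} → NoSegment gs → NoSegment hs →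
                List.map inj₁ es ++ gs ≡ List.map inj₁ fs ++ hs → es ≡ fs × gs ≡ hs
    segment-≡ []       []       _  _  eq   = refl , eq
    segment-≡ []       (_ ∷ _)  () _  refl
    segment-≡ (_ ∷ _)  []       _  () refl
    segment-≡ (_ ∷ es) (_ ∷ fs) p  q  eq with refl ← ∷-injectiveˡ eq =
      let es≡fs , gs≡hs = segment-≡ es fs p q (∷-injectiveʳ eq) in cong (_ ∷_) es≡fs , gs≡hs

    noSegment : ∀ {x} ns → Linked Opposite (inj₁ x ∷ ns) → NoSegment (flatten ns)
    noSegment []           _ = tt
    noSegment (inj₂ _ ∷ _) _ = tt
    noSegment (inj₁ _ ∷ _) (() ∷ _)

    tail : ∀ {n ns} → Linked (Opposite {Edge X} {Edge K}) (n ∷ ns) → Linked Opposite ns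
    tail [-]     = []
    tail (_ ∷ l) = l

  route⇒linked : ∀ {u ns v} → Route nested u ns v → Linked Opposite ns
  route⇒linked (last _ _)   = [-]
  route⇒linked (next _ o p) = o ∷ route⇒linked p

  flatten-injective : ∀ ns ms → Linked Opposite ns → Linked Opposite ms → flatten ns ≡ flatten ms → ns ≡ ms
  flatten-injective []            []            _ _ _ = refl
  flatten-injective (inj₂ _ ∷ ns) (inj₂ _ ∷ ms) p q eq =
    cong₂ _∷_ (cong inj₂ (inj₂-injective (∷-injectiveˡ eq)))
              (flatten-injective ns ms (tail p) (tail q) (∷-injectiveʳ eq))
  flatten-injective (inj₁ x@(_ , _ , es , r , _) ∷ ns) (inj₁ y@(_ , _ , fs , r′ , _) ∷ ms) p q eq
    with segment-≡ es fs (noSegment ns p) (noSegment ms q) eq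
  ... | refl , eq′ = cong₂ _∷_
    (cong inj₁ (Exec-≡ {S = S} {ι = ι₁} (ι₁-injective (proj₁ (route-endpoints r r′)))
                       (ι₁-injective (proj₂ (route-endpoints r r′))) refl))
    (flatten-injective ns ms (tail p) (tail q) eq′)
  flatten-injective [] (inj₁ (_ , _ , _ ∷ _ , _) ∷ _) _ _ ()
  flatten-injective (inj₁ (_ , _ , _ ∷ _ , _) ∷ _) [] _ _ ()
  flatten-injective (inj₁ (_ , _ , _ ∷ _ , _) ∷ _) (inj₂ _ ∷ _) _ _ ()
  flatten-injective (inj₂ _ ∷ _) (inj₁ (_ , _ , _ ∷ _ , _) ∷ _) _ _ ()

  coherent-label : ∀ n m → Coh (System.graph nested) n m ⇔ Coherent² (System.graph flat) (label n) (label m)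
  coherent-label (inj₁ _) (inj₁ _) = mk⇔ (All.map⁺ ∘ All.map All.map⁺) (All.map All.map⁻ ∘ All.map⁻)
  coherent-label (inj₁ (_ , _ , es , _)) (inj₂ _) = mk⇔ (λ _ → All.map⁺ (All.universal (λ _ → tt ∷ []) es)) (λ _ → tt)
  coherent-label (inj₂ _) (inj₁ (_ , _ , es , _)) = mk⇔ (λ _ → All.map⁺ (All.universal (λ _ → tt) es) ∷ []) (λ _ → tt)
  coherent-label (inj₂ _) (inj₂ _) = mk⇔ (λ c → (c ∷ []) ∷ []) (λ { ((c ∷ []) ∷ []) → c })

  coherent-flatten : ∀ ns ms → Coherent² (System.graph nested) ns ms ⇔
                               Coherent² (System.graph flat) (flatten ns) (flatten ms)
  coherent-flatten ns ms = mk⇔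
    -- `All-swap` exchanges the two quantifiers, so that concatenation is treated in one argument
    -- and then in the other.
    (All.concat⁺ ∘ All.map⁺ ∘ All.map (λ {n} → All.map (All.concat⁺ ∘ All.map⁺) ∘ All.All-swap ∘
       All.map (λ {m} → Equivalence.to (coherent-label n m))))
    (All.map (λ {n} → All.map (λ {m} → Equivalence.from (coherent-label n m)) ∘ All.All-swap ∘
       All.map (All.map⁻ ∘ All.concat⁻)) ∘ All.map⁻ ∘ All.concat⁻)

  -- What remains of a route after a segment in S has been cut off at w.
  data After (w : U) : List (Edge X ⊎ Edge K) → M → Set where
    stop : ∀ {v} → w ≡ k₂ v → After w [] v
    go   : ∀ {m e ns v} → w ≡ k₂ m → Route nested m (inj₂ e ∷ ns) v → After w (inj₂ e ∷ ns) v

  -- The leading segment stays open, as a bare route of `S` instead of an edge of `X`: an edge of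
  -- `S` in front may still prolong it, and its start may lie outside the interface.
  Segmentation : U → List (E ⊎ Edge K) → M → Set
  Segmentation u es v = ∃₂ λ xs ns → es ≡ List.map inj₁ xs ++ flatten ns ×
    ((xs ≡ [] × After u ns v) ⊎ ∃₂ λ a b → k₁ a ≡ u × Route S a xs b × After (k₁ b) ns v)

  -- A segment bounded on both sides by edges of `K` or by the ends of the whole route begins and
  -- ends at vertices common to `k₁` and `k₂`. The pullback places these in the interface.
  close : ∀ {a xs b m m′} → Route S a xs b → Coherent² H xs xs → k₁ a ≡ k₂ m → k₁ b ≡ k₂ m′ →
          Σ[ x ∈ Edge X ] labels {S = S} {ι = ι₁} x ≡ xs × j (source X x) ≡ m × j (target X x) ≡ m′
  close r c p q with pullback _ _ p | pullback _ _ q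
  ... | i , refl , p′ | i′ , refl , q′ = (i , i′ , _ , r , c) , refl , p′ , q′

  prefix : ∀ xs {gs} → Coherent² (System.graph flat) (List.map inj₁ xs ++ gs) (List.map inj₁ xs ++ gs) →
           Coherent² H xs xs
  prefix xs c = All.map (All.map⁻ ∘ All.++⁻ˡ (List.map inj₁ xs)) (All.map⁻ (All.++⁻ˡ (List.map inj₁ xs) c))

  close-after : ∀ {m a xs b ns v} → Route S a xs b → Coherent² H xs xs → k₁ a ≡ k₂ m → After (k₁ b) ns v →
                Σ[ x ∈ Edge X ] labels {S = S} {ι = ι₁} x ≡ xs × Route nested m (inj₁ x ∷ ns) v
  close-after r c p (stop q) with close r c p q
  ... | x , eq , refl , refl = x , eq , last refl refl
  close-after r c p (go q p′) with close r c p q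
  ... | x , eq , refl , refl = x , eq , next refl tt p′

  segmentation : ∀ {u es v} → Route flat u es (k₂ v) → Coherent² (System.graph flat) es es → Segmentation u es v
  segmentation (last {e = inj₁ e} refl q) _ = e ∷ [] , [] , refl , inj₂ (_ , _ , refl , last refl refl , stop q)
  segmentation (last {e = inj₂ e} refl q) _ =
    [] , inj₂ e ∷ [] , refl , inj₁ (refl , go refl (last refl (k₂-injective q)))
  segmentation (next {e = inj₁ e} refl r p) (_ ∷ c) with segmentation p (All.map All.tail c)
  ... | [] , ns , eq , inj₁ (_ , after) = e ∷ [] , ns , cong (inj₁ e ∷_) eq , inj₂ (_ , _ , refl , last refl refl , after)
  ... | f ∷ xs , ns , refl , inj₂ (a , b , p′ , q , after) with refl ← k₁-injective p′ =
    e ∷ f ∷ xs , ns , refl , inj₂ (_ , _ , refl , next refl r q , after)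
  segmentation (next {e = inj₂ e} refl r p) (_ ∷ c) with segmentation p (All.map All.tail c)
  ... | [] , [] , () , inj₁ _
  ... | [] , inj₂ _ ∷ _ , refl , inj₁ _ = ⊥-elim r
  -- The edge of `K` in front fixes the start of the open segment, which now becomes an edge of `X`.
  ... | f ∷ xs , ns , refl , inj₂ (a , b , p′ , q , after)
    with close-after q (prefix (f ∷ xs) (All.map All.tail c)) p′ after
  ... | x , refl , q′ = [] , inj₂ e ∷ inj₁ x ∷ ns , refl , inj₁ (refl , go refl (next refl tt q′))

  unflatten : ∀ {u es v} → Route flat (k₂ u) es (k₂ v) → Coherent² (System.graph flat) es es →
              ∃ λ ns → flatten ns ≡ es × Route nested u ns v
  unflatten p c with segmentation p c
  ... | [] , inj₂ e ∷ ns , refl , inj₁ (_ , go eq q) with refl ← k₂-injective eq = inj₂ e ∷ ns , refl , q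
  unflatten (last _ _) c | [] , [] , () , inj₁ _
  unflatten (next _ _ _) c | [] , [] , () , inj₁ _
  unflatten p c | f ∷ xs , ns , refl , inj₂ (a , b , p′ , q , after) with close-after q (prefix (f ∷ xs) c) p′ after
  ... | x , refl , q′ = inj₁ x ∷ ns , refl , q′

  Exec-flatten : (ι : I → M) → Exec nested ι ≅ Exec flat (k₂ ∘ ι)
  Exec-flatten ι = mk≅
    (λ (u , v , ns , p , c) → u , v , flatten ns , flatten⁺ p , Equivalence.to (coherent-flatten ns ns) c)
    (λ { {_ , _ , ns , p , _} {_ , _ , ms , q , _} eq → Exec-≡ (cong proj₁ eq) (cong (proj₁ ∘ proj₂) eq)
           (flatten-injective ns ms (route⇒linked p) (route⇒linked q) (cong (proj₁ ∘ proj₂ ∘ proj₂) eq)) })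
    surjective (λ _ → refl) (λ _ → refl)
    (λ { (_ , _ , ns , _) (_ , _ , ms , _) → coherent-flatten ns ms })
    where
    surjective : ∀ y → _
    surjective (u , v , es , p , c) with unflatten p c
    ... | ns , refl , q = (u , v , ns , q , Equivalence.from (coherent-flatten ns ns) c) , Exec-≡ refl refl refl

retraction⇒injective : {f : V → W} (g : W → V) → (∀ x → g (f x) ≡ x) → Injective _≡_ _≡_ f
retraction⇒injective g g∘f≗id {x} {y} eq = trans (sym (g∘f≗id x)) (trans (cong g eq) (g∘f≗id y))

module TripleInterface {A B C D : Set} where

  inner : A ⊎ C → A ⊎ B ⊎ C
  inner = Sum.map₂ inj₂

  left : A ⊎ C → A ⊎ C ⊎ D
  left = Sum.map₂ inj₁

  from-left : A ⊎ B ⊎ C → A ⊎ B ⊎ C ⊎ D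
  from-left = Sum.map₂ (Sum.map₂ inj₁)

  from-right : A ⊎ C ⊎ D → A ⊎ B ⊎ C ⊎ D
  from-right = Sum.map₂ inj₂

  commutes : from-left ∘ inner ≗ from-right ∘ left
  commutes (inj₁ _) = refl
  commutes (inj₂ _) = refl

  from-left-injective : Injective _≡_ _≡_ from-left
  from-left-injective {inj₁ _}        {inj₁ _}        refl = refl
  from-left-injective {inj₂ (inj₁ _)} {inj₂ (inj₁ _)} refl = refl
  from-left-injective {inj₂ (inj₂ _)} {inj₂ (inj₂ _)} refl = refl

  from-right-injective : Injective _≡_ _≡_ from-right
  from-right-injective {inj₁ _} {inj₁ _} refl = refl
  from-right-injective {inj₂ _} {inj₂ _} refl = refl

  inner-injective : Injective _≡_ _≡_ inner
  inner-injective {inj₁ _} {inj₁ _} refl = refl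
  inner-injective {inj₂ _} {inj₂ _} refl = refl

  pullback : ∀ v w → from-left v ≡ from-right w → ∃ λ i → inner i ≡ v × left i ≡ w
  pullback (inj₁ a)        (inj₁ _) refl = inj₁ a , refl , refl
  pullback (inj₂ (inj₂ c)) (inj₂ _) refl = inj₂ c , refl , refl

module Triple {A B C D : Set} (F : CohGraph (A ⊎ B)) (G : CohGraph (B ⊎ C)) (H : CohGraph (C ⊎ D)) where

  open TripleInterface {A} {B} {C} {D}
  open Nest (plug (rename (Sum.map₂ inj₁) F) (rename inj₂ G)) inner (rename inj₂ H) left from-left from-right
            commutes from-left-injective from-right-injective inner-injective pullback
    public using (flat; Exec-flatten)

  outer : A ⊎ D → A ⊎ B ⊎ C ⊎ D
  outer = Sum.map₂ (inj₂ ∘ inj₂)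

  ∷∷-∷∷≅Exec : (F ∷∷ G) ∷∷ H ≅ Exec flat outer
  ∷∷-∷∷≅Exec = ≅-trans (∷∷-cong (∷∷≅Exec F G) ≅-refl)
    (≅-trans (∷∷≅Exec (Exec (plug (rename (Sum.map₂ inj₁) F) (rename inj₂ G)) (Sum.map₂ inj₂)) H)
    (≅-trans (Exec-flatten (Sum.map₂ inj₂))
    (Exec-ι)))
    where
    -- The two interface maps agree only pointwise, so the identity embedding mediates between them.
    Exec-ι : Exec flat (Sum.map₂ inj₂ ∘ Sum.map₂ inj₂) ≅ Exec flat outer
    Exec-ι = Embedding.Exec-≅ (record
      { on-edges = id ; on-source = λ _ → refl ; on-target = λ _ → refl
      ; injective-E = id ; injective-V = id ; lift = λ e _ _ → e , refl
      ; ↝⁺ = λ _ _ _ → id ; ↝⁻ = λ _ _ _ → id ; coherence = λ _ _ → mk⇔ id id })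
      (λ { (inj₁ _) → refl ; (inj₂ _) → refl }) id id (λ _ → refl)

module _ (F : CohGraph (A ⊎ B)) (G : CohGraph (B ⊎ C)) (H : CohGraph (C ⊎ D)) where
  private
    module T = Triple F G H
    module R = Triple (rename swap H) (rename swap G) (rename swap F)

    j : D ⊎ C ⊎ B ⊎ A → A ⊎ B ⊎ C ⊎ D
    j (inj₁ d)               = inj₂ (inj₂ (inj₂ d))
    j (inj₂ (inj₁ c))        = inj₂ (inj₂ (inj₁ c))
    j (inj₂ (inj₂ (inj₁ b))) = inj₂ (inj₁ b)
    j (inj₂ (inj₂ (inj₂ a))) = inj₁ a

    j⁻¹ : A ⊎ B ⊎ C ⊎ D → D ⊎ C ⊎ B ⊎ A
    j⁻¹ (inj₁ a)               = inj₂ (inj₂ (inj₂ a))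
    j⁻¹ (inj₂ (inj₁ b))        = inj₂ (inj₂ (inj₁ b))
    j⁻¹ (inj₂ (inj₂ (inj₁ c))) = inj₂ (inj₁ c)
    j⁻¹ (inj₂ (inj₂ (inj₂ d))) = inj₁ d

    j⁻¹∘j : ∀ x → j⁻¹ (j x) ≡ x
    j⁻¹∘j (inj₁ _)               = refl
    j⁻¹∘j (inj₂ (inj₁ _))        = refl
    j⁻¹∘j (inj₂ (inj₂ (inj₁ _))) = refl
    j⁻¹∘j (inj₂ (inj₂ (inj₂ _))) = refl

    turn : ∀ {X Y Z : Set} → (X ⊎ Y) ⊎ Z → (Z ⊎ Y) ⊎ X
    turn (inj₁ (inj₁ x)) = inj₂ x
    turn (inj₁ (inj₂ y)) = inj₁ (inj₂ y)
    turn (inj₂ z)        = inj₁ (inj₁ z)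

    turn-involutive : ∀ {X Y Z : Set} (x : (X ⊎ Y) ⊎ Z) → turn (turn x) ≡ x
    turn-involutive (inj₁ (inj₁ _)) = refl
    turn-involutive (inj₁ (inj₂ _)) = refl
    turn-involutive (inj₂ _)        = refl

    jH : ∀ x → Sum.map₂ inj₂ (inj₂ x) ≡ j (Sum.map₂ (Sum.map₂ inj₁) (Sum.map₂ inj₁ (swap x)))
    jH (inj₁ _) = refl
    jH (inj₂ _) = refl

    jG : ∀ x → Sum.map₂ (Sum.map₂ inj₁) (inj₂ x) ≡ j (Sum.map₂ (Sum.map₂ inj₁) (inj₂ (swap x)))
    jG (inj₁ _) = refl
    jG (inj₂ _) = refl

    jF : ∀ x → Sum.map₂ (Sum.map₂ inj₁) (Sum.map₂ inj₁ x) ≡ j (Sum.map₂ inj₂ (inj₂ (swap x)))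
    jF (inj₁ _) = refl
    jF (inj₂ _) = refl

    reversal : Embedding R.flat T.flat j
    reversal = record
      { on-edges    = turn
      ; on-source   = [ [ jH ∘ source H , jG ∘ source G ] , jF ∘ source F ]
      ; on-target   = [ [ jH ∘ target H , jG ∘ target G ] , jF ∘ target F ]
      ; injective-E = retraction⇒injective turn turn-involutive
      ; injective-V = retraction⇒injective j⁻¹ j⁻¹∘j
      ; lift        = λ e _ _ → turn e , turn-involutive e
      ; ↝⁺          = λ { (inj₁ (inj₁ _)) (inj₁ (inj₂ _)) _ r → tt
                        ; (inj₁ (inj₂ _)) (inj₁ (inj₁ _)) _ r → tt
                        ; (inj₁ (inj₁ _)) (inj₂ _)        _ r → tt
                        ; (inj₁ (inj₂ _)) (inj₂ _)        _ r → tt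
                        ; (inj₂ _)        (inj₁ (inj₁ _)) _ r → tt
                        ; (inj₂ _)        (inj₁ (inj₂ _)) _ r → tt }
      ; ↝⁻          = λ { (inj₁ (inj₁ _)) (inj₁ (inj₂ _)) _ r → tt
                        ; (inj₁ (inj₂ _)) (inj₁ (inj₁ _)) _ r → tt
                        ; (inj₁ (inj₁ _)) (inj₂ _)        _ r → tt
                        ; (inj₁ (inj₂ _)) (inj₂ _)        _ r → tt
                        ; (inj₂ _)        (inj₁ (inj₁ _)) _ r → tt
                        ; (inj₂ _)        (inj₁ (inj₂ _)) _ r → tt }
      ; coherence   = λ { (inj₁ (inj₁ _)) (inj₁ (inj₁ _)) → mk⇔ id id
                        ; (inj₁ (inj₁ _)) (inj₁ (inj₂ _)) → mk⇔ id id
                        ; (inj₁ (inj₁ _)) (inj₂ _)        → mk⇔ id id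
                        ; (inj₁ (inj₂ _)) (inj₁ (inj₁ _)) → mk⇔ id id
                        ; (inj₁ (inj₂ _)) (inj₁ (inj₂ _)) → mk⇔ id id
                        ; (inj₁ (inj₂ _)) (inj₂ _)        → mk⇔ id id
                        ; (inj₂ _)        (inj₁ (inj₁ _)) → mk⇔ id id
                        ; (inj₂ _)        (inj₁ (inj₂ _)) → mk⇔ id id
                        ; (inj₂ _)        (inj₂ _)        → mk⇔ id id }
      }

  -- Only left-nested executions are flattened directly. The right-nested one is mirrored by
  -- `rev-∷∷`, which makes it left-nested, then flattened and turned back. In both flat systems
  -- edges may follow each other exactly when they come from different graphs among the three.
  ∷∷-assoc : F ∷∷ (G ∷∷ H) ≅ (F ∷∷ G) ∷∷ H
  ∷∷-assoc =
    ≅-trans (rename-≗ (F ∷∷ (G ∷∷ H)) (sym ∘ swap-involutive)) (≅-trans (rename-cong swap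
      (≅-trans (rev-∷∷ F (G ∷∷ H)) (≅-trans (∷∷-cong (rev-∷∷ G H) ≅-refl) R.∷∷-∷∷≅Exec)))
    (≅-trans (Embedding.Exec-≅ reversal (λ { (inj₁ _) → refl ; (inj₂ _) → refl })
                (retraction⇒injective swap swap-involutive) swap swap-involutive)
    (≅-sym T.∷∷-∷∷≅Exec)))

-- Execution and currying

assocˡʳ : (x : A ⊎ (B ⊎ C)) → assocʳ {A = A} {B = B} {C = C} (assocˡ x) ≡ x
assocˡʳ (inj₁ _)        = refl
assocˡʳ (inj₂ (inj₁ _)) = refl
assocˡʳ (inj₂ (inj₂ _)) = refl

assocʳˡ : (x : (A ⊎ B) ⊎ C) → assocˡ {A = A} {B = B} {C = C} (assocʳ x) ≡ x
assocʳˡ (inj₁ (inj₁ _)) = refl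
assocʳˡ (inj₁ (inj₂ _)) = refl
assocʳˡ (inj₂ _)        = refl

-- On both sides x, y and z are plugged with f simultaneously.
module _ (x : CohGraph (A′ ⊎ A)) (y : CohGraph (B′ ⊎ B)) (z : CohGraph (C′ ⊎ C))
         (f : CohGraph ((A ⊎ B) ⊎ C)) where
  private
    module T = Triple (rename interchange (x ⊗ᵍ y)) f (rename swap z)
    module R = Triple x (rename assocʳ f) (rename swap (rename interchange (y ⊗ᵍ z)))

    j : (A′ ⊎ B′) ⊎ (A ⊎ B) ⊎ C ⊎ C′ → A′ ⊎ A ⊎ (B ⊎ C) ⊎ (B′ ⊎ C′)
    j (inj₁ (inj₁ x′))        = inj₁ x′
    j (inj₁ (inj₂ y′))        = inj₂ (inj₂ (inj₂ (inj₁ y′)))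
    j (inj₂ (inj₁ (inj₁ x)))  = inj₂ (inj₁ x)
    j (inj₂ (inj₁ (inj₂ y)))  = inj₂ (inj₂ (inj₁ (inj₁ y)))
    j (inj₂ (inj₂ (inj₁ z)))  = inj₂ (inj₂ (inj₁ (inj₂ z)))
    j (inj₂ (inj₂ (inj₂ z′))) = inj₂ (inj₂ (inj₂ (inj₂ z′)))

    j⁻¹ : A′ ⊎ A ⊎ (B ⊎ C) ⊎ (B′ ⊎ C′) → (A′ ⊎ B′) ⊎ (A ⊎ B) ⊎ C ⊎ C′
    j⁻¹ (inj₁ x′)                      = inj₁ (inj₁ x′)
    j⁻¹ (inj₂ (inj₂ (inj₂ (inj₁ y′)))) = inj₁ (inj₂ y′)
    j⁻¹ (inj₂ (inj₁ x))                = inj₂ (inj₁ (inj₁ x))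
    j⁻¹ (inj₂ (inj₂ (inj₁ (inj₁ y))))  = inj₂ (inj₁ (inj₂ y))
    j⁻¹ (inj₂ (inj₂ (inj₁ (inj₂ z))))  = inj₂ (inj₂ (inj₁ z))
    j⁻¹ (inj₂ (inj₂ (inj₂ (inj₂ z′)))) = inj₂ (inj₂ (inj₂ z′))

    j⁻¹∘j : ∀ v → j⁻¹ (j v) ≡ v
    j⁻¹∘j (inj₁ (inj₁ _))        = refl
    j⁻¹∘j (inj₁ (inj₂ _))        = refl
    j⁻¹∘j (inj₂ (inj₁ (inj₁ _))) = refl
    j⁻¹∘j (inj₂ (inj₁ (inj₂ _))) = refl
    j⁻¹∘j (inj₂ (inj₂ (inj₁ _))) = refl
    j⁻¹∘j (inj₂ (inj₂ (inj₂ _))) = refl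

    φ : ∀ {P Q R S : Set} → ((P ⊎ Q) ⊎ R) ⊎ S → (P ⊎ R) ⊎ (Q ⊎ S)
    φ (inj₁ (inj₁ (inj₁ e))) = inj₁ (inj₁ e)
    φ (inj₁ (inj₁ (inj₂ e))) = inj₂ (inj₁ e)
    φ (inj₁ (inj₂ e))        = inj₁ (inj₂ e)
    φ (inj₂ e)               = inj₂ (inj₂ e)

    φ⁻¹ : ∀ {P Q R S : Set} → (P ⊎ R) ⊎ (Q ⊎ S) → ((P ⊎ Q) ⊎ R) ⊎ S
    φ⁻¹ (inj₁ (inj₁ e)) = inj₁ (inj₁ (inj₁ e))
    φ⁻¹ (inj₂ (inj₁ e)) = inj₁ (inj₁ (inj₂ e))
    φ⁻¹ (inj₁ (inj₂ e)) = inj₁ (inj₂ e)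
    φ⁻¹ (inj₂ (inj₂ e)) = inj₂ e

    φ⁻¹∘φ : ∀ {P Q R S : Set} (e : ((P ⊎ Q) ⊎ R) ⊎ S) → φ⁻¹ (φ e) ≡ e
    φ⁻¹∘φ (inj₁ (inj₁ (inj₁ _))) = refl
    φ⁻¹∘φ (inj₁ (inj₁ (inj₂ _))) = refl
    φ⁻¹∘φ (inj₁ (inj₂ _))        = refl
    φ⁻¹∘φ (inj₂ _)               = refl

    φ∘φ⁻¹ : ∀ {P Q R S : Set} (e : (P ⊎ R) ⊎ (Q ⊎ S)) → φ {P} {Q} {R} {S} (φ⁻¹ e) ≡ e
    φ∘φ⁻¹ (inj₁ (inj₁ _)) = refl
    φ∘φ⁻¹ (inj₂ (inj₁ _)) = refl
    φ∘φ⁻¹ (inj₁ (inj₂ _)) = refl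
    φ∘φ⁻¹ (inj₂ (inj₂ _)) = refl

    x₁ : A′ ⊎ A → (A′ ⊎ B′) ⊎ (A ⊎ B) ⊎ C ⊎ C′
    x₁ v = Sum.map₂ (Sum.map₂ inj₁) (Sum.map₂ inj₁ (interchange (inj₁ v)))
    y₁ : B′ ⊎ B → (A′ ⊎ B′) ⊎ (A ⊎ B) ⊎ C ⊎ C′
    y₁ v = Sum.map₂ (Sum.map₂ inj₁) (Sum.map₂ inj₁ (interchange (inj₂ v)))
    f₁ : (A ⊎ B) ⊎ C → (A′ ⊎ B′) ⊎ (A ⊎ B) ⊎ C ⊎ C′
    f₁ v = Sum.map₂ (Sum.map₂ inj₁) (inj₂ v)
    z₁ : C′ ⊎ C → (A′ ⊎ B′) ⊎ (A ⊎ B) ⊎ C ⊎ C′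
    z₁ v = Sum.map₂ inj₂ (inj₂ (swap v))

    jx : ∀ v → Sum.map₂ (Sum.map₂ inj₁) (Sum.map₂ inj₁ v) ≡ j (x₁ v)
    jx (inj₁ _) = refl
    jx (inj₂ _) = refl
    jy : ∀ v → Sum.map₂ inj₂ (inj₂ (swap (interchange (inj₁ v)))) ≡ j (y₁ v)
    jy (inj₁ _) = refl
    jy (inj₂ _) = refl
    jf : ∀ v → Sum.map₂ (Sum.map₂ inj₁) (inj₂ (assocʳ v)) ≡ j (f₁ v)
    jf (inj₁ (inj₁ _)) = refl
    jf (inj₁ (inj₂ _)) = refl
    jf (inj₂ _) = refl
    jz : ∀ v → Sum.map₂ inj₂ (inj₂ (swap (interchange (inj₂ v)))) ≡ j (z₁ v)
    jz (inj₁ _) = refl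
    jz (inj₂ _) = refl

    x#y : ∀ v w → x₁ v ≡ y₁ w → ⊥
    x#y (inj₁ _) (inj₁ _) ()
    x#y (inj₂ _) (inj₂ _) ()
    x#y (inj₁ _) (inj₂ _) ()
    x#y (inj₂ _) (inj₁ _) ()
    y#z : ∀ v w → y₁ v ≡ z₁ w → ⊥
    y#z (inj₁ _) (inj₁ _) ()
    y#z (inj₂ _) (inj₂ _) ()
    y#z (inj₁ _) (inj₂ _) ()
    y#z (inj₂ _) (inj₁ _) ()

    regroup : Embedding T.flat R.flat j
    regroup = record
      { on-edges    = φ
      ; on-source   = λ { (inj₁ (inj₁ (inj₁ e))) → jx (source x e) ; (inj₁ (inj₁ (inj₂ e))) → jy (source y e)
                        ; (inj₁ (inj₂ e)) → jf (source f e) ; (inj₂ e) → jz (source z e) }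
      ; on-target   = λ { (inj₁ (inj₁ (inj₁ e))) → jx (target x e) ; (inj₁ (inj₁ (inj₂ e))) → jy (target y e)
                        ; (inj₁ (inj₂ e)) → jf (target f e) ; (inj₂ e) → jz (target z e) }
      ; injective-E = retraction⇒injective φ⁻¹ φ⁻¹∘φ
      ; injective-V = retraction⇒injective j⁻¹ j⁻¹∘j
      ; lift        = λ e _ _ → φ⁻¹ e , φ∘φ⁻¹ e
      ; ↝⁺          = ↝⁺
      ; ↝⁻          = ↝⁻
      ; coherence   = coherence
      }
      where
      open System T.flat using (E) renaming (s to s₁; t to t₁; _↝_ to _↝₁_)
      open System R.flat using () renaming (_↝_ to _↝₂_)

      ↝⁺ : ∀ d e → t₁ d ≡ s₁ e → d ↝₁ e → φ d ↝₂ φ e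
      ↝⁺ (inj₁ (inj₁ (inj₁ _))) (inj₁ (inj₂ _))        _ _ = tt
      ↝⁺ (inj₁ (inj₁ (inj₁ _))) (inj₂ _)               _ _ = tt
      ↝⁺ (inj₁ (inj₁ (inj₂ _))) (inj₁ (inj₂ _))        _ _ = tt
      ↝⁺ (inj₁ (inj₁ (inj₂ d))) (inj₂ e)               p _ = y#z (target y d) (source z e) p
      ↝⁺ (inj₁ (inj₂ _))        (inj₁ (inj₁ (inj₁ _))) _ _ = tt
      ↝⁺ (inj₁ (inj₂ _))        (inj₁ (inj₁ (inj₂ _))) _ _ = tt
      ↝⁺ (inj₁ (inj₂ _))        (inj₂ _)               _ _ = tt
      ↝⁺ (inj₂ _)               (inj₁ (inj₁ (inj₁ _))) _ _ = tt
      ↝⁺ (inj₂ d)               (inj₁ (inj₁ (inj₂ e))) p _ = y#z (source y e) (target z d) (sym p)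
      ↝⁺ (inj₂ _)               (inj₁ (inj₂ _))        _ _ = tt

      ↝⁻ : ∀ d e → t₁ d ≡ s₁ e → φ d ↝₂ φ e → d ↝₁ e
      ↝⁻ (inj₁ (inj₁ (inj₁ d))) (inj₁ (inj₁ (inj₂ e))) p _ = x#y (target x d) (source y e) p
      ↝⁻ (inj₁ (inj₁ (inj₁ _))) (inj₁ (inj₂ _))        _ _ = tt
      ↝⁻ (inj₁ (inj₁ (inj₁ _))) (inj₂ _)               _ _ = tt
      ↝⁻ (inj₁ (inj₁ (inj₂ d))) (inj₁ (inj₁ (inj₁ e))) p _ = x#y (source x e) (target y d) (sym p)
      ↝⁻ (inj₁ (inj₁ (inj₂ _))) (inj₁ (inj₂ _))        _ _ = tt
      ↝⁻ (inj₁ (inj₂ _))        (inj₁ (inj₁ (inj₁ _))) _ _ = tt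
      ↝⁻ (inj₁ (inj₂ _))        (inj₁ (inj₁ (inj₂ _))) _ _ = tt
      ↝⁻ (inj₁ (inj₂ _))        (inj₂ _)               _ _ = tt
      ↝⁻ (inj₂ _)               (inj₁ (inj₁ (inj₁ _))) _ _ = tt
      ↝⁻ (inj₂ _)               (inj₁ (inj₂ _))        _ _ = tt

      coherence : ∀ d e → Coh (System.graph T.flat) d e ⇔ Coh (System.graph R.flat) (φ d) (φ e)
      coherence (inj₁ (inj₁ (inj₁ _))) (inj₁ (inj₁ (inj₁ _))) = mk⇔ id id
      coherence (inj₁ (inj₁ (inj₁ _))) (inj₁ (inj₁ (inj₂ _))) = mk⇔ id id
      coherence (inj₁ (inj₁ (inj₁ _))) (inj₁ (inj₂ _))        = mk⇔ id id
      coherence (inj₁ (inj₁ (inj₁ _))) (inj₂ _)               = mk⇔ id id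
      coherence (inj₁ (inj₁ (inj₂ _))) (inj₁ (inj₁ (inj₁ _))) = mk⇔ id id
      coherence (inj₁ (inj₁ (inj₂ _))) (inj₁ (inj₁ (inj₂ _))) = mk⇔ id id
      coherence (inj₁ (inj₁ (inj₂ _))) (inj₁ (inj₂ _))        = mk⇔ id id
      coherence (inj₁ (inj₁ (inj₂ _))) (inj₂ _)               = mk⇔ id id
      coherence (inj₁ (inj₂ _))        (inj₁ (inj₁ (inj₁ _))) = mk⇔ id id
      coherence (inj₁ (inj₂ _))        (inj₁ (inj₁ (inj₂ _))) = mk⇔ id id
      coherence (inj₁ (inj₂ _))        (inj₁ (inj₂ _))        = mk⇔ id id
      coherence (inj₁ (inj₂ _))        (inj₂ _)               = mk⇔ id id
      coherence (inj₂ _)               (inj₁ (inj₁ (inj₁ _))) = mk⇔ id id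
      coherence (inj₂ _)               (inj₁ (inj₁ (inj₂ _))) = mk⇔ id id
      coherence (inj₂ _)               (inj₁ (inj₂ _))        = mk⇔ id id
      coherence (inj₂ _)               (inj₂ _)               = mk⇔ id id

  -- This is the naturality of currying. The grouping decides which edges of `x`, `y` and `z` count
  -- as adjacent, but the three graphs touch disjoint sets of vertices, so no route can tell the
  -- groupings apart.
  curry-∷∷ : rename assocʳ ((rename interchange (x ⊗ᵍ y) ∷∷ f) ∷∷ rename swap z) ≅
             (x ∷∷ rename assocʳ f) ∷∷ rename swap (rename interchange (y ⊗ᵍ z))
  curry-∷∷ = ≅-trans (rename-cong assocʳ T.∷∷-∷∷≅Exec)
    (≅-trans (Embedding.Exec-≅ regroup
                (λ { (inj₁ (inj₁ _)) → refl ; (inj₁ (inj₂ _)) → refl ; (inj₂ _) → refl })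
                (retraction⇒injective assocˡ assocʳˡ) assocˡ assocˡʳ)
    (≅-sym R.∷∷-∷∷≅Exec))

-- Bijections as graphs

-- Each vertex is joined to its image in both directions, because a route may cross an interface
-- either way. Total coherence makes wires invisible to the coherence of an execution. With `φ` the
-- identity this is the identity morphism.
wire : (V → W) → CohGraph (V ⊎ W)
wire {V} φ = record
  { Edge         = V ⊎ V
  ; source       = [ inj₁ , inj₂ ∘ φ ]
  ; target       = [ inj₂ ∘ φ , inj₁ ]
  ; _⌢_          = λ _ _ → ⊤
  ; ⌢-refl       = tt
  ; ⌢-sym        = λ _ → tt
  ; ⌢-irrelevant = λ _ _ → refl
  }

module _ (F : CohGraph (A ⊎ V)) (φ : V → W) where
  private
    F′ = rename {W = A ⊎ V ⊎ W} (Sum.map₂ inj₁) F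
    φ′ = rename {W = A ⊎ V ⊎ W} inj₂ (wire φ)
    S  = plug F′ φ′

    ι : A ⊎ W → A ⊎ V ⊎ W
    ι = Sum.map₂ inj₂

    into out-of : A ⊎ V → List (Edge F ⊎ (V ⊎ V))
    into (inj₁ _) = []
    into (inj₂ v) = inj₂ (inj₂ v) ∷ []
    out-of (inj₁ _) = []
    out-of (inj₂ v) = inj₂ (inj₁ v) ∷ []

    -- An endpoint in `V` lies on the interface and must be continued along its wire, while an
    -- endpoint in `A` is already outer.
    extend : Edge F → List (Edge F ⊎ (V ⊎ V))
    extend e = into (source F e) ++ inj₁ e ∷ out-of (target F e)

    extend-from : ∀ {e} y → target F e ≡ y →
                  Route S (Sum.map₂ inj₁ (source F e)) (inj₁ e ∷ out-of y) (ι (Sum.map₂ φ y))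
    extend-from (inj₁ a) eq = last refl (cong (Sum.map₂ inj₁) eq)
    extend-from (inj₂ v) eq =
      next refl tt (subst (λ y → Route S (Sum.map₂ inj₁ y) (inj₂ (inj₁ v) ∷ []) (inj₂ (inj₂ (φ v)))) (sym eq) (last refl refl))

    extend-route : ∀ {e} x → source F e ≡ x →
                   Route S (ι (Sum.map₂ φ x)) (into x ++ inj₁ e ∷ out-of (target F e)) (ι (Sum.map₂ φ (target F e)))
    extend-route {e} (inj₁ a) eq =
      subst (λ x → Route S x (inj₁ e ∷ out-of (target F e)) (ι (Sum.map₂ φ (target F e)))) (cong (Sum.map₂ inj₁) eq)
            (extend-from (target F e) refl)
    extend-route {e} (inj₂ v) eq =
      next refl tt (subst (λ x → Route S x (inj₁ e ∷ out-of (target F e)) (ι (Sum.map₂ φ (target F e)))) (cong (Sum.map₂ inj₁) eq)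
            (extend-from (target F e) refl))

    -- Wires are coherent with everything, so `e` is the only entry of `extend e` at which coherence
    -- can fail.
    data Shape (e : Edge F) : Edge F ⊎ (V ⊎ V) → Set where
      is-edge : Shape e (inj₁ e)
      is-wire : ∀ {w} → Shape e (inj₂ w)

    shape : ∀ {e} x y → All (Shape e) (into x ++ inj₁ e ∷ out-of y)
    shape (inj₁ _) (inj₁ _) = is-edge ∷ []
    shape (inj₁ _) (inj₂ _) = is-edge ∷ is-wire ∷ []
    shape (inj₂ _) (inj₁ _) = is-wire ∷ is-edge ∷ []
    shape (inj₂ _) (inj₂ _) = is-wire ∷ is-edge ∷ is-wire ∷ []

    coherent-shape : ∀ {d e b c} → Coh F d e → Shape d b → Shape e c → Coh (System.graph S) b c
    coherent-shape d⌢e is-edge is-edge = d⌢e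
    coherent-shape _   is-edge is-wire = tt
    coherent-shape _   is-wire is-edge = tt
    coherent-shape _   is-wire is-wire = tt

    coherent-extend : ∀ d e → Coh F d e ⇔ Coherent² (System.graph S) (extend d) (extend e)
    coherent-extend d e = mk⇔
      (λ d⌢e → All.map (λ b → All.map (coherent-shape d⌢e b) (shape (source F e) (target F e)))
                       (shape (source F d) (target F d)))
      (λ c → All.lookup (All.lookup c (∈-++⁺ʳ (into (source F d)) (here refl)))
                        (∈-++⁺ʳ (into (source F e)) (here refl)))

    extend-injective : ∀ {d e} x x′ {y y′} → into x ++ inj₁ d ∷ out-of y ≡ into x′ ++ inj₁ e ∷ out-of y′ → d ≡ e
    extend-injective (inj₁ _) (inj₁ _) eq = inj₁-injective (∷-injectiveˡ eq)
    extend-injective (inj₂ _) (inj₂ _) eq = inj₁-injective (∷-injectiveˡ (∷-injectiveʳ eq))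
    extend-injective (inj₁ _) (inj₂ _) ()
    extend-injective (inj₂ _) (inj₁ _) ()

    to : Edge F → Edge (Exec S ι)
    to e = Sum.map₂ φ (source F e) , Sum.map₂ φ (target F e) , extend e ,
           extend-route (source F e) refl , Equivalence.to (coherent-extend e e) (CohGraph.⌢-refl F)

    not-outer : ∀ x {w} → Sum.map₂ inj₁ x ≡ ι (inj₂ w) → ⊥
    not-outer (inj₁ _) ()
    not-outer (inj₂ _) ()

    endpoint : ∀ x {u} → Sum.map₂ inj₁ x ≡ ι u → ([] ≡ into x × [] ≡ out-of x) × Sum.map₂ φ x ≡ u
    endpoint (inj₁ _) {inj₁ _} refl = (refl , refl) , refl
    endpoint x {inj₂ _} eq = ⊥-elim (not-outer x eq)

    junction : ∀ (x : A ⊎ V) {v} → _≡_ {A = A ⊎ V ⊎ W} (Sum.map₂ inj₁ x) (inj₂ (inj₁ v)) → x ≡ inj₂ v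
    junction (inj₂ _) refl = refl

    after-edge : ∀ x {w es v} → Route S (Sum.map₂ inj₁ x) (inj₂ w ∷ es) (ι v) →
                 inj₂ w ∷ es ≡ out-of x × Sum.map₂ φ x ≡ v
    after-edge (inj₁ _) (last () _)
    after-edge (inj₁ _) (next () _ _)
    after-edge (inj₂ _) {inj₂ _} (last () _)
    after-edge (inj₂ _) {inj₂ _} (next () _ _)
    after-edge (inj₂ _) {inj₁ _} {v = inj₂ _} (last refl refl) = refl , refl
    after-edge (inj₂ _) {inj₁ _} (next {f = inj₁ f} _ _ p) = ⊥-elim (not-outer (source F f) (route-source p))

    from-edge : ∀ {u e es v} → Route S u (inj₁ e ∷ es) (ι v) →
                es ≡ out-of (target F e) × Sum.map₂ φ (target F e) ≡ v
    from-edge {e = e} (last _ q) = let (_ , a) , b = endpoint (target F e) q in a , b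
    from-edge {e = e} (next {f = inj₂ _} _ _ p) = after-edge (target F e) p

    -- Wires and edges of `F` alternate, a wire alone never joins two outer vertices, and a wire
    -- into `W` cannot be followed by an edge of `F`. So a route between outer vertices contains
    -- exactly one edge of `F`.
    to-surjective : ∀ {u es v} → Route S (ι u) es (ι v) →
                    ∃ λ e → extend e ≡ es × Sum.map₂ φ (source F e) ≡ u × Sum.map₂ φ (target F e) ≡ v
    to-surjective {es = inj₁ e ∷ _} p with endpoint (source F e) (route-source p) | from-edge p
    ... | (eq , _) , q | refl , r = e , cong (_++ inj₁ e ∷ out-of (target F e)) (sym eq) , q , r
    to-surjective {u = inj₁ _} {inj₂ (inj₁ _) ∷ _} p with () ← route-source p
    to-surjective {u = inj₁ _} {inj₂ (inj₂ _) ∷ _} p with () ← route-source p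
    to-surjective {u = inj₂ _} {inj₂ (inj₁ _) ∷ _} p with () ← route-source p
    to-surjective {u = inj₂ _} {inj₂ (inj₂ _) ∷ _} {inj₁ _} (last _ ())
    to-surjective {u = inj₂ _} {inj₂ (inj₂ _) ∷ _} {inj₂ _} (last _ ())
    to-surjective {u = inj₂ _} {inj₂ (inj₂ v) ∷ _} {v′} (next {f = inj₁ e} refl _ p)
      with junction (source F e) {v} (route-source p) | from-edge {v = v′} p
    ... | eq | refl , r = e , cong (λ x → into x ++ inj₁ e ∷ out-of (target F e)) eq , cong (Sum.map₂ φ) eq , r

  ∷∷-wire : F ∷∷ wire φ ≅ rename (Sum.map₂ φ) F
  ∷∷-wire = ≅-trans (∷∷≅Exec F (wire φ)) (≅-sym (mk≅ to
    (λ {d} {e} eq → extend-injective (source F d) (source F e) (cong (proj₁ ∘ proj₂ ∘ proj₂) eq))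
    (λ { (u , v , es , p , c) → let e , a , b , c′ = to-surjective p in e , Exec-≡ b c′ a })
    (λ _ → refl) (λ _ → refl) coherent-extend))

wire-≗ : {φ ψ : V → W} → φ ≗ ψ → wire φ ≅ wire ψ
wire-≗ φ≗ψ = mk≅ id id (_, refl)
  [ (λ _ → refl) , cong inj₂ ∘ sym ∘ φ≗ψ ] [ cong inj₂ ∘ sym ∘ φ≗ψ , (λ _ → refl) ] (λ _ _ → mk⇔ id id)

wire-∘ : (φ : U → V) (ψ : V → W) → wire φ ∷∷ wire ψ ≅ wire (ψ ∘ φ)
wire-∘ φ ψ = ≅-trans (∷∷-wire (wire φ) ψ) (mk≅ id id (_, refl)
  [ (λ _ → refl) , (λ _ → refl) ] [ (λ _ → refl) , (λ _ → refl) ] (λ _ _ → mk⇔ id id))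

wire-⊗ : (φ : V → W) (ψ : V′ → W′) → rename interchange (wire φ ⊗ᵍ wire ψ) ≅ wire (Sum.map φ ψ)
wire-⊗ φ ψ = mk≅ interchange (retraction⇒injective interchange interchange-involutive)
  (λ e → interchange e , interchange-involutive e)
  (λ { (inj₁ (inj₁ _)) → refl ; (inj₁ (inj₂ _)) → refl ; (inj₂ (inj₁ _)) → refl ; (inj₂ (inj₂ _)) → refl })
  (λ { (inj₁ (inj₁ _)) → refl ; (inj₁ (inj₂ _)) → refl ; (inj₂ (inj₁ _)) → refl ; (inj₂ (inj₂ _)) → refl })
  (λ { (inj₁ _) (inj₁ _) → mk⇔ id id ; (inj₁ _) (inj₂ _) → mk⇔ id id
     ; (inj₂ _) (inj₁ _) → mk⇔ id id ; (inj₂ _) (inj₂ _) → mk⇔ id id })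
  where
  interchange-involutive : ∀ {A B C D : Set} (x : (A ⊎ B) ⊎ (C ⊎ D)) → interchange (interchange x) ≡ x
  interchange-involutive (inj₁ (inj₁ _)) = refl
  interchange-involutive (inj₁ (inj₂ _)) = refl
  interchange-involutive (inj₂ (inj₁ _)) = refl
  interchange-involutive (inj₂ (inj₂ _)) = refl

module _ {φ : V → W} {ψ : W → V} (ψ∘φ : ∀ v → ψ (φ v) ≡ v) (φ∘ψ : ∀ w → φ (ψ w) ≡ w) where

  -- Seen from the other side, the wire leaving `v` is the one arriving from `φ v`. The edge map
  -- therefore exchanges the tags and carries the index along `φ`.
  wire-swap : rename swap (wire φ) ≅ wire ψ
  wire-swap = mk≅ [ inj₂ ∘ φ , inj₁ ∘ φ ]
    (λ { {inj₁ _} {inj₁ _} eq → cong inj₁ (retraction⇒injective ψ ψ∘φ (inj₂-injective eq))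
       ; {inj₂ _} {inj₂ _} eq → cong inj₂ (retraction⇒injective ψ ψ∘φ (inj₁-injective eq)) })
    [ (λ w → inj₂ (ψ w) , cong inj₁ (φ∘ψ w)) , (λ w → inj₁ (ψ w) , cong inj₂ (φ∘ψ w)) ]
    [ cong inj₂ ∘ ψ∘φ , (λ _ → refl) ] [ (λ _ → refl) , cong inj₂ ∘ ψ∘φ ] (λ _ _ → mk⇔ id id)

  wire-∷∷ : (G : CohGraph (W ⊎ C)) → wire φ ∷∷ G ≅ rename (Sum.map₁ ψ) G
  wire-∷∷ G =
    wire φ ∷∷ G
      ≅⟨ rename-≗ {f = id} {g = swap ∘ swap} (wire φ ∷∷ G) (sym ∘ swap-involutive) ⟩
    rename swap (rename swap (wire φ ∷∷ G))
      ≅⟨ rename-cong swap (rev-∷∷ (wire φ) G) ⟩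
    rename swap (rename swap G ∷∷ rename swap (wire φ))
      ≅⟨ rename-cong swap (∷∷-cong {F = rename swap G} {rename swap G} {rename swap (wire φ)} {wire ψ}
           ≅-refl wire-swap) ⟩
    rename swap (rename swap G ∷∷ wire ψ)
      ≅⟨ rename-cong swap (∷∷-wire (rename swap G) ψ) ⟩
    rename swap (rename (Sum.map₂ ψ) (rename swap G))
      ≅⟨ rename-≗ {f = swap ∘ Sum.map₂ ψ ∘ swap} {g = Sum.map₁ ψ} G (λ { (inj₁ _) → refl ; (inj₂ _) → refl }) ⟩
    rename (Sum.map₁ ψ) G ≅∎

  wire-inverse : wire φ ∷∷ wire ψ ≅ wire id
  wire-inverse = ≅-trans (wire-∘ φ ψ) (wire-≗ ψ∘φ)

-- Cycles

module _ (L : Rel N 0ℓ) where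

  -- The list omits the final index, so walks compose by concatenation and a closed walk does not
  -- list its start twice. Incidence and alternation are both part of `L`, which turns every change
  -- of graphs into a relabelling of edges.
  data Walk : N → List N → N → Set where
    []  : ∀ {e} → Walk e [] e
    _∷_ : ∀ {d e es f} → L d e → Walk e es f → Walk d (d ∷ es) f

  record Cycle (C : Rel N 0ℓ) : Set where
    constructor cycle
    field
      {start}  : N
      {rest}   : List N
      walk     : Walk start (start ∷ rest) start
      coherent : ∀ {d e} → d ∈ᴸ start ∷ rest → e ∈ᴸ start ∷ rest → C d e

  infixr 5 _++ʷ_

  _++ʷ_ : ∀ {d es e fs f} → Walk d es e → Walk e fs f → Walk d (es ++ fs) f
  []      ++ʷ q = q
  (l ∷ p) ++ʷ q = l ∷ (p ++ʷ q)

  successor : ∀ {d es f x} → Walk d es f → x ∈ᴸ es → ∃ λ y → L x y × (y ∈ᴸ es ⊎ y ≡ f)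
  successor (l ∷ [])          (here refl) = _ , l , inj₂ refl
  successor (l ∷ p@(_ ∷ _)) (here refl) = _ , l , inj₁ (there (here refl))
  successor (l ∷ p)           (there x∈)  with successor p x∈
  ... | y , r , inj₁ y∈ = y , r , inj₁ (there y∈)
  ... | y , r , inj₂ y≡ = y , r , inj₂ y≡

  predecessor : ∀ {d es f x} → Walk d es f → x ∈ᴸ es → x ≡ d ⊎ ∃ λ y → L y x × y ∈ᴸ es
  predecessor (l ∷ p) (here refl) = inj₁ refl
  predecessor (l ∷ p) (there x∈)  with predecessor p x∈
  ... | inj₁ refl           = inj₂ (_ , l , here refl)
  ... | inj₂ (y , r , y∈) = inj₂ (y , r , there y∈)

  walk-last : ∀ {d e es f} → Walk d (e ∷ es) f → ∃ λ y → L y f × y ∈ᴸ e ∷ es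
  walk-last (l ∷ [])          = _ , l , here refl
  walk-last (l ∷ p@(_ ∷ _)) = let y , r , y∈ = walk-last p in y , r , there y∈

module _ {L C : Rel N 0ℓ} (c : Cycle L C) where
  open Cycle c

  -- Absence of cycles is later shown by exhibiting dead ends: a visited edge without an admissible
  -- neighbour, or all of whose neighbours are incoherent with another visited edge.
  cycle-successor : ∀ {x} → x ∈ᴸ start ∷ rest → ∃ λ y → L x y × y ∈ᴸ start ∷ rest
  cycle-successor x∈ with successor L walk x∈
  ... | y , r , inj₁ y∈   = y , r , y∈
  ... | y , r , inj₂ refl = y , r , here refl

  cycle-predecessor : ∀ {x} → x ∈ᴸ start ∷ rest → ∃ λ y → L y x × y ∈ᴸ start ∷ rest
  cycle-predecessor x∈ with predecessor L walk x∈
  ... | inj₁ refl = walk-last L walk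
  ... | inj₂ p    = p

module _ {L C : Rel N 0ℓ} {L′ C′ : Rel M 0ℓ} (label⁺ : M → List⁺ N) where

  private
    label′ : M → List N
    label′ = List⁺.toList ∘ label⁺

  expand-walk : (∀ {x y} → L′ x y → Walk L (List⁺.head (label⁺ x)) (label′ x) (List⁺.head (label⁺ y))) →
                ∀ {x xs y} → Walk L′ x xs y →
                Walk L (List⁺.head (label⁺ x)) (concatMap label′ xs) (List⁺.head (label⁺ y))
  expand-walk link []      = []
  expand-walk link (l ∷ p) = _++ʷ_ L (link l) (expand-walk link p)

  expand-∈ : ∀ {a} xs → a ∈ᴸ concatMap label′ xs → ∃ λ x → x ∈ᴸ xs × a ∈ᴸ label′ x
  expand-∈ (x ∷ xs) a∈ with ∈-++⁻ (label′ x) a∈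
  ... | inj₁ p = x , here refl , p
  ... | inj₂ p = let y , y∈ , q = expand-∈ xs p in y , there y∈ , q

  -- The label of an edge of an execution is the route behind it, so this unfolds a cycle through an
  -- execution into one through the graphs plugged together.
  expand-cycle : (∀ {x y} → L′ x y → Walk L (List⁺.head (label⁺ x)) (label′ x) (List⁺.head (label⁺ y))) →
                 (∀ {x y} → C′ x y → ∀ {a b} → a ∈ᴸ label′ x → b ∈ᴸ label′ y → C a b) →
                 Cycle L′ C′ → Cycle L C
  expand-cycle link coh (cycle {x} {xs} walk c) = cycle (expand-walk link walk) λ a∈ b∈ →
    let _ , x∈ , p = expand-∈ (x ∷ xs) a∈
        _ , y∈ , q = expand-∈ (x ∷ xs) b∈
    in coh (c x∈ y∈) p q

map-cycle : {L C : Rel N 0ℓ} {L′ C′ : Rel M 0ℓ} (f : M → N) →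
            (∀ {x y} → L′ x y → L (f x) (f y)) → (∀ {x y} → C′ x y → C (f x) (f y)) →
            Cycle L′ C′ → Cycle L C
map-cycle f link coh = expand-cycle (λ x → f x ∷ []) (λ l → link l ∷ [])
  λ { c (here refl) (here refl) → coh c }

module _ {L C : Rel N 0ℓ} {P : N → Set} where

  restrict-walk : ∀ {d es f} (ps : All P (d ∷ es)) → Walk L d (d ∷ es) f → (q : P f) →
                  Walk (λ x y → L (proj₁ x) (proj₁ y)) (d , All.head ps) (All.toList ps) (f , q)
  restrict-walk (_ ∷ [])     (l ∷ [])        _ = l ∷ []
  restrict-walk (_ ∷ _ ∷ _) (l ∷ w@(_ ∷ _)) q = l ∷ restrict-walk (_ ∷ _) w q

  restrict-∈ : ∀ {es x} (ps : All P es) → x ∈ᴸ All.toList ps → proj₁ x ∈ᴸ es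
  restrict-∈ (_ ∷ _)  (here refl) = here refl
  restrict-∈ (_ ∷ ps) (there x∈)  = there (restrict-∈ ps x∈)

  -- Indexing the cycle by `∃ P` keeps the evidence at each edge, so that a subsequent `map-cycle`
  -- can return the preimage that the evidence contains.
  restrict-cycle : ((cycle {e} {es} _ _) : Cycle L C) → (∀ {x} → x ∈ᴸ e ∷ es → P x) →
                   Cycle {N = ∃ P} (λ x y → L (proj₁ x) (proj₁ y)) (λ x y → C (proj₁ x) (proj₁ y))
  restrict-cycle (cycle w c) all with All.tabulate all
  ... | p ∷ ps = cycle (restrict-walk (p ∷ ps) w p) λ x∈ y∈ → c (restrict-∈ (p ∷ ps) x∈) (restrict-∈ (p ∷ ps) y∈)

module _ (G H : CohGraph V) where

  Link : Rel (Edge G ⊎ Edge H) 0ℓ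
  Link d e = target (G □ H) d ≡ source (G □ H) e × Opposite d e

  PlugCycle : Set
  PlugCycle = Cycle Link (Coh (G □ H))

  private
    K = G □ H

    path-source : ∀ {u v} (p : Path K u v) → source K (head (edges K p)) ≡ u
    path-source (edge _ s _)   = s
    path-source (step _ s _ _) = s

    path⇒walk : ∀ {u v e} (p : Path K u v) → v ≡ source K e → Linked Opposite (toList (edges K p) ∷ʳ e) →
                Walk Link (head (edges K p)) (toList (edges K p)) e
    path⇒walk (edge _ _ refl) eq (o ∷ _) = (eq , o) ∷ []
    path⇒walk (step _ _ refl p) eq (o ∷ a) = (sym (path-source p) , o) ∷ path⇒walk p eq a

    walk⇒path : ∀ {d es e} → Walk Link d (d ∷ es) e →
                Σ[ p ∈ Path K (source K d) (source K e) ]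
                  edges K p ≡ d List⁺.∷ es × Linked Opposite ((d ∷ es) ∷ʳ e)
    walk⇒path ((eq , o) ∷ []) = edge _ refl eq , refl , o ∷ [-]
    walk⇒path {d} ((eq , o) ∷ w@(_ ∷ _)) =
      let p , es≡ , a = walk⇒path w in step _ refl eq p , cong (d List⁺.∷⁺_) es≡ , o ∷ a

  toCycle : CoherentAlternatingCycle G H → PlugCycle
  toCycle (v , p , a , c) = cycle (path⇒walk p (sym (path-source p)) a) λ x∈ y∈ → All.lookup (All.lookup c x∈) y∈

  fromCycle : PlugCycle → CoherentAlternatingCycle G H
  fromCycle (cycle w c) =
    let p , es≡ , a = walk⇒path w in
    _ , p , subst (λ es → Linked Opposite (toList es ∷ʳ head es)) (sym es≡) a ,
    subst (λ es → Coherent² K (toList es) (toList es)) (sym es≡)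
          (All.tabulate λ x∈ → All.tabulate λ y∈ → c x∈ y∈)

-- Such maps send coherent cycles to coherent cycles, hence pull orthogonality back. Coherence is
-- only preserved, not reflected, because `separation` maps a graph to one with more coherence.
record Hom (j : V → W) (G : CohGraph V) (H : CohGraph W) : Set where
  constructor hom
  field
    on-edges  : Edge G → Edge H
    on-source : ∀ e → source H (on-edges e) ≡ j (source G e)
    on-target : ∀ e → target H (on-edges e) ≡ j (target G e)
    on-⌢      : ∀ d e → Coh G d e → Coh H (on-edges d) (on-edges e)

≅⇒Hom : {G H : CohGraph V} → G ≅ H → Hom id G H
≅⇒Hom G≅H = hom (Inverse.to bijection) source-≡ target-≡ (λ d e → Equivalence.to (coherence d e))
  where open _≅_ G≅H

map-□ : {j : V → W} {G H : CohGraph V} {G′ H′ : CohGraph W} → Hom j G G′ → Hom j H H′ → PlugCycle G H → PlugCycle G′ H′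
map-□ {j = j} {G} {H} {G′} {H′} g h = map-cycle f
  (λ { {x} {y} (eq , o) → trans (t x) (trans (cong j eq) (sym (s y))) , opposite x y o })
  (λ {x} {y} → coh x y)
  where
  module g = Hom g
  module h = Hom h
  f : Edge G ⊎ Edge H → Edge G′ ⊎ Edge H′
  f = Sum.map g.on-edges h.on-edges
  s : ∀ x → source (G′ □ H′) (f x) ≡ j (source (G □ H) x)
  s = [ g.on-source , h.on-source ]
  t : ∀ x → target (G′ □ H′) (f x) ≡ j (target (G □ H) x)
  t = [ g.on-target , h.on-target ]
  opposite : ∀ x y → Opposite x y → Opposite (f x) (f y)
  opposite (inj₁ _) (inj₂ _) o = o
  opposite (inj₂ _) (inj₁ _) o = o
  coh : ∀ x y → Coh (G □ H) x y → Coh (G′ □ H′) (f x) (f y)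
  coh (inj₁ d) (inj₁ e) = g.on-⌢ d e
  coh (inj₂ d) (inj₂ e) = h.on-⌢ d e
  coh (inj₁ _) (inj₂ _) = id
  coh (inj₂ _) (inj₁ _) = id

⟂-map : {j : V → W} {G H : CohGraph V} {G′ H′ : CohGraph W} → Hom j G G′ → Hom j H H′ → G′ ⟂ H′ → G ⟂ H
⟂-map {G = G} {H} {G′} {H′} g h G′⟂H′ c = G′⟂H′ (fromCycle G′ H′ (map-□ g h (toCycle G H c)))

module _ {S : System U} {ι : I → U} where
  open System S

  labels⁺ : Edge (Exec S ι) → List⁺ (Edge graph)
  labels⁺ (_ , _ , e ∷ es , _) = e ∷ es

  labels⁺-source : ∀ x → s (List⁺.head (labels⁺ x)) ≡ ι (source (Exec S ι) x)
  labels⁺-source (_ , _ , _ ∷ _ , p , _) = route-source p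

  labels⁺-coherent : ∀ x y → Coherent² graph (labels {S = S} {ι = ι} x) (labels {S = S} {ι = ι} y) →
                     ∀ {a b} → a ∈ᴸ List⁺.toList (labels⁺ x) → b ∈ᴸ List⁺.toList (labels⁺ y) → a ⌢ b
  labels⁺-coherent (_ , _ , _ ∷ _ , _) (_ , _ , _ ∷ _ , _) c a∈ b∈ = All.lookup (All.lookup c a∈) b∈

  route⇒walk : {L : Rel N′ 0ℓ} (σ : Edge graph → N′) → (∀ {d e} → t d ≡ s e → d ↝ e → L (σ d) (σ e)) →
               ∀ {u e es v y} → Route S u (e ∷ es) v → (∀ d → t d ≡ v → L (σ d) y) →
               Walk L (σ e) (List.map σ (e ∷ es)) y
  route⇒walk σ link (last _ q)   end = end _ q ∷ []
  route⇒walk σ link (next _ r p) end = link (sym (route-source p)) r ∷ route⇒walk σ link p end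

  labels⁺-walk : {L : Rel N′ 0ℓ} (σ : Edge graph → N′) → (∀ {d e} → t d ≡ s e → d ↝ e → L (σ d) (σ e)) →
                 ∀ x {y} → (∀ d → t d ≡ ι (target (Exec S ι) x) → L (σ d) y) →
                 Walk L (σ (List⁺.head (labels⁺ x))) (List⁺.toList (List⁺.map σ (labels⁺ x))) y
  labels⁺-walk σ link (_ , _ , _ ∷ _ , p , _) = route⇒walk σ link p

-- The counterpart of Nest for cycles: a cycle over S and further edges E₂
-- that visits E₂ becomes a cycle in which each maximal segment in S is a
-- single edge of Exec S ι.
module Substitute
  {U I E₂ : Set} (S : System U) (ι : I → U)
  {L C : Rel (System.E S ⊎ E₂) 0ℓ} {L′ C′ : Rel (Edge (Exec S ι) ⊎ E₂) 0ℓ}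
  (inside    : ∀ {d e} → L (inj₁ d) (inj₁ e) → System.t S d ≡ System.s S e × System._↝_ S d e)
  (coherent₁ : ∀ {d e} → C (inj₁ d) (inj₁ e) → Coh (System.graph S) d e)
  (enter     : ∀ {f e} → L (inj₂ f) (inj₁ e) → ∃ λ i → ι i ≡ System.s S e)
  (leave     : ∀ {e f} → L (inj₁ e) (inj₂ f) → ∃ λ i → ι i ≡ System.t S e)
  (enter′    : ∀ {f e} → L (inj₂ f) (inj₁ e) → ∀ x → ι (source (Exec S ι) x) ≡ System.s S e → L′ (inj₂ f) (inj₁ x))
  (leave′    : ∀ {e f} → L (inj₁ e) (inj₂ f) → ∀ x → ι (target (Exec S ι) x) ≡ System.t S e → L′ (inj₁ x) (inj₂ f))
  (outside   : ∀ {f g} → L (inj₂ f) (inj₂ g) → L′ (inj₂ f) (inj₂ g))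
  (coherent₂ : ∀ {f g} → C (inj₂ f) (inj₂ g) → C′ (inj₂ f) (inj₂ g))
  (coherent′ : ∀ x y → Coh (Exec S ι) x y → C′ (inj₁ x) (inj₁ y))
  (separate₁ : ∀ x f → C′ (inj₁ x) (inj₂ f))
  (separate₂ : ∀ f x → C′ (inj₂ f) (inj₁ x))
  where

  open System S renaming (E to E₁)

  private
    module _ (es : List (E₁ ⊎ E₂)) (c : ∀ {d e} → d ∈ᴸ es → e ∈ᴸ es → C d e) where

      Covered : Edge (Exec S ι) ⊎ E₂ → Set
      Covered (inj₁ x) = All (λ e → inj₁ e ∈ᴸ es) (labels {S = S} {ι = ι} x)
      Covered (inj₂ f) = inj₂ f ∈ᴸ es

      covered-⌢ : ∀ x y → Covered x → Covered y → C′ x y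
      covered-⌢ (inj₁ x) (inj₁ y) p q = coherent′ x y (All.map (λ d∈ → All.map (λ e∈ → coherent₁ (c d∈ e∈)) q) p)
      covered-⌢ (inj₁ x) (inj₂ f) _ _ = separate₁ x f
      covered-⌢ (inj₂ f) (inj₁ x) _ _ = separate₂ f x
      covered-⌢ (inj₂ f) (inj₂ g) p q = coherent₂ (c p q)

      -- The walk is grouped from its end, and a leading segment stays open until an edge of `E₂` in
      -- front closes it. The link out of the segment is stored so that `leave` can then locate its
      -- end in the interface.
      data From (g : E₂) : E₁ ⊎ E₂ → Set where
        outer   : ∀ {f ts} → Walk L′ (inj₂ f) (inj₂ f ∷ ts) (inj₂ g) → All Covered (inj₂ f ∷ ts) → From g (inj₂ f)
        segment : ∀ {e xs d f ts} → Route S (s e) (e ∷ xs) (t d) → All (λ e → inj₁ e ∈ᴸ es) (e ∷ xs) →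
                  L (inj₁ d) (inj₂ f) → Walk L′ (inj₂ f) ts (inj₂ g) → All Covered ts → From g (inj₁ e)

      group : ∀ {e fs g} → Walk L e (e ∷ fs) (inj₂ g) → All (_∈ᴸ es) (e ∷ fs) → From g e
      group {inj₂ _} (l ∷ [])        (p ∷ []) = outer (outside l ∷ []) (p ∷ [])
      group {inj₁ _} (l ∷ [])        (p ∷ []) = segment (last refl refl) (p ∷ []) l [] []
      group {inj₂ _} (_∷_ {e = inj₂ _} l w@(_ ∷ _)) (p ∷ ps) with group w ps
      ... | outer v c = outer (outside l ∷ v) (p ∷ c)
      group {inj₁ _} (_∷_ {e = inj₂ _} l w@(_ ∷ _)) (p ∷ ps) with group w ps
      ... | outer v c = segment (last refl refl) (p ∷ []) l v c
      group {inj₁ _} (_∷_ {e = inj₁ _} l w@(_ ∷ _)) (p ∷ ps) with group w ps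
      ... | segment r q l′ v c =
        segment (next refl (proj₂ (inside l)) (subst (λ x → Route S x _ _) (sym (proj₁ (inside l))) r)) (p ∷ q) l′ v c
      group {inj₂ _} (_∷_ {e = inj₁ _} l w@(_ ∷ _)) (p ∷ ps) with group w ps
      ... | segment {e} {xs} {d} r q l′ v cov with enter l | leave l′
      ... | i , eq | i′ , eq′ = outer (enter′ l x eq ∷ leave′ l′ x eq′ ∷ v) (p ∷ q ∷ cov)
        where
        x : Edge (Exec S ι)
        x = i , i′ , e ∷ xs , subst₂ (λ y z → Route S y (e ∷ xs) z) (sym eq) (sym eq′) r ,
            All.map (λ d∈ → All.map (λ e∈ → coherent₁ (c d∈ e∈)) q) q

    data Split {E₁ E₂ : Set} (L : Rel (E₁ ⊎ E₂) 0ℓ) (d : E₁ ⊎ E₂) (es : List (E₁ ⊎ E₂)) (e : E₁ ⊎ E₂) : Set where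
      inner : All (λ x → ∃ λ y → x ≡ inj₁ y) es → Split L d es e
      at    : ∀ {xs f ys} → es ≡ xs ++ inj₂ f ∷ ys → Walk L d xs (inj₂ f) → Walk L (inj₂ f) (inj₂ f ∷ ys) e → Split L d es e

    split : ∀ {E₁ E₂ : Set} {L : Rel (E₁ ⊎ E₂) 0ℓ} {d es e} → Walk L d es e → Split L d es e
    split [] = inner []
    split (_∷_ {d = inj₂ f} l w) = at refl [] (l ∷ w)
    split (_∷_ {d = inj₁ d} l w) with split w
    ... | inner p = inner ((d , refl) ∷ p)
    ... | at refl v v′ = at refl (l ∷ v) v′

  -- A cycle avoiding `E₂` offers no place to cut and remains a cycle of `S`; it is the closed cycle
  -- that an execution forgets. Any other is rotated to start at an edge of `E₂`, so that no segment
  -- straddles the start.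
  substitute : Cycle L C → Cycle {N = E₁} (λ d e → t d ≡ s e × d ↝ e) _⌢_ ⊎ Cycle L′ C′
  substitute cyc@(cycle {e} {es} w c) with split w
  ... | inner p = inj₁ (map-cycle (λ { (_ , y , _) → y })
    (λ { {_ , _ , refl} {_ , _ , refl} → inside })
    (λ { {_ , _ , refl} {_ , _ , refl} → coherent₁ })
    (restrict-cycle cyc (All.lookup p)))
  ... | at {xs} {f} {ys} eq v v′ with group (e ∷ es) c (_++ʷ_ L v′ v) (All.tabulate rotate)
    where
    rotate : ∀ {x} → x ∈ᴸ inj₂ f ∷ ys ++ xs → x ∈ᴸ e ∷ es
    rotate x∈ rewrite eq with ∈-++⁻ (inj₂ f ∷ ys) x∈
    ... | inj₁ p = ∈-++⁺ʳ xs p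
    ... | inj₂ p = ∈-++⁺ˡ p
  ... | outer w′ cov = inj₂ (cycle w′ λ {x} {y} x∈ y∈ →
    covered-⌢ (e ∷ es) c x y (All.lookup cov x∈) (All.lookup cov y∈))

swap-⟂ : {G H : CohGraph V} → PlugCycle G H → PlugCycle H G
swap-⟂ {G = G} {H} c = toCycle H G (swapCycle G H (fromCycle G H c))

-- The action of F on the graphs over A, as of a morphism on the points of its domain.
act : CohGraph (A ⊎ B) → CohGraph A → CohGraph B
act F a = Exec (plug (rename inj₁ a) F) inj₂

-- A graph over `A` is a morphism out of the empty vertex set. Read this way, `act` inherits the law
-- `∷∷-wire`.
act≅∷∷ : (F : CohGraph (A ⊎ B)) (a : CohGraph A) → rename {W = ⊥ ⊎ B} inj₂ (act F a) ≅ rename inj₂ a ∷∷ F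
act≅∷∷ {A} {B} F a =
  rename inj₂ (act F a)
    ≅⟨ Embedding.Exec-≅ add-⊥ (λ _ → refl) inj₂-injective [ (λ ()) , id ] (λ { (inj₂ _) → refl }) ⟩
  Exec (plug (rename (Sum.map₂ inj₁) (rename inj₂ a)) (rename inj₂ F)) (Sum.map₂ inj₂)
    ≅⟨ ≅-sym (∷∷≅Exec (rename inj₂ a) F) ⟩
  rename inj₂ a ∷∷ F ≅∎
  where
  add-⊥ : Embedding (plug (rename inj₁ a) F)
                    (plug (rename {W = ⊥ ⊎ A ⊎ B} (Sum.map₂ inj₁) (rename inj₂ a)) (rename inj₂ F)) inj₂
  add-⊥ = record
    { on-edges    = id
    ; on-source   = [ (λ _ → refl) , (λ _ → refl) ]
    ; on-target   = [ (λ _ → refl) , (λ _ → refl) ]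
    ; injective-E = id
    ; injective-V = inj₂-injective
    ; lift        = λ e _ _ → e , refl
    ; ↝⁺          = λ _ _ _ → id
    ; ↝⁻          = λ _ _ _ → id
    ; coherence   = λ { (inj₁ _) (inj₁ _) → mk⇔ id id ; (inj₁ _) (inj₂ _) → mk⇔ id id
                      ; (inj₂ _) (inj₁ _) → mk⇔ id id ; (inj₂ _) (inj₂ _) → mk⇔ id id }
    }

act-wire : (φ : V → W) (a : CohGraph V) → act (wire φ) a ≅ rename φ a
act-wire {V} {W} φ a =
  act (wire φ) a
    ≅⟨ rename-cong strip (act≅∷∷ (wire φ) a) ⟩
  rename strip (rename inj₂ a ∷∷ wire φ)
    ≅⟨ rename-cong strip (∷∷-wire (rename inj₂ a) φ) ⟩
  rename φ a ≅∎
  where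
  strip : ⊥ ⊎ W → W
  strip = [ (λ ()) , id ]

module _ (F : CohGraph (A ⊎ B)) (a : CohGraph A) (b : CohGraph B) where
  private
    S = plug (rename inj₁ a) F
    L = Link F (a ⊗ᵍ b)

    σ : Edge a ⊎ Edge F → Edge F ⊎ (Edge a ⊎ Edge b)
    σ (inj₁ e) = inj₂ (inj₁ e)
    σ (inj₂ f) = inj₁ f

    σ-link : ∀ {d e} → System.t S d ≡ System.s S e → Opposite d e → L (σ d) (σ e)
    σ-link {inj₁ _} {inj₂ _} p o = p , o
    σ-link {inj₂ _} {inj₁ _} p o = p , o

    σ-coh : ∀ d e → Coh (System.graph S) d e → Coh (F □ (a ⊗ᵍ b)) (σ d) (σ e)
    σ-coh (inj₁ _) (inj₁ _) = id
    σ-coh (inj₁ _) (inj₂ _) = id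
    σ-coh (inj₂ _) (inj₁ _) = id
    σ-coh (inj₂ _) (inj₂ _) = id

    ρ : Edge F ⊎ (Edge a ⊎ Edge b) → (Edge a ⊎ Edge F) ⊎ Edge b
    ρ (inj₁ f)        = inj₁ (inj₂ f)
    ρ (inj₂ (inj₁ e)) = inj₁ (inj₁ e)
    ρ (inj₂ (inj₂ g)) = inj₂ g

    ρ⁻¹ : (Edge a ⊎ Edge F) ⊎ Edge b → Edge F ⊎ (Edge a ⊎ Edge b)
    ρ⁻¹ (inj₁ e) = σ e
    ρ⁻¹ (inj₂ g) = inj₂ (inj₂ g)

    ρ⁻¹∘ρ : ∀ e → ρ⁻¹ (ρ e) ≡ e
    ρ⁻¹∘ρ (inj₁ _)        = refl
    ρ⁻¹∘ρ (inj₂ (inj₁ _)) = refl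
    ρ⁻¹∘ρ (inj₂ (inj₂ _)) = refl

    expand : Edge (act F a) ⊎ Edge b → List⁺ (Edge F ⊎ (Edge a ⊎ Edge b))
    expand (inj₁ x) = List⁺.map σ (labels⁺ {S = S} {ι = inj₂} x)
    expand (inj₂ g) = inj₂ (inj₂ g) ∷ []

    b-target : ∀ {β g} d → System.t S d ≡ inj₂ β → β ≡ source b g → L (σ d) (inj₂ (inj₂ g))
    b-target (inj₂ f) p q = trans p (cong inj₂ q) , tt

    b-source : ∀ {β g} d → System.s S d ≡ inj₂ β → target b g ≡ β → L (inj₂ (inj₂ g)) (σ d)
    b-source (inj₂ f) p q = trans (cong inj₂ q) (sym p) , tt

    link : ∀ {x y} → Link (act F a) b x y →
           Walk L (List⁺.head (expand x)) (toList (expand x)) (List⁺.head (expand y))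
    link {inj₁ x} {inj₂ g} (p , _) = labels⁺-walk σ (λ {d} {e} → σ-link {d} {e}) x λ d q → b-target d q p
    link {inj₂ g} {inj₁ x} (p , _) =
      b-source (List⁺.head (labels⁺ {S = S} {ι = inj₂} x)) (labels⁺-source {S = S} {ι = inj₂} x) p ∷ []

    coh : ∀ {x y} → Coh (act F a □ b) x y → ∀ {d e} → d ∈ᴸ toList (expand x) → e ∈ᴸ toList (expand y) →
          Coh (F □ (a ⊗ᵍ b)) d e
    coh {inj₁ x} {inj₁ y} c d∈ e∈ with ∈-map⁻ σ d∈ | ∈-map⁻ σ e∈
    ... | d , p , refl | e , q , refl = σ-coh d e (labels⁺-coherent {S = S} {ι = inj₂} x y c p q)
    coh {inj₁ x} {inj₂ g} _ d∈ (here refl) with ∈-map⁻ σ d∈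
    ... | inj₁ _ , _ , refl = tt
    ... | inj₂ _ , _ , refl = tt
    coh {inj₂ g} {inj₁ x} _ (here refl) e∈ with ∈-map⁻ σ e∈
    ... | inj₁ _ , _ , refl = tt
    ... | inj₂ _ , _ , refl = tt
    coh {inj₂ g} {inj₂ h} c (here refl) (here refl) = c

  act-cycle⁺ : PlugCycle (act F a) b → PlugCycle F (a ⊗ᵍ b)
  act-cycle⁺ = expand-cycle expand (λ {x} {y} → link {x} {y}) (λ {x} {y} → coh {x} {y})

  -- The first alternative is the cycle closed between `F` and `a`: it meets no outer vertex at
  -- which a route of `act F a` could begin, so it has to be excluded by other means.
  act-cycle⁻ : PlugCycle F (a ⊗ᵍ b) → PlugCycle F (rename inj₁ a) ⊎ PlugCycle (act F a) b
  act-cycle⁻ c = Sum.map₁ swap-⟂ (Substitute.substitute S inj₂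
    {L = λ x y → L (ρ⁻¹ x) (ρ⁻¹ y)} {C = λ x y → Coh (F □ (a ⊗ᵍ b)) (ρ⁻¹ x) (ρ⁻¹ y)}
    {L′ = Link (act F a) b} {C′ = Coh (act F a □ b)}
    (λ { {inj₁ _} {inj₂ _} (p , _) → p , tt ; {inj₂ _} {inj₁ _} (p , _) → p , tt })
    (λ { {inj₁ _} {inj₁ _} c → c ; {inj₁ _} {inj₂ _} c → tt ; {inj₂ _} {inj₁ _} c → tt ; {inj₂ _} {inj₂ _} c → c })
    (λ { {g} {inj₂ _} (p , _) → target b g , p })
    (λ { {inj₂ _} {g} (p , _) → source b g , sym p })
    (λ { {g} {inj₂ _} (p , _) _ q → inj₂-injective (trans p (sym q)) , tt })
    (λ { {inj₂ _} {g} (p , _) _ q → inj₂-injective (trans q p) , tt })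
    (λ { (_ , ()) })
    id (λ _ _ → id) (λ _ _ → tt) (λ _ _ → tt)
    (map-cycle ρ
      (λ {x} {y} → subst₂ L (sym (ρ⁻¹∘ρ x)) (sym (ρ⁻¹∘ρ y)))
      (λ {x} {y} → subst₂ (Coh (F □ (a ⊗ᵍ b))) (sym (ρ⁻¹∘ρ x)) (sym (ρ⁻¹∘ρ y))) c))

-- Orthogonality and conducts

Graphs : Set → Set₂
Graphs V = Pred (CohGraph V) (lsuc 0ℓ)

empty : CohGraph V
empty = record
  { Edge         = ⊥
  ; source       = λ ()
  ; target       = λ ()
  ; _⌢_          = λ _ _ → ⊥
  ; ⌢-refl       = λ { {()} }
  ; ⌢-sym        = λ ()
  ; ⌢-irrelevant = λ ()
  }

¬PlugCycle : {G H : CohGraph V} → G ⟂ H → ¬ PlugCycle G H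
¬PlugCycle {G = G} {H} G⟂H c = G⟂H (fromCycle G H c)

-- Cycles alternate, so the start of one or the successor of its start lies in `G`.
edgeless-⟂ : {G : CohGraph V} → ¬ Edge G → (H : CohGraph V) → G ⟂ H
edgeless-⟂ {G = G} ¬e H c with toCycle G H c
... | cyc@(cycle {inj₁ e} _ _) = ¬e e
... | cyc@(cycle {inj₂ f} _ _) with cycle-successor cyc (here refl)
... | inj₁ e , _ = ¬e e
... | inj₂ _ , (_ , ()) , _

module _ {X : Graphs V} where

  ⊆-Orth² : X ⊆ Orth (Orth X)
  ⊆-Orth² {G} G∈X H H∈ = ⟂-sym {G = H} {G} (H∈ G G∈X)

  ⊆-Orth³ : Orth X ⊆ Orth (Orth (Orth X))
  ⊆-Orth³ {G} G∈ H H∈ = ⟂-sym {G = H} {G} (H∈ G G∈)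

Orth-anti : {X Y : Graphs V} → X ⊆ Y → Orth Y ⊆ Orth X
Orth-anti X⊆Y G∈ H H∈ = G∈ H (X⊆Y H∈)

-- Being orthogonal to everything, `empty` inhabits every conduct. This supplies the one test that
-- excludes closed cycles, and an edgeless partner in a product.
empty-∈ : (𝑨 : Conduct V) → empty ∈ carrier 𝑨
empty-∈ 𝑨 = proj₂ (Conduct.closed 𝑨) λ H _ → edgeless-⟂ (λ ()) H

⊥⊥⊆ : (𝑨 : Conduct V) → carrier ((𝑨 ^⊥) ^⊥) ⊆ carrier 𝑨
⊥⊥⊆ 𝑨 = proj₂ (Conduct.closed 𝑨)

⊆⊥⊥ : (𝑨 : Conduct V) → carrier 𝑨 ⊆ carrier ((𝑨 ^⊥) ^⊥)
⊆⊥⊥ 𝑨 = proj₁ (Conduct.closed 𝑨)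

rename-hom : (f : V → W) (G : CohGraph V) → Hom f G (rename f G)
rename-hom f G = hom id (λ _ → refl) (λ _ → refl) (λ _ _ → id)

rename⁻-hom : {f : V → W} {g : W → V} → (∀ v → g (f v) ≡ v) → (G : CohGraph V) → Hom g (rename f G) G
rename⁻-hom g∘f G = hom id (sym ∘ g∘f ∘ source G) (sym ∘ g∘f ∘ target G) (λ _ _ → id)

swap-hom : (G : CohGraph V) (H : CohGraph W) → Hom swap (G ⊗ᵍ H) (H ⊗ᵍ G)
swap-hom G H = hom swap [ (λ _ → refl) , (λ _ → refl) ] [ (λ _ → refl) , (λ _ → refl) ]
  λ { (inj₁ _) (inj₁ _) → id ; (inj₁ _) (inj₂ _) → id ; (inj₂ _) (inj₁ _) → id ; (inj₂ _) (inj₂ _) → id }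

⟂-swap : (F : CohGraph (V ⊎ W)) (G : CohGraph V) (H : CohGraph W) → rename swap F ⟂ H ⊗ᵍ G → F ⟂ G ⊗ᵍ H
⟂-swap F G H = ⟂-map (rename-hom swap F) (swap-hom G H)

⟂-swap⁻ : (F : CohGraph (V ⊎ W)) (G : CohGraph V) (H : CohGraph W) → F ⟂ G ⊗ᵍ H → rename swap F ⟂ H ⊗ᵍ G
⟂-swap⁻ F G H = ⟂-map (rename⁻-hom swap-involutive F) (swap-hom H G)

act-⟂ : (F : CohGraph (V ⊎ W)) (a : CohGraph V) (b : CohGraph W) → F ⟂ a ⊗ᵍ b → act F a ⟂ b
act-⟂ F a b F⟂ c = ¬PlugCycle F⟂ (act-cycle⁺ F a b (toCycle (act F a) b c))

-- A cycle between `F` and `a` survives the addition of any `b`, so a single passed test rules it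
-- out for all of them.
no-scalar-cycle : (F : CohGraph (V ⊎ W)) (a : CohGraph V) (b : CohGraph W) → F ⟂ a ⊗ᵍ b →
                  ¬ PlugCycle F (rename inj₁ a)
no-scalar-cycle F a b F⟂ c = ¬PlugCycle F⟂ (map-□ {j = id} (hom id (λ _ → refl) (λ _ → refl) (λ _ _ → id))
  (hom inj₁ (λ _ → refl) (λ _ → refl) (λ _ _ → id)) c)

act-⟂⁻ : (F : CohGraph (V ⊎ W)) (a : CohGraph V) (b : CohGraph W) → ¬ PlugCycle F (rename inj₁ a) →
         act F a ⟂ b → F ⟂ a ⊗ᵍ b
act-⟂⁻ F a b F⟂a Fa⟂b c with act-cycle⁻ F a b (toCycle F (a ⊗ᵍ b) c)
... | inj₁ c′ = F⟂a c′
... | inj₂ c′ = ¬PlugCycle Fa⟂b c′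

-- A test of F against a ⊗ b is a test of act F a against b, so b may be
-- replaced by anything in the biorthogonal of the tests.
⟂-biorthʳ : (F : CohGraph (V ⊎ W)) (a : CohGraph V) (Y : Graphs W) → ∃ (_∈ Y) →
            (∀ b → b ∈ Y → F ⟂ a ⊗ᵍ b) → ∀ b → b ∈ Orth (Orth Y) → F ⟂ a ⊗ᵍ b
⟂-biorthʳ F a Y (b₀ , b₀∈) F⟂ b b∈ =
  act-⟂⁻ F a b (no-scalar-cycle F a b₀ (F⟂ b₀ b₀∈))
    (⟂-sym {G = b} {act F a} (b∈ (act F a) (λ b′ b′∈ → act-⟂ F a b′ (F⟂ b′ b′∈))))

⟂-biorthˡ : (F : CohGraph (V ⊎ W)) (X : Graphs V) (b : CohGraph W) → ∃ (_∈ X) →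
            (∀ a → a ∈ X → F ⟂ a ⊗ᵍ b) → ∀ a → a ∈ Orth (Orth X) → F ⟂ a ⊗ᵍ b
⟂-biorthˡ F X b x₀ F⟂ a a∈ = ⟂-swap F a b
  (⟂-biorthʳ (rename swap F) b X x₀ (λ a′ a′∈ → ⟂-swap⁻ F a′ b (F⟂ a′ a′∈)) a a∈)

-- The generating set in the definition of 𝑨 ⊗ 𝑩.
Products : Conduct V → Conduct W → Graphs (V ⊎ W)
Products 𝑨 𝑩 F = ∃₂ λ G H → G ∈ carrier 𝑨 × H ∈ carrier 𝑩 × F ≡ G ⊗ᵍ H

product-∈ : (𝑨 : Conduct V) (𝑩 : Conduct W) {a : CohGraph V} {b : CohGraph W} → a ∈ carrier 𝑨 → b ∈ carrier 𝑩 →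
            a ⊗ᵍ b ∈ carrier (𝑨 ⊗ 𝑩)
product-∈ 𝑨 𝑩 a∈ b∈ = ⊆-Orth² {X = Products 𝑨 𝑩} (_ , _ , a∈ , b∈ , refl)

products-inhabited : (𝑨 : Conduct V) (𝑩 : Conduct W) → ∃ (_∈ Products 𝑨 𝑩)
products-inhabited 𝑨 𝑩 = _ , _ , _ , empty-∈ 𝑨 , empty-∈ 𝑩 , refl

-- In particular membership in 𝑨 ⊸ 𝑩, which is (𝑨 ⊗ 𝑩 ^⊥) ^⊥.
⊗^⊥-intro : (𝑨 : Conduct V) (𝑩 : Conduct W) {F : CohGraph (V ⊎ W)} →
            (∀ a b → a ∈ carrier 𝑨 → b ∈ carrier 𝑩 → F ⟂ a ⊗ᵍ b) → F ∈ carrier ((𝑨 ⊗ 𝑩) ^⊥)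
⊗^⊥-intro 𝑨 𝑩 F⟂ = ⊆-Orth³ {X = Products 𝑨 𝑩} λ { _ (a , b , a∈ , b∈ , refl) → F⟂ a b a∈ b∈ }

⊗^⊥-elim : (𝑨 : Conduct V) (𝑩 : Conduct W) {F : CohGraph (V ⊎ W)} → F ∈ carrier ((𝑨 ⊗ 𝑩) ^⊥) →
           ∀ a b → a ∈ carrier 𝑨 → b ∈ carrier 𝑩 → F ⟂ a ⊗ᵍ b
⊗^⊥-elim 𝑨 𝑩 F∈ a b a∈ b∈ = F∈ (a ⊗ᵍ b) (product-∈ 𝑨 𝑩 a∈ b∈)

-- Elements of a tensor need not be products, being taken from a biorthogonal. Membership in
-- conducts with nested tensors is reduced to products through this lemma and its mirror image.
⟂-⊗ˡ : (𝑨 : Conduct V) (𝑩 : Conduct W) (F : CohGraph ((V ⊎ W) ⊎ U)) (c : CohGraph U) →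
       (∀ a b → a ∈ carrier 𝑨 → b ∈ carrier 𝑩 → F ⟂ (a ⊗ᵍ b) ⊗ᵍ c) →
       ∀ p → p ∈ carrier (𝑨 ⊗ 𝑩) → F ⟂ p ⊗ᵍ c
⟂-⊗ˡ 𝑨 𝑩 F c F⟂ = ⟂-biorthˡ F (Products 𝑨 𝑩) c (products-inhabited 𝑨 𝑩)
  λ { _ (a , b , a∈ , b∈ , refl) → F⟂ a b a∈ b∈ }

⟂-⊗ʳ : (𝑨 : Conduct V) (𝑩 : Conduct W) (F : CohGraph (U ⊎ (V ⊎ W))) (c : CohGraph U) →
       (∀ a b → a ∈ carrier 𝑨 → b ∈ carrier 𝑩 → F ⟂ c ⊗ᵍ (a ⊗ᵍ b)) →
       ∀ p → p ∈ carrier (𝑨 ⊗ 𝑩) → F ⟂ c ⊗ᵍ p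
⟂-⊗ʳ 𝑨 𝑩 F c F⟂ = ⟂-biorthʳ F c (Products 𝑨 𝑩) (products-inhabited 𝑨 𝑩)
  λ { _ (a , b , a∈ , b∈ , refl) → F⟂ a b a∈ b∈ }

act-∈ : (𝑨 : Conduct V) (𝑩 : Conduct W) {F : CohGraph (V ⊎ W)} {a : CohGraph V} →
        F ∈ carrier (𝑨 ⊸ 𝑩) → a ∈ carrier 𝑨 → act F a ∈ carrier 𝑩
act-∈ 𝑨 𝑩 {F} {a} F∈ a∈ = ⊥⊥⊆ 𝑩 λ b b∈ → act-⟂ F a b (⊗^⊥-elim 𝑨 (𝑩 ^⊥) F∈ a b a∈ b∈)

⊸-no-scalar-cycle : (𝑨 : Conduct V) (𝑩 : Conduct W) {F : CohGraph (V ⊎ W)} {a : CohGraph V} →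
                    F ∈ carrier (𝑨 ⊸ 𝑩) → a ∈ carrier 𝑨 → ¬ PlugCycle F (rename inj₁ a)
⊸-no-scalar-cycle 𝑨 𝑩 {F} {a} F∈ a∈ =
  no-scalar-cycle F a empty (⊗^⊥-elim 𝑨 (𝑩 ^⊥) F∈ a empty a∈ (empty-∈ (𝑩 ^⊥)))

-- Morphisms under composition, tensor, duality and currying

module _ (F : CohGraph (A ⊎ B)) (G : CohGraph (B ⊎ C)) (a : CohGraph A) (c : CohGraph C) where
  private
    S₀ = plug (rename {W = A ⊎ B ⊎ C} (Sum.map₂ inj₁) F) (rename inj₂ G)
    ι : A ⊎ C → A ⊎ B ⊎ C
    ι = Sum.map₂ inj₂
    X = Exec S₀ ι

    E : Set
    E = (Edge a ⊎ Edge F) ⊎ (Edge G ⊎ Edge c)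

    s t : E → A ⊎ B ⊎ C
    s (inj₁ (inj₁ e)) = inj₁ (source a e)
    s (inj₁ (inj₂ e)) = Sum.map₂ inj₁ (source F e)
    s (inj₂ (inj₁ e)) = inj₂ (source G e)
    s (inj₂ (inj₂ e)) = inj₂ (inj₂ (source c e))
    t (inj₁ (inj₁ e)) = inj₁ (target a e)
    t (inj₁ (inj₂ e)) = Sum.map₂ inj₁ (target F e)
    t (inj₂ (inj₁ e)) = inj₂ (target G e)
    t (inj₂ (inj₂ e)) = inj₂ (inj₂ (target c e))

    -- In the chain `a`, `F`, `G`, `c` only neighbours share vertices, and precisely these pairs may
    -- alternate. The relation thus fits the grouping of `F` with `G` as well as that of `a` with
    -- `F`.
    Adjacent : Rel E 0ℓ
    Adjacent (inj₁ d)        (inj₁ e)        = Opposite d e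
    Adjacent (inj₁ (inj₂ _)) (inj₂ (inj₁ _)) = ⊤
    Adjacent (inj₂ (inj₁ _)) (inj₁ (inj₂ _)) = ⊤
    Adjacent (inj₂ d)        (inj₂ e)        = Opposite d e
    Adjacent _               _               = ⊥

    L K : Rel E 0ℓ
    L d e = t d ≡ s e × Adjacent d e
    K (inj₁ d) (inj₁ e) = Coh (rename inj₁ a □ F) d e
    K (inj₂ d) (inj₂ e) = Coh (G □ rename inj₂ c) d e
    K (inj₁ _) (inj₂ _) = ⊤
    K (inj₂ _) (inj₁ _) = ⊤

    σ : Edge F ⊎ Edge G → E
    σ (inj₁ e) = inj₁ (inj₂ e)
    σ (inj₂ e) = inj₂ (inj₁ e)

    σ-link : ∀ {d e} → System.t S₀ d ≡ System.s S₀ e → Opposite d e → L (σ d) (σ e)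
    σ-link {inj₁ _} {inj₂ _} p o = p , o
    σ-link {inj₂ _} {inj₁ _} p o = p , o

    σ-coh : ∀ d e → Coh (System.graph S₀) d e → K (σ d) (σ e)
    σ-coh (inj₁ _) (inj₁ _) = id
    σ-coh (inj₁ _) (inj₂ _) = id
    σ-coh (inj₂ _) (inj₁ _) = id
    σ-coh (inj₂ _) (inj₂ _) = id

    side : Edge a ⊎ Edge c → E
    side (inj₁ e) = inj₁ (inj₁ e)
    side (inj₂ e) = inj₂ (inj₂ e)

    expand : Edge X ⊎ (Edge a ⊎ Edge c) → List⁺ E
    expand (inj₁ x) = List⁺.map σ (labels⁺ {S = S₀} {ι = ι} x)
    expand (inj₂ e) = side e ∷ []

    F#c : ∀ v {w} → _≡_ {A = A ⊎ B ⊎ C} (Sum.map₂ inj₁ v) (inj₂ (inj₂ w)) → ⊥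
    F#c (inj₁ _) ()
    F#c (inj₂ _) ()

    arrive : ∀ d e {v} → System.t S₀ d ≡ ι v → v ≡ source (a ⊗ᵍ c) e → L (σ d) (side e)
    arrive (inj₁ _) (inj₁ _) p refl = p , tt
    arrive (inj₁ d) (inj₂ e) p refl = ⊥-elim (F#c (target F d) p)
    arrive (inj₂ _) (inj₂ _) p refl = p , tt

    depart : ∀ d e {v} → System.s S₀ d ≡ ι v → target (a ⊗ᵍ c) e ≡ v → L (side e) (σ d)
    depart (inj₁ _) (inj₁ _) p refl = sym p , tt
    depart (inj₁ d) (inj₂ e) p refl = ⊥-elim (F#c (source F d) p)
    depart (inj₂ _) (inj₂ _) p refl = sym p , tt

    link : ∀ {x y} → Link X (a ⊗ᵍ c) x y →
           Walk L (List⁺.head (expand x)) (toList (expand x)) (List⁺.head (expand y))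
    link {inj₁ x} {inj₂ e} (p , _) = labels⁺-walk σ (λ {d} {e} → σ-link {d} {e}) x λ d q → arrive d e q p
    link {inj₂ e} {inj₁ x} (p , _) =
      depart (List⁺.head (labels⁺ {S = S₀} {ι = ι} x)) e (labels⁺-source {S = S₀} {ι = ι} x) p ∷ []

    σ-side : ∀ d e → K (σ d) (side e)
    σ-side (inj₁ _) (inj₁ _) = tt
    σ-side (inj₁ _) (inj₂ _) = tt
    σ-side (inj₂ _) (inj₁ _) = tt
    σ-side (inj₂ _) (inj₂ _) = tt

    side-σ : ∀ e d → K (side e) (σ d)
    side-σ (inj₁ _) (inj₁ _) = tt
    side-σ (inj₁ _) (inj₂ _) = tt
    side-σ (inj₂ _) (inj₁ _) = tt
    side-σ (inj₂ _) (inj₂ _) = tt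

    side-side : ∀ d e → Coh (a ⊗ᵍ c) d e → K (side d) (side e)
    side-side (inj₁ _) (inj₁ _) = id
    side-side (inj₁ _) (inj₂ _) = id
    side-side (inj₂ _) (inj₁ _) = id
    side-side (inj₂ _) (inj₂ _) = id

    coh : ∀ {x y} → Coh (X □ (a ⊗ᵍ c)) x y → ∀ {d e} → d ∈ᴸ toList (expand x) → e ∈ᴸ toList (expand y) → K d e
    coh {inj₁ x} {inj₁ y} r d∈ e∈ with ∈-map⁻ σ d∈ | ∈-map⁻ σ e∈
    ... | d , p , refl | e , q , refl = σ-coh d e (labels⁺-coherent {S = S₀} {ι = ι} x y r p q)
    coh {inj₁ x} {inj₂ g} _ d∈ (here refl) with ∈-map⁻ σ d∈
    ... | d , _ , refl = σ-side d g
    coh {inj₂ g} {inj₁ x} _ (here refl) e∈ with ∈-map⁻ σ e∈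
    ... | e , _ , refl = side-σ g e
    coh {inj₂ d} {inj₂ e} r (here refl) (here refl) = side-side d e r

    K₁ = act F a
    S  = plug (rename inj₁ a) F

    τ : Edge K₁ ⊎ (Edge G ⊎ Edge c) → Edge G ⊎ (Edge K₁ ⊎ Edge c)
    τ (inj₁ x)        = inj₂ (inj₁ x)
    τ (inj₂ (inj₁ e)) = inj₁ e
    τ (inj₂ (inj₂ e)) = inj₂ (inj₂ e)

    k-injective : ∀ {v w : A ⊎ B} → _≡_ {A = A ⊎ B ⊎ C} (Sum.map₂ inj₁ v) (Sum.map₂ inj₁ w) → v ≡ w
    k-injective {inj₁ _} {inj₁ _} refl = refl
    k-injective {inj₂ _} {inj₂ _} refl = refl

    FG : ∀ (v : A ⊎ B) {w} → _≡_ {A = A ⊎ B ⊎ C} (Sum.map₂ inj₁ v) (inj₂ w) → ∃ λ b → v ≡ inj₂ b × w ≡ inj₁ b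
    FG (inj₂ b) refl = b , refl , refl

    FG′ : ∀ {v : A ⊎ B} {b w} → inj₂ b ≡ v → _≡_ {A = A ⊎ B ⊎ C} (Sum.map₂ inj₁ v) (inj₂ w) → inj₁ b ≡ w
    FG′ refl refl = refl

  -- Flatten F ∷∷ G, then regroup the edges of a and F into act F a.
  ∷∷-cycle : PlugCycle X (a ⊗ᵍ c) → PlugCycle F (rename inj₁ a) ⊎ PlugCycle G (act F a ⊗ᵍ c)
  ∷∷-cycle cyc = Sum.map₁ swap-⟂ (Sum.map₂ (map-cycle τ id id) (Substitute.substitute S inj₂
    {L = L} {C = K}
    {L′ = λ x y → Link G (K₁ ⊗ᵍ c) (τ x) (τ y)} {C′ = λ x y → Coh (G □ (K₁ ⊗ᵍ c)) (τ x) (τ y)}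
    (λ { {inj₁ _} {inj₂ _} (p , o) → k-injective p , o ; {inj₂ _} {inj₁ _} (p , o) → k-injective p , o })
    id
    (λ { {inj₁ e} {inj₂ f} (p , _) → let b , q , _ = FG (source F f) (sym p) in b , sym q })
    (λ { {inj₂ f} {inj₁ e} (p , _) → let b , q , _ = FG (target F f) p in b , sym q })
    (λ { {inj₁ e} {inj₂ f} (p , _) x q → sym (FG′ q (sym p)) , tt })
    (λ { {inj₂ f} {inj₁ e} (p , _) x q → FG′ q p , tt })
    (λ { {inj₁ _} {inj₂ _} (p , o) → inj₂-injective p , o ; {inj₂ _} {inj₁ _} (p , o) → inj₂-injective p , o })
    (λ { {inj₁ _} {inj₁ _} → id ; {inj₁ _} {inj₂ _} → id ; {inj₂ _} {inj₁ _} → id ; {inj₂ _} {inj₂ _} → id })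
    (λ _ _ → id) (λ { _ (inj₁ _) → tt ; _ (inj₂ _) → tt }) (λ { (inj₁ _) _ → tt ; (inj₂ _) _ → tt })
    (expand-cycle expand (λ {x} {y} → link {x} {y}) (λ {x} {y} → coh {x} {y}) cyc)))

-- A cycle against `a ⊗ᵍ c` closes up between `F` and `a`, or becomes a cycle of `G` against
-- `act F a` and `c`. Membership of `F` forbids the former and puts `act F a` into `𝑩`, so that
-- membership of `G` forbids the latter.
∷∷-∈ : (𝑨 : Conduct A) (𝑩 : Conduct B) (𝑪 : Conduct C) {F : CohGraph (A ⊎ B)} {G : CohGraph (B ⊎ C)} →
       F ∈ carrier (𝑨 ⊸ 𝑩) → G ∈ carrier (𝑩 ⊸ 𝑪) → F ∷∷ G ∈ carrier (𝑨 ⊸ 𝑪)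
∷∷-∈ 𝑨 𝑩 𝑪 {F} {G} F∈ G∈ = ⊗^⊥-intro 𝑨 (𝑪 ^⊥) λ a c a∈ c∈ →
  ⟂-map {G′ = Exec (plug (rename (Sum.map₂ inj₁) F) (rename inj₂ G)) (Sum.map₂ inj₂)} {H′ = a ⊗ᵍ c}
    (≅⇒Hom (∷∷≅Exec F G)) (≅⇒Hom ≅-refl) λ cyc →
    [ ⊸-no-scalar-cycle 𝑨 𝑩 F∈ a∈
    , ¬PlugCycle (⊗^⊥-elim 𝑩 (𝑪 ^⊥) G∈ (act F a) c (act-∈ 𝑨 𝑩 F∈ a∈) c∈)
    ] (∷∷-cycle F G a c (toCycle _ (a ⊗ᵍ c) cyc))

module _ (F : CohGraph (A ⊎ B)) (G : CohGraph (C ⊎ D)) (a : CohGraph A) (c : CohGraph C) (q : CohGraph (B ⊎ D)) where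
  private
    Vertices : Set
    Vertices = (A ⊎ C) ⊎ (B ⊎ D)

    i₁ : A ⊎ B → Vertices
    i₁ v = interchange (inj₁ v)

    i₂ : C ⊎ D → Vertices
    i₂ v = interchange (inj₂ v)

    i₁-injective : ∀ v w → i₁ v ≡ i₁ w → v ≡ w
    i₁-injective (inj₁ _) (inj₁ _) refl = refl
    i₁-injective (inj₂ _) (inj₂ _) refl = refl

    i₂-injective : ∀ v w → i₂ v ≡ i₂ w → v ≡ w
    i₂-injective (inj₁ _) (inj₁ _) refl = refl
    i₂-injective (inj₂ _) (inj₂ _) refl = refl

    i₁#i₂ : ∀ v w → i₁ v ≡ i₂ w → ⊥
    i₁#i₂ (inj₁ _) (inj₁ _) ()
    i₁#i₂ (inj₂ _) (inj₂ _) ()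

    i₁-right : ∀ v {w} → i₁ v ≡ inj₂ w → ∃ λ b → v ≡ inj₂ b × w ≡ inj₁ b
    i₁-right (inj₂ b) refl = b , refl , refl

    i₂-right : ∀ v {w} → i₂ v ≡ inj₂ w → ∃ λ d → v ≡ inj₂ d × w ≡ inj₂ d
    i₂-right (inj₂ d) refl = d , refl , refl

    FG T : CohGraph Vertices
    FG = rename interchange (F ⊗ᵍ G)
    T  = (a ⊗ᵍ c) ⊗ᵍ q

    Fa = act F a
    Gc = act G c

    FaG cq : CohGraph Vertices
    FaG = rename (i₁ ∘ inj₂) Fa □ rename i₂ G
    cq  = rename (i₂ ∘ inj₁) c □ rename inj₂ q

    ρ₁ : Edge FG ⊎ Edge T → (Edge a ⊎ Edge F) ⊎ ((Edge G ⊎ Edge c) ⊎ Edge q)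
    ρ₁ (inj₁ (inj₁ f))        = inj₁ (inj₂ f)
    ρ₁ (inj₁ (inj₂ g))        = inj₂ (inj₁ (inj₁ g))
    ρ₁ (inj₂ (inj₁ (inj₁ e))) = inj₁ (inj₁ e)
    ρ₁ (inj₂ (inj₁ (inj₂ e))) = inj₂ (inj₁ (inj₂ e))
    ρ₁ (inj₂ (inj₂ e))        = inj₂ (inj₂ e)

    ρ₁⁻¹ : (Edge a ⊎ Edge F) ⊎ ((Edge G ⊎ Edge c) ⊎ Edge q) → Edge FG ⊎ Edge T
    ρ₁⁻¹ (inj₁ (inj₂ f))        = inj₁ (inj₁ f)
    ρ₁⁻¹ (inj₂ (inj₁ (inj₁ g))) = inj₁ (inj₂ g)
    ρ₁⁻¹ (inj₁ (inj₁ e))        = inj₂ (inj₁ (inj₁ e))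
    ρ₁⁻¹ (inj₂ (inj₁ (inj₂ e))) = inj₂ (inj₁ (inj₂ e))
    ρ₁⁻¹ (inj₂ (inj₂ e))        = inj₂ (inj₂ e)

    ρ₁⁻¹∘ρ₁ : ∀ e → ρ₁⁻¹ (ρ₁ e) ≡ e
    ρ₁⁻¹∘ρ₁ (inj₁ (inj₁ _))        = refl
    ρ₁⁻¹∘ρ₁ (inj₁ (inj₂ _))        = refl
    ρ₁⁻¹∘ρ₁ (inj₂ (inj₁ (inj₁ _))) = refl
    ρ₁⁻¹∘ρ₁ (inj₂ (inj₁ (inj₂ _))) = refl
    ρ₁⁻¹∘ρ₁ (inj₂ (inj₂ _))        = refl

    τ₁ : Edge Fa ⊎ ((Edge G ⊎ Edge c) ⊎ Edge q) → Edge FaG ⊎ Edge cq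
    τ₁ (inj₁ x)               = inj₁ (inj₁ x)
    τ₁ (inj₂ (inj₁ (inj₁ g))) = inj₁ (inj₂ g)
    τ₁ (inj₂ (inj₁ (inj₂ e))) = inj₂ (inj₁ e)
    τ₁ (inj₂ (inj₂ e))        = inj₂ (inj₂ e)

    absorb-F : PlugCycle FG T → PlugCycle (rename inj₁ a) F ⊎ PlugCycle FaG cq
    absorb-F cyc = Sum.map₂ (map-cycle τ₁ id id) (Substitute.substitute (plug (rename inj₁ a) F) inj₂
      {L = λ x y → Link FG T (ρ₁⁻¹ x) (ρ₁⁻¹ y)} {C = λ x y → Coh (FG □ T) (ρ₁⁻¹ x) (ρ₁⁻¹ y)}
      {L′ = λ x y → Link FaG cq (τ₁ x) (τ₁ y)} {C′ = λ x y → Coh (FaG □ cq) (τ₁ x) (τ₁ y)}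
      (λ { {inj₁ _} {inj₂ _} (p , _) → i₁-injective _ _ p , tt
         ; {inj₂ _} {inj₁ _} (p , _) → i₁-injective _ _ p , tt })
      (λ { {inj₁ _} {inj₁ _} → id ; {inj₁ _} {inj₂ _} → id ; {inj₂ _} {inj₁ _} → id ; {inj₂ _} {inj₂ _} → id })
      -- A segment of `a` and `F` is entered only from `q`, and below it is left only towards `q`:
      -- edges of `G` and `c` live on the other tensor factor.
      (λ { {inj₂ _} {inj₂ f} (p , _) → let b , r , _ = i₁-right (source F f) (sym p) in b , sym r
         ; {inj₁ (inj₁ g)} {inj₁ e} (p , _) → ⊥-elim (i₁#i₂ (inj₁ (source a e)) (target G g) (sym p))
         ; {inj₁ (inj₂ e)} {inj₂ f} (p , _) → ⊥-elim (i₁#i₂ (source F f) (inj₁ (target c e)) (sym p)) })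
      (λ { {inj₂ f} {inj₂ _} (p , _) → let b , r , _ = i₁-right (target F f) p in b , sym r
         ; {inj₁ e} {inj₁ (inj₁ g)} (p , _) → ⊥-elim (i₁#i₂ (inj₁ (target a e)) (source G g) p)
         ; {inj₂ f} {inj₁ (inj₂ e)} (p , _) → ⊥-elim (i₁#i₂ (target F f) (inj₁ (source c e)) p) })
      (λ { {inj₂ _} {inj₂ f} (p , _) x r → trans p (cong i₁ (sym r)) , tt
         ; {inj₁ (inj₁ g)} {inj₁ e} (p , _) → ⊥-elim (i₁#i₂ (inj₁ (source a e)) (target G g) (sym p))
         ; {inj₁ (inj₂ e)} {inj₂ f} (p , _) → ⊥-elim (i₁#i₂ (source F f) (inj₁ (target c e)) (sym p)) })
      (λ { {inj₂ f} {inj₂ _} (p , _) x r → trans (cong i₁ r) p , tt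
         ; {inj₁ e} {inj₁ (inj₁ g)} (p , _) → ⊥-elim (i₁#i₂ (inj₁ (target a e)) (source G g) p)
         ; {inj₂ f} {inj₁ (inj₂ e)} (p , _) → ⊥-elim (i₁#i₂ (target F f) (inj₁ (source c e)) p) })
      (λ { {inj₁ (inj₁ _)} {inj₁ (inj₂ _)} l → l ; {inj₁ (inj₁ _)} {inj₂ _} l → l
         ; {inj₁ (inj₂ _)} {inj₁ (inj₁ _)} l → l ; {inj₂ _} {inj₁ (inj₁ _)} l → l })
      (λ { {inj₁ (inj₁ _)} {inj₁ (inj₁ _)} → id ; {inj₁ (inj₁ _)} {inj₁ (inj₂ _)} → id
         ; {inj₁ (inj₂ _)} {inj₁ (inj₁ _)} → id ; {inj₁ (inj₂ _)} {inj₁ (inj₂ _)} → id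
         ; {inj₁ (inj₁ _)} {inj₂ _} → id ; {inj₁ (inj₂ _)} {inj₂ _} → id
         ; {inj₂ _} {inj₁ (inj₁ _)} → id ; {inj₂ _} {inj₁ (inj₂ _)} → id ; {inj₂ _} {inj₂ _} → id })
      (λ _ _ → id)
      (λ { _ (inj₁ (inj₁ _)) → tt ; _ (inj₁ (inj₂ _)) → tt ; _ (inj₂ _) → tt })
      (λ { (inj₁ (inj₁ _)) _ → tt ; (inj₁ (inj₂ _)) _ → tt ; (inj₂ _) _ → tt })
      (map-cycle ρ₁
        (λ {x} {y} → subst₂ (Link FG T) (sym (ρ₁⁻¹∘ρ₁ x)) (sym (ρ₁⁻¹∘ρ₁ y)))
        (λ {x} {y} → subst₂ (Coh (FG □ T)) (sym (ρ₁⁻¹∘ρ₁ x)) (sym (ρ₁⁻¹∘ρ₁ y))) cyc))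

    ρ₂ : Edge FaG ⊎ Edge cq → (Edge c ⊎ Edge G) ⊎ (Edge Fa ⊎ Edge q)
    ρ₂ (inj₁ (inj₁ x)) = inj₂ (inj₁ x)
    ρ₂ (inj₁ (inj₂ g)) = inj₁ (inj₂ g)
    ρ₂ (inj₂ (inj₁ e)) = inj₁ (inj₁ e)
    ρ₂ (inj₂ (inj₂ e)) = inj₂ (inj₂ e)

    ρ₂⁻¹ : (Edge c ⊎ Edge G) ⊎ (Edge Fa ⊎ Edge q) → Edge FaG ⊎ Edge cq
    ρ₂⁻¹ (inj₂ (inj₁ x)) = inj₁ (inj₁ x)
    ρ₂⁻¹ (inj₁ (inj₂ g)) = inj₁ (inj₂ g)
    ρ₂⁻¹ (inj₁ (inj₁ e)) = inj₂ (inj₁ e)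
    ρ₂⁻¹ (inj₂ (inj₂ e)) = inj₂ (inj₂ e)

    ρ₂⁻¹∘ρ₂ : ∀ e → ρ₂⁻¹ (ρ₂ e) ≡ e
    ρ₂⁻¹∘ρ₂ (inj₁ (inj₁ _)) = refl
    ρ₂⁻¹∘ρ₂ (inj₁ (inj₂ _)) = refl
    ρ₂⁻¹∘ρ₂ (inj₂ (inj₁ _)) = refl
    ρ₂⁻¹∘ρ₂ (inj₂ (inj₂ _)) = refl

    τ₂ : Edge Gc ⊎ (Edge Fa ⊎ Edge q) → Edge q ⊎ (Edge Fa ⊎ Edge Gc)
    τ₂ (inj₁ x)        = inj₂ (inj₂ x)
    τ₂ (inj₂ (inj₁ x)) = inj₂ (inj₁ x)
    τ₂ (inj₂ (inj₂ e)) = inj₁ e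

    absorb-G : PlugCycle FaG cq → PlugCycle (rename inj₁ c) G ⊎ PlugCycle q (Fa ⊗ᵍ Gc)
    absorb-G cyc = Sum.map₂ (map-cycle τ₂ id id) (Substitute.substitute (plug (rename inj₁ c) G) inj₂
      {L = λ x y → Link FaG cq (ρ₂⁻¹ x) (ρ₂⁻¹ y)} {C = λ x y → Coh (FaG □ cq) (ρ₂⁻¹ x) (ρ₂⁻¹ y)}
      {L′ = λ x y → Link q (Fa ⊗ᵍ Gc) (τ₂ x) (τ₂ y)} {C′ = λ x y → Coh (q □ (Fa ⊗ᵍ Gc)) (τ₂ x) (τ₂ y)}
      (λ { {inj₁ _} {inj₂ _} (p , _) → i₂-injective _ _ p , tt
         ; {inj₂ _} {inj₁ _} (p , _) → i₂-injective _ _ p , tt })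
      (λ { {inj₁ _} {inj₁ _} → id ; {inj₁ _} {inj₂ _} → id ; {inj₂ _} {inj₁ _} → id ; {inj₂ _} {inj₂ _} → id })
      (λ { {inj₂ _} {inj₂ g} (p , _) → let d , r , _ = i₂-right (source G g) (sym p) in d , sym r
         ; {inj₁ x} {inj₁ e} (p , _) → ⊥-elim (i₁#i₂ (inj₂ (target Fa x)) (inj₁ (source c e)) p) })
      (λ { {inj₂ g} {inj₂ _} (p , _) → let d , r , _ = i₂-right (target G g) p in d , sym r
         ; {inj₁ e} {inj₁ x} (p , _) → ⊥-elim (i₁#i₂ (inj₂ (source Fa x)) (inj₁ (target c e)) (sym p)) })
      (λ { {inj₂ _} {inj₂ g} (p , _) x r → inj₂-injective (trans p (cong i₂ (sym r))) , tt
         ; {inj₁ x} {inj₁ e} (p , _) → ⊥-elim (i₁#i₂ (inj₂ (target Fa x)) (inj₁ (source c e)) p) })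
      (λ { {inj₂ g} {inj₂ _} (p , _) x r → inj₂-injective (trans (cong i₂ r) p) , tt
         ; {inj₁ e} {inj₁ x} (p , _) → ⊥-elim (i₁#i₂ (inj₂ (source Fa x)) (inj₁ (target c e)) (sym p)) })
      (λ { {inj₁ _} {inj₂ _} (p , _) → inj₂-injective p , tt
         ; {inj₂ _} {inj₁ _} (p , _) → inj₂-injective p , tt })
      (λ { {inj₁ _} {inj₁ _} → id ; {inj₁ _} {inj₂ _} → id ; {inj₂ _} {inj₁ _} → id ; {inj₂ _} {inj₂ _} → id })
      (λ _ _ → id) (λ { _ (inj₁ _) → tt ; _ (inj₂ _) → tt }) (λ { (inj₁ _) _ → tt ; (inj₂ _) _ → tt })
      (map-cycle ρ₂
        (λ {x} {y} → subst₂ (Link FaG cq) (sym (ρ₂⁻¹∘ρ₂ x)) (sym (ρ₂⁻¹∘ρ₂ y)))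
        (λ {x} {y} → subst₂ (Coh (FaG □ cq)) (sym (ρ₂⁻¹∘ρ₂ x)) (sym (ρ₂⁻¹∘ρ₂ y))) cyc))

  -- The cycle is contracted twice, `a` with `F` and then `c` with `G`. What remains tests `q`
  -- against a product, as needed for a `q` taken from the dual of a tensor.
  ⊗ᵍ-⟂ : ¬ PlugCycle F (rename inj₁ a) → ¬ PlugCycle G (rename inj₁ c) → q ⟂ act F a ⊗ᵍ act G c →
         rename interchange (F ⊗ᵍ G) ⟂ (a ⊗ᵍ c) ⊗ᵍ q
  ⊗ᵍ-⟂ F⟂a G⟂c q⟂ cyc with absorb-F (toCycle FG T cyc)
  ... | inj₁ c₁ = F⟂a (swap-⟂ c₁)
  ... | inj₂ c₁ with absorb-G c₁
  ...   | inj₁ c₂ = G⟂c (swap-⟂ c₂)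
  ...   | inj₂ c₂ = ¬PlugCycle q⟂ c₂

⊗ᵍ-∈ : (𝑨 : Conduct A) (𝑩 : Conduct B) (𝑪 : Conduct C) (𝑫 : Conduct D)
       {F : CohGraph (A ⊎ B)} {G : CohGraph (C ⊎ D)} →
       F ∈ carrier (𝑨 ⊸ 𝑩) → G ∈ carrier (𝑪 ⊸ 𝑫) →
       rename interchange (F ⊗ᵍ G) ∈ carrier ((𝑨 ⊗ 𝑪) ⊸ (𝑩 ⊗ 𝑫))
⊗ᵍ-∈ 𝑨 𝑩 𝑪 𝑫 {F} {G} F∈ G∈ = ⊗^⊥-intro (𝑨 ⊗ 𝑪) ((𝑩 ⊗ 𝑫) ^⊥) λ p q p∈ q∈ →
  ⟂-⊗ˡ 𝑨 𝑪 (rename interchange (F ⊗ᵍ G)) q (λ a c a∈ c∈ →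
    ⊗ᵍ-⟂ F G a c q (⊸-no-scalar-cycle 𝑨 𝑩 F∈ a∈) (⊸-no-scalar-cycle 𝑪 𝑫 G∈ c∈)
      (⊗^⊥-elim 𝑩 𝑫 q∈ (act F a) (act G c) (act-∈ 𝑨 𝑩 F∈ a∈) (act-∈ 𝑪 𝑫 G∈ c∈)))
    p p∈

swap-∈ : (𝑨 : Conduct A) (𝑩 : Conduct B) {F : CohGraph (A ⊎ B)} →
         F ∈ carrier (𝑨 ⊸ 𝑩) → rename swap F ∈ carrier (𝑩 ^⊥ ⊸ 𝑨 ^⊥)
swap-∈ 𝑨 𝑩 {F} F∈ = ⊗^⊥-intro (𝑩 ^⊥) ((𝑨 ^⊥) ^⊥) λ b a b∈ a∈ →
  ⟂-swap⁻ F a b (⊗^⊥-elim 𝑨 (𝑩 ^⊥) F∈ a b (⊥⊥⊆ 𝑨 a∈) b∈)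

swap-∈⁻ : (𝑨 : Conduct A) (𝑩 : Conduct B) {F : CohGraph (B ⊎ A)} →
          F ∈ carrier (𝑩 ^⊥ ⊸ 𝑨 ^⊥) → rename swap F ∈ carrier (𝑨 ⊸ 𝑩)
swap-∈⁻ 𝑨 𝑩 {F} F∈ = ⊗^⊥-intro 𝑨 (𝑩 ^⊥) λ a b a∈ b∈ →
  ⟂-swap⁻ F b a (⊗^⊥-elim (𝑩 ^⊥) ((𝑨 ^⊥) ^⊥) F∈ b a b∈ (⊆⊥⊥ 𝑨 a∈))

module _ (φ : V → W) (a : CohGraph V) where
  private
    L = Link (wire φ) (rename inj₁ a)

    no-return : ∀ w x y → L x (inj₁ w) → L (inj₁ w) y → ⊥
    no-return (inj₁ _) _        (inj₂ _) _        (() , _)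
    no-return (inj₂ _) (inj₂ _) _        (() , _) _

  -- Every wire has one end in `W`, where the renamed `a` has no edge, so it lacks a successor or a
  -- predecessor.
  wire-no-scalar-cycle : ¬ PlugCycle (wire φ) (rename inj₁ a)
  wire-no-scalar-cycle cyc@(cycle {inj₁ w} _ _) =
    let x , p , _ = cycle-predecessor cyc (here refl)
        y , q , _ = cycle-successor cyc (here refl)
    in no-return w x y p q
  wire-no-scalar-cycle cyc@(cycle {inj₂ _} _ _) with cycle-successor cyc (here refl)
  ... | inj₂ _ , (_ , ()) , _
  ... | inj₁ w , _ , w∈ =
    let x , p , _ = cycle-predecessor cyc w∈
        y , q , _ = cycle-successor cyc w∈
    in no-return w x y p q

wire-⟂ : (φ : V → W) (a : CohGraph V) (b : CohGraph W) → rename φ a ⟂ b → wire φ ⟂ a ⊗ᵍ b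
wire-⟂ φ a b φa⟂b = act-⟂⁻ (wire φ) a b (wire-no-scalar-cycle φ a)
  (⟂-map {G′ = rename φ a} {H′ = b} (≅⇒Hom (act-wire φ a)) (≅⇒Hom ≅-refl) φa⟂b)

wire-∈ : (𝑨 : Conduct V) (𝑩 : Conduct W) (φ : V → W) → (∀ a → a ∈ carrier 𝑨 → rename φ a ∈ carrier 𝑩) →
         wire φ ∈ carrier (𝑨 ⊸ 𝑩)
wire-∈ 𝑨 𝑩 φ φ-∈ = ⊗^⊥-intro 𝑨 (𝑩 ^⊥) λ a b a∈ b∈ →
  wire-⟂ φ a b (⟂-sym {G = b} {rename φ a} (b∈ (rename φ a) (φ-∈ a a∈)))

wire-⊗-∈ : (𝑨 : Conduct V) (𝑩 : Conduct W) (𝑪 : Conduct U) (φ : V ⊎ W → U) →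
           (∀ a b → a ∈ carrier 𝑨 → b ∈ carrier 𝑩 → rename φ (a ⊗ᵍ b) ∈ carrier 𝑪) →
           wire φ ∈ carrier ((𝑨 ⊗ 𝑩) ⊸ 𝑪)
wire-⊗-∈ 𝑨 𝑩 𝑪 φ φ-∈ = ⊗^⊥-intro (𝑨 ⊗ 𝑩) (𝑪 ^⊥) λ p c p∈ c∈ →
  ⟂-⊗ˡ 𝑨 𝑩 (wire φ) c (λ a b a∈ b∈ →
    wire-⟂ φ (a ⊗ᵍ b) c (⟂-sym {G = c} {rename φ (a ⊗ᵍ b)} (c∈ (rename φ (a ⊗ᵍ b)) (φ-∈ a b a∈ b∈)))) p p∈

assocʳ-hom : (G : CohGraph A) (H : CohGraph B) (K : CohGraph C) → Hom assocʳ ((G ⊗ᵍ H) ⊗ᵍ K) (G ⊗ᵍ (H ⊗ᵍ K))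
assocʳ-hom G H K = hom assocʳ [ [ (λ _ → refl) , (λ _ → refl) ] , (λ _ → refl) ]
                              [ [ (λ _ → refl) , (λ _ → refl) ] , (λ _ → refl) ]
  λ { (inj₁ (inj₁ _)) (inj₁ (inj₁ _)) → id ; (inj₁ (inj₁ _)) (inj₁ (inj₂ _)) → id ; (inj₁ (inj₁ _)) (inj₂ _) → id
    ; (inj₁ (inj₂ _)) (inj₁ (inj₁ _)) → id ; (inj₁ (inj₂ _)) (inj₁ (inj₂ _)) → id ; (inj₁ (inj₂ _)) (inj₂ _) → id
    ; (inj₂ _) (inj₁ (inj₁ _)) → id ; (inj₂ _) (inj₁ (inj₂ _)) → id ; (inj₂ _) (inj₂ _) → id }

assocˡ-hom : (G : CohGraph A) (H : CohGraph B) (K : CohGraph C) → Hom assocˡ (G ⊗ᵍ (H ⊗ᵍ K)) ((G ⊗ᵍ H) ⊗ᵍ K)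
assocˡ-hom G H K = hom assocˡ [ (λ _ → refl) , [ (λ _ → refl) , (λ _ → refl) ] ]
                              [ (λ _ → refl) , [ (λ _ → refl) , (λ _ → refl) ] ]
  λ { (inj₁ _) (inj₁ _) → id ; (inj₁ _) (inj₂ (inj₁ _)) → id ; (inj₁ _) (inj₂ (inj₂ _)) → id
    ; (inj₂ (inj₁ _)) (inj₁ _) → id ; (inj₂ (inj₁ _)) (inj₂ (inj₁ _)) → id ; (inj₂ (inj₁ _)) (inj₂ (inj₂ _)) → id
    ; (inj₂ (inj₂ _)) (inj₁ _) → id ; (inj₂ (inj₂ _)) (inj₂ (inj₁ _)) → id ; (inj₂ (inj₂ _)) (inj₂ (inj₂ _)) → id }

⟂-assocʳ : (F : CohGraph ((A ⊎ B) ⊎ C)) (G : CohGraph A) (H : CohGraph B) (K : CohGraph C) →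
           F ⟂ (G ⊗ᵍ H) ⊗ᵍ K → rename assocʳ F ⟂ G ⊗ᵍ (H ⊗ᵍ K)
⟂-assocʳ F G H K = ⟂-map (rename⁻-hom {f = assocʳ} {g = assocˡ} assocʳˡ F) (assocˡ-hom G H K)

⟂-assocˡ : (F : CohGraph (A ⊎ (B ⊎ C))) (G : CohGraph A) (H : CohGraph B) (K : CohGraph C) →
           F ⟂ G ⊗ᵍ (H ⊗ᵍ K) → rename assocˡ F ⟂ (G ⊗ᵍ H) ⊗ᵍ K
⟂-assocˡ F G H K = ⟂-map (rename⁻-hom {f = assocˡ} {g = assocʳ} assocˡʳ F) (assocʳ-hom G H K)

module _ (𝑨 : Conduct A) (𝑩 : Conduct B) (𝑪 : Conduct C) where

  -- Both memberships amount to passing the tests by all triples `a`, `b`, `c`; the tests differ in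
  -- bracketing only.
  curry-∈ : {F : CohGraph ((A ⊎ B) ⊎ C)} → F ∈ carrier ((𝑨 ⊗ 𝑩) ⊸ 𝑪 ^⊥) →
            rename assocʳ F ∈ carrier (𝑨 ⊸ (𝑩 ⊗ 𝑪) ^⊥)
  curry-∈ {F} F∈ = ⊗^⊥-intro 𝑨 (((𝑩 ⊗ 𝑪) ^⊥) ^⊥) λ a p a∈ p∈ →
    ⟂-⊗ʳ 𝑩 𝑪 (rename assocʳ F) a (λ b c b∈ c∈ →
      ⟂-assocʳ F a b c (⊗^⊥-elim (𝑨 ⊗ 𝑩) ((𝑪 ^⊥) ^⊥) F∈ (a ⊗ᵍ b) c (product-∈ 𝑨 𝑩 a∈ b∈) (⊆⊥⊥ 𝑪 c∈)))
      p (⊥⊥⊆ (𝑩 ⊗ 𝑪) p∈)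

  uncurry-∈ : {F : CohGraph (A ⊎ (B ⊎ C))} → F ∈ carrier (𝑨 ⊸ (𝑩 ⊗ 𝑪) ^⊥) →
              rename assocˡ F ∈ carrier ((𝑨 ⊗ 𝑩) ⊸ 𝑪 ^⊥)
  uncurry-∈ {F} F∈ = ⊗^⊥-intro (𝑨 ⊗ 𝑩) ((𝑪 ^⊥) ^⊥) λ p c p∈ c∈ →
    ⟂-⊗ˡ 𝑨 𝑩 (rename assocˡ F) c (λ a b a∈ b∈ →
      ⟂-assocˡ F a b c (⊗^⊥-elim 𝑨 (((𝑩 ⊗ 𝑪) ^⊥) ^⊥) F∈ a (b ⊗ᵍ c) a∈
        (⊆⊥⊥ (𝑩 ⊗ 𝑪) (product-∈ 𝑩 𝑪 b∈ (⊥⊥⊆ 𝑪 c∈))))) p p∈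

  assocʳ-∈ : wire assocʳ ∈ carrier (((𝑨 ⊗ 𝑩) ⊗ 𝑪) ⊸ (𝑨 ⊗ (𝑩 ⊗ 𝑪)))
  assocʳ-∈ = wire-⊗-∈ (𝑨 ⊗ 𝑩) 𝑪 (𝑨 ⊗ (𝑩 ⊗ 𝑪)) assocʳ λ p c p∈ c∈ → ⊥⊥⊆ (𝑨 ⊗ (𝑩 ⊗ 𝑪)) λ t t∈ →
    ⟂-map {G′ = p ⊗ᵍ c} {H′ = rename assocˡ t} (rename⁻-hom {f = assocʳ} {g = assocˡ} assocʳˡ (p ⊗ᵍ c)) (rename-hom assocˡ t)
      (⟂-sym {G = rename assocˡ t} {p ⊗ᵍ c} (⟂-⊗ˡ 𝑨 𝑩 (rename assocˡ t) c (λ a b a∈ b∈ →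
        ⟂-assocˡ t a b c (⊗^⊥-elim 𝑨 (𝑩 ⊗ 𝑪) t∈ a (b ⊗ᵍ c) a∈ (product-∈ 𝑩 𝑪 b∈ c∈))) p p∈))

  assocˡ-∈ : wire assocˡ ∈ carrier ((𝑨 ⊗ (𝑩 ⊗ 𝑪)) ⊸ ((𝑨 ⊗ 𝑩) ⊗ 𝑪))
  assocˡ-∈ = wire-⊗-∈ 𝑨 (𝑩 ⊗ 𝑪) ((𝑨 ⊗ 𝑩) ⊗ 𝑪) assocˡ λ a p a∈ p∈ → ⊥⊥⊆ ((𝑨 ⊗ 𝑩) ⊗ 𝑪) λ t t∈ →
    ⟂-map {G′ = a ⊗ᵍ p} {H′ = rename assocʳ t} (rename⁻-hom {f = assocˡ} {g = assocʳ} assocˡʳ (a ⊗ᵍ p)) (rename-hom assocʳ t)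
      (⟂-sym {G = rename assocʳ t} {a ⊗ᵍ p} (⟂-⊗ʳ 𝑩 𝑪 (rename assocʳ t) a (λ b c b∈ c∈ →
        ⟂-assocʳ t a b c (⊗^⊥-elim (𝑨 ⊗ 𝑩) 𝑪 t∈ (a ⊗ᵍ b) c (product-∈ 𝑨 𝑩 a∈ b∈) c∈)) p p∈))

-- Generators

-- An element of 𝑨 ⊗ 𝑩 has no edge between V and W: the edges back and
-- forth of the bridge rule them out. Edges of the bridge of different kinds
-- are incoherent, so a cycle through it never comes back from the other side.
bridge : CohGraph V → CohGraph W → CohGraph (V ⊎ W)
bridge {V} {W} G H = record
  { Edge         = (Edge G ⊎ Edge H) ⊎ ((V × W) ⊎ (W × V))
  ; source       = [ [ inj₁ ∘ source G , inj₂ ∘ source H ] , [ inj₁ ∘ proj₁ , inj₂ ∘ proj₁ ] ]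
  ; target       = [ [ inj₁ ∘ target G , inj₂ ∘ target H ] , [ inj₂ ∘ proj₂ , inj₁ ∘ proj₂ ] ]
  ; _⌢_          = _⌢_
  ; ⌢-refl       = λ { {inj₁ (inj₁ _)} → G.⌢-refl ; {inj₁ (inj₂ _)} → H.⌢-refl
                     ; {inj₂ (inj₁ _)} → tt ; {inj₂ (inj₂ _)} → tt }
  ; ⌢-sym        = λ {d} {e} → ⌢-sym d e
  ; ⌢-irrelevant = λ {d} {e} → ⌢-irrelevant d e
  }
  where
  module G = CohGraph G
  module H = CohGraph H

  _⌢_ : Rel ((Edge G ⊎ Edge H) ⊎ ((V × W) ⊎ (W × V))) 0ℓ
  inj₁ (inj₁ d) ⌢ inj₁ (inj₁ e) = d G.⌢ e
  inj₁ (inj₂ d) ⌢ inj₁ (inj₂ e) = d H.⌢ e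
  inj₂ (inj₁ _) ⌢ inj₂ (inj₁ _) = ⊤
  inj₂ (inj₂ _) ⌢ inj₂ (inj₂ _) = ⊤
  _             ⌢ _             = ⊥

  ⌢-sym : ∀ d e → d ⌢ e → e ⌢ d
  ⌢-sym (inj₁ (inj₁ _)) (inj₁ (inj₁ _)) = G.⌢-sym
  ⌢-sym (inj₁ (inj₂ _)) (inj₁ (inj₂ _)) = H.⌢-sym
  ⌢-sym (inj₂ (inj₁ _)) (inj₂ (inj₁ _)) = id
  ⌢-sym (inj₂ (inj₂ _)) (inj₂ (inj₂ _)) = id

  ⌢-irrelevant : ∀ d e (p q : d ⌢ e) → p ≡ q
  ⌢-irrelevant (inj₁ (inj₁ _)) (inj₁ (inj₁ _)) = G.⌢-irrelevant
  ⌢-irrelevant (inj₁ (inj₂ _)) (inj₁ (inj₂ _)) = H.⌢-irrelevant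
  ⌢-irrelevant (inj₂ (inj₁ _)) (inj₂ (inj₁ _)) = λ _ _ → refl
  ⌢-irrelevant (inj₂ (inj₂ _)) (inj₂ (inj₂ _)) = λ _ _ → refl

×-≡⁻ : ∀ {P Q : Set} {x x′ : P} {y y′ : Q} → (x , y) ≡ (x′ , y′) → x ≡ x′ × y ≡ y′
×-≡⁻ refl = refl , refl

-- Edges of `G` and `H` remain on their side while the new ones cross, and each ordered pair of
-- vertices is crossed only once.
bridge-simple : (G : CohGraph V) (H : CohGraph W) → Simple G → Simple H → Simple (bridge G H)
bridge-simple G H Gs Hs {inj₁ (inj₁ _)} {inj₁ (inj₁ _)} eq =
  let p , q = ×-≡⁻ eq in cong (inj₁ ∘ inj₁) (Gs (cong₂ _,_ (inj₁-injective p) (inj₁-injective q)))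
bridge-simple G H Gs Hs {inj₁ (inj₂ _)} {inj₁ (inj₂ _)} eq =
  let p , q = ×-≡⁻ eq in cong (inj₁ ∘ inj₂) (Hs (cong₂ _,_ (inj₂-injective p) (inj₂-injective q)))
bridge-simple G H Gs Hs {inj₂ (inj₁ _)} {inj₂ (inj₁ _)} refl = refl
bridge-simple G H Gs Hs {inj₂ (inj₂ _)} {inj₂ (inj₂ _)} refl = refl
bridge-simple G H Gs Hs {inj₁ (inj₁ _)} {inj₁ (inj₂ _)} ()
bridge-simple G H Gs Hs {inj₁ (inj₁ _)} {inj₂ (inj₁ _)} ()
bridge-simple G H Gs Hs {inj₁ (inj₁ _)} {inj₂ (inj₂ _)} ()
bridge-simple G H Gs Hs {inj₁ (inj₂ _)} {inj₁ (inj₁ _)} ()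
bridge-simple G H Gs Hs {inj₁ (inj₂ _)} {inj₂ (inj₁ _)} ()
bridge-simple G H Gs Hs {inj₁ (inj₂ _)} {inj₂ (inj₂ _)} ()
bridge-simple G H Gs Hs {inj₂ (inj₁ _)} {inj₁ (inj₁ _)} ()
bridge-simple G H Gs Hs {inj₂ (inj₁ _)} {inj₁ (inj₂ _)} ()
bridge-simple G H Gs Hs {inj₂ (inj₂ _)} {inj₁ (inj₁ _)} ()
bridge-simple G H Gs Hs {inj₂ (inj₂ _)} {inj₁ (inj₂ _)} ()

⊗ᵍ-simple : (G : CohGraph V) (H : CohGraph W) → Simple G → Simple H → Simple (G ⊗ᵍ H)
⊗ᵍ-simple G H Gs Hs {inj₁ _} {inj₁ _} eq =
  let p , q = ×-≡⁻ eq in cong inj₁ (Gs (cong₂ _,_ (inj₁-injective p) (inj₁-injective q)))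
⊗ᵍ-simple G H Gs Hs {inj₂ _} {inj₂ _} eq =
  let p , q = ×-≡⁻ eq in cong inj₂ (Hs (cong₂ _,_ (inj₂-injective p) (inj₂-injective q)))
⊗ᵍ-simple G H Gs Hs {inj₁ _} {inj₂ _} ()
⊗ᵍ-simple G H Gs Hs {inj₂ _} {inj₁ _} ()

module _ (G a : CohGraph V) (H b : CohGraph W) where
  private
    K = bridge G H
    ab = a ⊗ᵍ b
    L = Link K ab

    module _ (cyc : PlugCycle K ab) where
      open Cycle cyc

      Visited : Edge K ⊎ Edge ab → Set
      Visited x = x ∈ᴸ start ∷ rest

      -- Coherence is demanded of all pairs on the cycle, so one visited edge of `G` excludes `H`
      -- and every crossing. An edge of `b` would have one of these as its predecessor, so it does
      -- not occur either.
      inner-G : ∀ {g} → Visited (inj₁ (inj₁ (inj₁ g))) → PlugCycle G a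
      inner-G {g} g∈ = map-cycle (λ { (_ , y , _) → y })
        (λ { {_ , x , refl} {_ , y , refl} → link x y }) (λ { {_ , x , refl} {_ , y , refl} → coh x y })
        (restrict-cycle cyc visited)
        where
        ε : Edge G ⊎ Edge a → Edge K ⊎ Edge ab
        ε = Sum.map (inj₁ ∘ inj₁) inj₁
        visited : ∀ {x} → Visited x → ∃ λ y → x ≡ ε y
        visited {inj₁ (inj₁ (inj₁ e))} _  = inj₁ e , refl
        visited {inj₁ (inj₁ (inj₂ _))} x∈ = ⊥-elim (coherent g∈ x∈)
        visited {inj₁ (inj₂ (inj₁ _))} x∈ = ⊥-elim (coherent g∈ x∈)
        visited {inj₁ (inj₂ (inj₂ _))} x∈ = ⊥-elim (coherent g∈ x∈)
        visited {inj₂ (inj₁ e)}        _  = inj₂ e , refl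
        visited {inj₂ (inj₂ _)}        x∈ with cycle-predecessor cyc x∈
        ... | inj₁ (inj₁ (inj₂ _)) , _ , y∈ = ⊥-elim (coherent g∈ y∈)
        ... | inj₁ (inj₂ (inj₁ _)) , _ , y∈ = ⊥-elim (coherent g∈ y∈)
        ... | inj₁ (inj₂ (inj₂ _)) , _ , y∈ = ⊥-elim (coherent g∈ y∈)
        ... | inj₁ (inj₁ (inj₁ _)) , (() , _) , _
        ... | inj₂ _ , (_ , ()) , _
        link : ∀ x y → L (ε x) (ε y) → Link G a x y
        link (inj₁ _) (inj₂ _) (p , o) = inj₁-injective p , o
        link (inj₂ _) (inj₁ _) (p , o) = inj₁-injective p , o
        coh : ∀ x y → Coh (K □ ab) (ε x) (ε y) → Coh (G □ a) x y
        coh (inj₁ _) (inj₁ _) = id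
        coh (inj₁ _) (inj₂ _) = id
        coh (inj₂ _) (inj₁ _) = id
        coh (inj₂ _) (inj₂ _) = id

      inner-H : ∀ {h} → Visited (inj₁ (inj₁ (inj₂ h))) → PlugCycle H b
      inner-H {h} h∈ = map-cycle (λ { (_ , y , _) → y })
        (λ { {_ , x , refl} {_ , y , refl} → link x y }) (λ { {_ , x , refl} {_ , y , refl} → coh x y })
        (restrict-cycle cyc visited)
        where
        ε : Edge H ⊎ Edge b → Edge K ⊎ Edge ab
        ε = Sum.map (inj₁ ∘ inj₂) inj₂
        visited : ∀ {x} → Visited x → ∃ λ y → x ≡ ε y
        visited {inj₁ (inj₁ (inj₂ e))} _  = inj₁ e , refl
        visited {inj₁ (inj₁ (inj₁ _))} x∈ = ⊥-elim (coherent h∈ x∈)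
        visited {inj₁ (inj₂ (inj₁ _))} x∈ = ⊥-elim (coherent h∈ x∈)
        visited {inj₁ (inj₂ (inj₂ _))} x∈ = ⊥-elim (coherent h∈ x∈)
        visited {inj₂ (inj₂ e)}        _  = inj₂ e , refl
        visited {inj₂ (inj₁ _)}        x∈ with cycle-predecessor cyc x∈
        ... | inj₁ (inj₁ (inj₁ _)) , _ , y∈ = ⊥-elim (coherent h∈ y∈)
        ... | inj₁ (inj₂ (inj₁ _)) , _ , y∈ = ⊥-elim (coherent h∈ y∈)
        ... | inj₁ (inj₂ (inj₂ _)) , _ , y∈ = ⊥-elim (coherent h∈ y∈)
        ... | inj₁ (inj₁ (inj₂ _)) , (() , _) , _
        ... | inj₂ _ , (_ , ()) , _
        link : ∀ x y → L (ε x) (ε y) → Link H b x y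
        link (inj₁ _) (inj₂ _) (p , o) = inj₂-injective p , o
        link (inj₂ _) (inj₁ _) (p , o) = inj₂-injective p , o
        coh : ∀ x y → Coh (K □ ab) (ε x) (ε y) → Coh (H □ b) x y
        coh (inj₁ _) (inj₁ _) = id
        coh (inj₁ _) (inj₂ _) = id
        coh (inj₂ _) (inj₁ _) = id
        coh (inj₂ _) (inj₂ _) = id

      -- A crossing is followed by an edge of `a` or `b`, which stays on the side reached. The next
      -- edge of the bridge starts there: it belongs to `G` or `H` or crosses back, and each of
      -- these is incoherent with the first crossing.
      no-crossing : ∀ {x} → Visited (inj₁ (inj₂ x)) → ⊥
      no-crossing {inj₁ _} x∈ with cycle-successor cyc x∈
      ... | inj₁ _ , (_ , ()) , _
      ... | inj₂ (inj₁ _) , (() , _) , _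
      ... | inj₂ (inj₂ _) , _ , y∈ with cycle-successor cyc y∈
      ...   | inj₁ (inj₁ _) , _ , z∈ = coherent x∈ z∈
      ...   | inj₁ (inj₂ (inj₂ _)) , _ , z∈ = coherent x∈ z∈
      ...   | inj₁ (inj₂ (inj₁ _)) , (() , _) , _
      ...   | inj₂ _ , (_ , ()) , _
      no-crossing {inj₂ _} x∈ with cycle-successor cyc x∈
      ... | inj₁ _ , (_ , ()) , _
      ... | inj₂ (inj₂ _) , (() , _) , _
      ... | inj₂ (inj₁ _) , _ , y∈ with cycle-successor cyc y∈
      ...   | inj₁ (inj₁ _) , _ , z∈ = coherent x∈ z∈
      ...   | inj₁ (inj₂ (inj₁ _)) , _ , z∈ = coherent x∈ z∈
      ...   | inj₁ (inj₂ (inj₂ _)) , (() , _) , _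
      ...   | inj₂ _ , (_ , ()) , _

      inner : ∀ {x} → Visited (inj₁ x) → PlugCycle G a ⊎ PlugCycle H b
      inner {inj₁ (inj₁ _)} x∈ = inj₁ (inner-G x∈)
      inner {inj₁ (inj₂ _)} x∈ = inj₂ (inner-H x∈)
      inner {inj₂ _}        x∈ = ⊥-elim (no-crossing x∈)

    bridge-cycle : PlugCycle K ab → PlugCycle G a ⊎ PlugCycle H b
    bridge-cycle cyc@(cycle {inj₁ _} _ _) = inner cyc (here refl)
    bridge-cycle cyc@(cycle {inj₂ _} _ _) with cycle-successor cyc (here refl)
    ... | inj₁ _ , _ , x∈ = inner cyc x∈
    ... | inj₂ _ , (_ , ()) , _

  bridge-⟂ : G ⟂ a → H ⟂ b → bridge G H ⟂ a ⊗ᵍ b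
  bridge-⟂ G⟂a H⟂b c = [ ¬PlugCycle G⟂a , ¬PlugCycle H⟂b ] (bridge-cycle (toCycle K ab c))

two-cycle : (G H : CohGraph V) → ∀ e f → target G e ≡ source H f → target H f ≡ source G e → PlugCycle G H
two-cycle G H e f p q = cycle {start = inj₁ e} {rest = inj₂ f ∷ []} ((p , tt) ∷ (q , tt) ∷ []) λ
  { (here refl)         (here refl)         → CohGraph.⌢-refl G
  ; (here refl)         (there (here refl)) → tt
  ; (there (here refl)) (here refl)         → tt
  ; (there (here refl)) (there (here refl)) → CohGraph.⌢-refl H }

-- Preimages of both endpoints are part of an edge, so its source and target are available without
-- inverting `i`.
induced : (i : V → U) → CohGraph U → CohGraph V
induced i F = record
  { Edge         = Σ[ e ∈ Edge F ] ∃₂ λ u v → source F e ≡ i u × target F e ≡ i v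
  ; source       = λ (_ , u , _) → u
  ; target       = λ (_ , _ , v , _) → v
  ; _⌢_          = λ (d , _) (e , _) → Coh F d e
  ; ⌢-refl       = CohGraph.⌢-refl F
  ; ⌢-sym        = CohGraph.⌢-sym F
  ; ⌢-irrelevant = CohGraph.⌢-irrelevant F
  }

induced-hom : (i : V → U) (F : CohGraph U) → Hom i (induced i F) F
induced-hom i F = hom proj₁ (λ (_ , _ , _ , p , _) → p) (λ (_ , _ , _ , _ , q) → q) (λ _ _ → id)

module _ (F : CohGraph (V ⊎ W)) (G : CohGraph V) (H : CohGraph W) (F⟂ : F ⟂ bridge G H) where
  private
    K = bridge G H

    F₁ = induced inj₁ F
    F₂ = induced inj₂ F

    underlying : Edge F₁ ⊎ Edge F₂ → Edge F
    underlying = [ proj₁ , proj₁ ]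

    locate : ∀ e {x y} → source F e ≡ x → target F e ≡ y →
             Σ[ f ∈ Edge F₁ ⊎ Edge F₂ ] underlying f ≡ e
    locate e {inj₁ u} {inj₁ v} p q = inj₁ (e , u , v , p , q) , refl
    locate e {inj₂ u} {inj₂ v} p q = inj₂ (e , u , v , p , q) , refl
    -- The bridge edge from `v` back to `u` would close a cycle of length two.
    locate e {inj₁ u} {inj₂ v} p q = ⊥-elim (¬PlugCycle F⟂ (two-cycle F K e (inj₂ (inj₂ (v , u))) q (sym p)))
    locate e {inj₂ u} {inj₁ v} p q = ⊥-elim (¬PlugCycle F⟂ (two-cycle F K e (inj₂ (inj₁ (v , u))) q (sym p)))

    underlying-source : ∀ f → source (F₁ ⊗ᵍ F₂) f ≡ source F (underlying f)
    underlying-source (inj₁ (_ , _ , _ , p , _)) = sym p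
    underlying-source (inj₂ (_ , _ , _ , p , _)) = sym p

    underlying-target : ∀ f → target (F₁ ⊗ᵍ F₂) f ≡ target F (underlying f)
    underlying-target (inj₁ (_ , _ , _ , _ , q)) = sym q
    underlying-target (inj₂ (_ , _ , _ , _ , q)) = sym q

    underlying-coh : ∀ f g → Coh F (underlying f) (underlying g) → Coh (F₁ ⊗ᵍ F₂) f g
    underlying-coh (inj₁ _) (inj₁ _) c = c
    underlying-coh (inj₁ _) (inj₂ _) _ = tt
    underlying-coh (inj₂ _) (inj₁ _) _ = tt
    underlying-coh (inj₂ _) (inj₂ _) c = c

    φ : Edge F → Edge F₁ ⊎ Edge F₂
    φ e = proj₁ (locate e refl refl)

    φ-≡ : ∀ e → underlying (φ e) ≡ e
    φ-≡ e = proj₂ (locate e refl refl)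

  -- No edge of F crosses, so F is its two induced parts side by side, with less coherence.
  separation : Hom id F (induced inj₁ F ⊗ᵍ induced inj₂ F)
  separation = hom φ
    (λ e → trans (underlying-source (φ e)) (cong (source F) (φ-≡ e)))
    (λ e → trans (underlying-target (φ e)) (cong (target F) (φ-≡ e)))
    (λ d e c → underlying-coh (φ d) (φ e) (subst₂ (Coh F) (sym (φ-≡ d)) (sym (φ-≡ e)) c))

-- A graph orthogonal to the bridge maps into the product of its induced parts. These belong to `𝑨`
-- and `𝑩` because `G` and `H` are contained in the bridge, and every test that the product passes
-- is passed by the graph.
⊗-generator : (𝑨 : Conduct V) (𝑩 : Conduct W) {G : CohGraph V} {H : CohGraph W} →
              Generator 𝑨 G → Generator 𝑩 H → Generator (𝑨 ⊗ 𝑩) (bridge G H)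
⊗-generator 𝑨 𝑩 {G} {H} (G∈ , _ , Orth-G⊆) (H∈ , _ , Orth-H⊆) = K∈ ,
  (λ { {F} F∈ _ refl → ⟂-sym {G = bridge G H} {F} (K∈ F F∈) }) ,
  (λ {F} F⟂ T T∈ → let F⟂K = F⟂ (bridge G H) refl in
    ⟂-map (separation F G H F⟂K) (≅⇒Hom ≅-refl)
      (⟂-sym {G = T} {induced inj₁ F ⊗ᵍ induced inj₂ F} (T∈ _ (_ , _ ,
        Orth-G⊆ (λ { _ refl → ⟂-map {G′ = F} {bridge G H} (induced-hom inj₁ F)
          (hom (inj₁ ∘ inj₁) (λ _ → refl) (λ _ → refl) (λ _ _ → id)) F⟂K }) ,
        Orth-H⊆ (λ { _ refl → ⟂-map {G′ = F} {bridge G H} (induced-hom inj₂ F)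
          (hom (inj₁ ∘ inj₂) (λ _ → refl) (λ _ → refl) (λ _ _ → id)) F⟂K }) , refl))))
  where
  K∈ : bridge G H ∈ carrier ((𝑨 ⊗ 𝑩) ^⊥)
  K∈ = ⊗^⊥-intro 𝑨 𝑩 λ a b a∈ b∈ → bridge-⟂ G a H b (G∈ a a∈) (H∈ b b∈)

-- From `Orth ｛ G ｝ ⊆ carrier 𝑨` it follows that `𝑨 ^⊥` lies in the biorthogonal of `｛ G ｝`, and
-- likewise for `H`. The single test `G ⊗ᵍ H` is thus extended to all tests, one factor at a time.
⅋-generator : (𝑨 : Conduct V) (𝑩 : Conduct W) {G : CohGraph V} {H : CohGraph W} →
              Generator 𝑨 G → Generator 𝑩 H → Generator (𝑨 ⅋ 𝑩) (G ⊗ᵍ H)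
⅋-generator 𝑨 𝑩 {G} {H} (G∈ , _ , Orth-G⊆) (H∈ , _ , Orth-H⊆) =
  ⊆⊥⊥ (𝑨 ^⊥ ⊗ 𝑩 ^⊥) (product-∈ (𝑨 ^⊥) (𝑩 ^⊥) G∈ H∈) ,
  (λ { F∈ _ refl → ⊗^⊥-elim (𝑨 ^⊥) (𝑩 ^⊥) F∈ G H G∈ H∈ }) ,
  (λ {F} F⟂ → ⊗^⊥-intro (𝑨 ^⊥) (𝑩 ^⊥) λ a b a∈ b∈ →
    ⟂-biorthˡ F ｛ G ｝ b (G , refl) (λ { _ refl →
      ⟂-biorthʳ F G ｛ H ｝ (H , refl) (λ { _ refl → F⟂ (G ⊗ᵍ H) refl }) b (Orth-anti Orth-H⊆ b∈) })
      a (Orth-anti Orth-G⊆ a∈))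

principal-⊗ : (𝑨 : Conduct V) (𝑩 : Conduct W) → Principal 𝑨 → Principal 𝑩 → Principal (𝑨 ⊗ 𝑩)
principal-⊗ 𝑨 𝑩 (G , g , Gs) (H , h , Hs) = bridge G H , ⊗-generator 𝑨 𝑩 g h , bridge-simple G H Gs Hs

principal-⅋ : (𝑨 : Conduct V) (𝑩 : Conduct W) → Principal 𝑨 → Principal 𝑩 → Principal (𝑨 ⅋ 𝑩)
principal-⅋ 𝑨 𝑩 (G , g , Gs) (H , h , Hs) = G ⊗ᵍ H , ⅋-generator 𝑨 𝑩 g h , ⊗ᵍ-simple G H Gs Hs

principal-≐ : (𝑨 𝑩 : Conduct V) → carrier 𝑨 ≐ carrier 𝑩 → Principal 𝑨 → Principal 𝑩
principal-≐ 𝑨 𝑩 (𝑨⊆𝑩 , 𝑩⊆𝑨) (G , (G∈ , 𝑨⊆ , ⊆𝑨) , Gs) =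
  G , (Orth-anti 𝑩⊆𝑨 G∈ , 𝑨⊆ ∘ 𝑩⊆𝑨 , 𝑨⊆𝑩 ∘ ⊆𝑨) , Gs

biprincipal-^⊥ : (𝑨 : Conduct V) → BiPrincipal 𝑨 → BiPrincipal (𝑨 ^⊥)
biprincipal-^⊥ 𝑨 (p , p⊥) = p⊥ , principal-≐ 𝑨 ((𝑨 ^⊥) ^⊥) (Conduct.closed 𝑨) p

biprincipal-⊗ : (𝑨 : Conduct V) (𝑩 : Conduct W) → BiPrincipal 𝑨 → BiPrincipal 𝑩 → BiPrincipal (𝑨 ⊗ 𝑩)
biprincipal-⊗ 𝑨 𝑩 (p , p⊥) (q , q⊥) = principal-⊗ 𝑨 𝑩 p q ,
  -- The dual of a tensor is the par of the duals only up to biorthogonals in both factors: the two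
  -- conducts have the same elements but are different records.
  principal-≐ (𝑨 ^⊥ ⅋ 𝑩 ^⊥) ((𝑨 ⊗ 𝑩) ^⊥)
    ( (λ F∈ → ⊗^⊥-intro 𝑨 𝑩 λ a b a∈ b∈ → ⊗^⊥-elim ((𝑨 ^⊥) ^⊥) ((𝑩 ^⊥) ^⊥) F∈ a b (⊆⊥⊥ 𝑨 a∈) (⊆⊥⊥ 𝑩 b∈))
    , (λ F∈ → ⊗^⊥-intro ((𝑨 ^⊥) ^⊥) ((𝑩 ^⊥) ^⊥) λ a b a∈ b∈ → ⊗^⊥-elim 𝑨 𝑩 F∈ a b (⊥⊥⊆ 𝑨 a∈) (⊥⊥⊆ 𝑩 b∈)))
    (principal-⅋ (𝑨 ^⊥) (𝑩 ^⊥) p⊥ q⊥)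

biprincipal-⅋ : (𝑨 : Conduct V) (𝑩 : Conduct W) → BiPrincipal 𝑨 → BiPrincipal 𝑩 → BiPrincipal (𝑨 ⅋ 𝑩)
biprincipal-⅋ 𝑨 𝑩 p q = biprincipal-^⊥ (𝑨 ^⊥ ⊗ 𝑩 ^⊥)
  (biprincipal-⊗ (𝑨 ^⊥) (𝑩 ^⊥) (biprincipal-^⊥ 𝑨 p) (biprincipal-^⊥ 𝑩 q))

-- Base conducts and the edge bound

empty-generator : (𝑨 : Conduct V) → (∀ G → G ∈ carrier 𝑨) → Generator 𝑨 empty
empty-generator 𝑨 all = (λ G _ → edgeless-⟂ (λ ()) G) ,
  (λ { {F} _ _ refl → ⟂-sym {G = empty} {F} (edgeless-⟂ (λ ()) F) }) , (λ {F} _ → all F)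

empty-simple : Simple (empty {V})
empty-simple {x = ()}

-- Without vertices there are no edges, so every graph over `⊥` belongs to this conduct and to its
-- dual.
𝟏 : Conduct ⊥
𝟏 = orth ｛ empty ｝

𝟏-∈ : (G : CohGraph ⊥) → G ∈ carrier 𝟏
𝟏-∈ G H _ = edgeless-⟂ (source G) H

𝟏-biprincipal : BiPrincipal 𝟏
𝟏-biprincipal = (empty , empty-generator 𝟏 𝟏-∈ , empty-simple) ,
  (empty , empty-generator (𝟏 ^⊥) (λ G H _ → edgeless-⟂ (source G) H) , empty-simple)

loop : CohGraph ⊤
loop = record
  { Edge         = ⊤
  ; source       = id
  ; target       = id
  ; _⌢_          = λ _ _ → ⊤
  ; ⌢-refl       = tt
  ; ⌢-sym        = id
  ; ⌢-irrelevant = λ _ _ → refl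
  }

-- On one vertex every edge is a loop and forms a cycle of length two with `loop`. Only edgeless
-- graphs remain, and the dual contains all graphs.
𝑺 : Conduct ⊤
𝑺 = orth ｛ loop ｝

𝑺-edgeless : ∀ G → G ∈ carrier 𝑺 → ¬ Edge G
𝑺-edgeless G G∈ e = ¬PlugCycle (G∈ loop refl) (two-cycle G loop e tt refl refl)

𝑺-dual : (G : CohGraph ⊤) → G ∈ carrier (𝑺 ^⊥)
𝑺-dual G H H∈ = ⟂-sym {G = H} {G} (edgeless-⟂ (𝑺-edgeless H H∈) G)

𝑺-biprincipal : BiPrincipal 𝑺
𝑺-biprincipal = (loop , (𝑺-dual loop , id , id) , (λ _ → refl)) ,
  (empty , empty-generator (𝑺 ^⊥) 𝑺-dual , empty-simple)

module _ (G : CohGraph V) (simple : Simple G) where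

  endpoints : Edge G ↣ (V × V)
  endpoints = mk↣ {to = λ e → source G e , target G e} simple

  -- No enumeration of `Edge G` is given, so its size is measured by the injections from `Fin m`.
  -- Numbering the endpoints and pairing them with `combine` lands in `Fin (n * n)`.
  simple-bound : ∀ {n m} → V ↔ Fin n → Fin m ↣ Edge G → m ≤ n * n
  simple-bound V↔n m↣E = injective⇒≤ {f = λ i → combine (to (source G (m.to i))) (to (target G (m.to i)))} λ {i} {j} eq →
    let p , q = combine-injective (to (source G (m.to i))) _ (to (source G (m.to j))) _ eq
    in m.injective (simple (cong₂ _,_ (to-injective p) (to-injective q)))
    where
    module m = Injection m↣E
    open Inverse V↔n
    to-injective : Injective _≡_ _≡_ to
    to-injective = retraction⇒injective from strictlyInverseʳ

-- The ∗-autonomous structure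

wire-∘₃ : (φ : U → V) (ψ : V → W) (χ : W → D) → wire φ ∷∷ wire ψ ∷∷ wire χ ≅ wire (χ ∘ ψ ∘ φ)
wire-∘₃ φ ψ χ =
  wire φ ∷∷ wire ψ ∷∷ wire χ
    ≅⟨ ∷∷-cong {F = wire φ ∷∷ wire ψ} {wire (ψ ∘ φ)} {wire χ} {wire χ} (wire-∘ φ ψ) ≅-refl ⟩
  wire (ψ ∘ φ) ∷∷ wire χ
    ≅⟨ wire-∘ (ψ ∘ φ) χ ⟩
  wire (χ ∘ ψ ∘ φ) ≅∎

identityˡ-≅ : (F : CohGraph (A ⊎ B)) → F ∷∷ wire id ≅ F
identityˡ-≅ F =
  F ∷∷ wire id
    ≅⟨ ∷∷-wire F id ⟩
  rename (Sum.map₂ id) F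
    ≅⟨ rename-id {f = Sum.map₂ id} F (λ { (inj₁ _) → refl ; (inj₂ _) → refl }) ⟩
  F ≅∎

identityʳ-≅ : (F : CohGraph (A ⊎ B)) → wire id ∷∷ F ≅ F
identityʳ-≅ F =
  wire id ∷∷ F
    ≅⟨ wire-∷∷ {φ = id} {ψ = id} (λ _ → refl) (λ _ → refl) F ⟩
  rename (Sum.map₁ id) F
    ≅⟨ rename-id {f = Sum.map₁ id} F (λ { (inj₁ _) → refl ; (inj₂ _) → refl }) ⟩
  F ≅∎

⊗₁-cong : {F F′ : CohGraph (A ⊎ B)} {G G′ : CohGraph (C ⊎ D)} → F ≅ F′ → G ≅ G′ →
          rename interchange (F ⊗ᵍ G) ≅ rename interchange (F′ ⊗ᵍ G′)
⊗₁-cong F≅F′ G≅G′ = rename-cong interchange (□-cong (rename-cong inj₁ F≅F′) (rename-cong inj₂ G≅G′))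

⊗₁-1 : rename interchange (wire {V} id ⊗ᵍ wire {W} id) ≅ wire id
⊗₁-1 = ≅-trans (wire-⊗ id id) (wire-≗ λ { (inj₁ _) → refl ; (inj₂ _) → refl })

-- Both composites are renamings, one at the target of `F` and one at the source of `F′`, so a
-- naturality law reduces to an isomorphism of renamed graphs.
wire-natural : (F : CohGraph (A ⊎ B)) (F′ : CohGraph (A′ ⊎ B′)) (φ : A → A′) (φ⁻¹ : A′ → A) (ψ : B → B′) →
               (∀ v → φ⁻¹ (φ v) ≡ v) → (∀ v → φ (φ⁻¹ v) ≡ v) →
               rename (Sum.map₂ ψ) F ≅ rename (Sum.map₁ φ⁻¹) F′ →
               F ∷∷ wire ψ ≅ wire φ ∷∷ F′
wire-natural F F′ φ φ⁻¹ ψ φ⁻¹∘φ φ∘φ⁻¹ iso =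
  F ∷∷ wire ψ
    ≅⟨ ∷∷-wire F ψ ⟩
  rename (Sum.map₂ ψ) F
    ≅⟨ iso ⟩
  rename (Sum.map₁ φ⁻¹) F′
    ≅⟨ ≅-sym (wire-∷∷ {φ = φ} {ψ = φ⁻¹} φ⁻¹∘φ φ∘φ⁻¹ F′) ⟩
  wire φ ∷∷ F′ ≅∎

module _ (F : CohGraph (A ⊎ A′)) (G : CohGraph (B ⊎ B′)) (H : CohGraph (C ⊎ C′)) where

  α-natural-≅ : rename interchange (rename interchange (F ⊗ᵍ G) ⊗ᵍ H) ∷∷ wire assocʳ ≅
                wire assocʳ ∷∷ rename interchange (F ⊗ᵍ rename interchange (G ⊗ᵍ H))
  α-natural-≅ = wire-natural (rename interchange (rename interchange (F ⊗ᵍ G) ⊗ᵍ H))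
    (rename interchange (F ⊗ᵍ rename interchange (G ⊗ᵍ H)))
    assocʳ assocˡ assocʳ assocʳˡ assocˡʳ
    (mk≅ assocʳ (retraction⇒injective assocˡ assocʳˡ) (λ e → assocˡ e , assocˡʳ e)
      (λ { (inj₁ (inj₁ e)) → f (source F e) ; (inj₁ (inj₂ e)) → g (source G e) ; (inj₂ e) → h (source H e) })
      (λ { (inj₁ (inj₁ e)) → f (target F e) ; (inj₁ (inj₂ e)) → g (target G e) ; (inj₂ e) → h (target H e) })
      λ { (inj₁ (inj₁ _)) (inj₁ (inj₁ _)) → mk⇔ id id
        ; (inj₁ (inj₁ _)) (inj₁ (inj₂ _)) → mk⇔ id id
        ; (inj₁ (inj₁ _)) (inj₂ _)        → mk⇔ id id
        ; (inj₁ (inj₂ _)) (inj₁ (inj₁ _)) → mk⇔ id id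
        ; (inj₁ (inj₂ _)) (inj₁ (inj₂ _)) → mk⇔ id id
        ; (inj₁ (inj₂ _)) (inj₂ _)        → mk⇔ id id
        ; (inj₂ _)        (inj₁ (inj₁ _)) → mk⇔ id id
        ; (inj₂ _)        (inj₁ (inj₂ _)) → mk⇔ id id
        ; (inj₂ _)        (inj₂ _)        → mk⇔ id id })
    where
    S : Set
    S = ((A ⊎ B) ⊎ C) ⊎ (A′ ⊎ (B′ ⊎ C′))
    f : ∀ v → _≡_ {A = S} (Sum.map₁ assocˡ (interchange (inj₁ v)))
                          (Sum.map₂ assocʳ (interchange (inj₁ (interchange (inj₁ v)))))
    f (inj₁ _) = refl
    f (inj₂ _) = refl
    g : ∀ v → _≡_ {A = S} (Sum.map₁ assocˡ (interchange (inj₂ (interchange (inj₁ v)))))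
                          (Sum.map₂ assocʳ (interchange (inj₁ (interchange (inj₂ v)))))
    g (inj₁ _) = refl
    g (inj₂ _) = refl
    h : ∀ v → _≡_ {A = S} (Sum.map₁ assocˡ (interchange (inj₂ (interchange (inj₂ v)))))
                          (Sum.map₂ assocʳ (interchange (inj₂ v)))
    h (inj₁ _) = refl
    h (inj₂ _) = refl

drop-left : ⊥ ⊎ V → V
drop-left = [ (λ ()) , id ]

drop-right : V ⊎ ⊥ → V
drop-right = [ id , (λ ()) ]

drop-left-section : (v : ⊥ ⊎ V) → inj₂ (drop-left v) ≡ v
drop-left-section (inj₂ _) = refl

drop-right-section : (v : V ⊎ ⊥) → inj₁ (drop-right v) ≡ v
drop-right-section (inj₁ _) = refl

module _ (F : CohGraph (A ⊎ B)) where

  l-natural-≅ : rename interchange (wire {⊥} id ⊗ᵍ F) ∷∷ wire drop-left ≅ wire drop-left ∷∷ F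
  l-natural-≅ = wire-natural (rename interchange (wire {⊥} id ⊗ᵍ F)) F drop-left inj₂ drop-left drop-left-section (λ _ → refl)
    (≅-sym (mk≅ inj₂ inj₂-injective (λ { (inj₂ e) → e , refl ; (inj₁ (inj₁ ())) ; (inj₁ (inj₂ ())) })
      (f ∘ source F) (f ∘ target F) (λ _ _ → mk⇔ id id)))
    where
    f : ∀ v → _≡_ {A = (⊥ ⊎ A) ⊎ B} (Sum.map₂ drop-left (interchange {A = ⊥} {B = ⊥} (inj₂ v))) (Sum.map₁ inj₂ v)
    f (inj₁ _) = refl
    f (inj₂ _) = refl

  r-natural-≅ : rename interchange (F ⊗ᵍ wire {⊥} id) ∷∷ wire drop-right ≅ wire drop-right ∷∷ F
  r-natural-≅ = wire-natural (rename interchange (F ⊗ᵍ wire {⊥} id)) F drop-right inj₁ drop-right drop-right-section (λ _ → refl)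
    (≅-sym (mk≅ inj₁ inj₁-injective (λ { (inj₁ e) → e , refl ; (inj₂ (inj₁ ())) ; (inj₂ (inj₂ ())) })
      (f ∘ source F) (f ∘ target F) (λ _ _ → mk⇔ id id)))
    where
    f : ∀ v → _≡_ {A = (A ⊎ ⊥) ⊎ B} (Sum.map₂ drop-right (interchange {C = ⊥} {D = ⊥} (inj₁ v))) (Sum.map₁ inj₁ v)
    f (inj₁ _) = refl
    f (inj₂ _) = refl

σ-natural-≅ : (F : CohGraph (A ⊎ A′)) (G : CohGraph (B ⊎ B′)) →
              rename interchange (F ⊗ᵍ G) ∷∷ wire swap ≅ wire swap ∷∷ rename interchange (G ⊗ᵍ F)
σ-natural-≅ {A} {A′} {B} {B′} F G = wire-natural
  (rename interchange (F ⊗ᵍ G)) (rename interchange (G ⊗ᵍ F)) swap swap swap swap-involutive swap-involutive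
  (mk≅ swap (retraction⇒injective swap swap-involutive) (λ e → swap e , swap-involutive e)
    [ f ∘ source F , g ∘ source G ] [ f ∘ target F , g ∘ target G ]
    λ { (inj₁ _) (inj₁ _) → mk⇔ id id ; (inj₁ _) (inj₂ _) → mk⇔ id id
      ; (inj₂ _) (inj₁ _) → mk⇔ id id ; (inj₂ _) (inj₂ _) → mk⇔ id id })
  where
  f : ∀ v → _≡_ {A = (A ⊎ B) ⊎ (B′ ⊎ A′)} (Sum.map₁ swap (interchange (inj₂ v))) (Sum.map₂ swap (interchange (inj₁ v)))
  f (inj₁ _) = refl
  f (inj₂ _) = refl
  g : ∀ v → _≡_ {A = (A ⊎ B) ⊎ (B′ ⊎ A′)} (Sum.map₁ swap (interchange (inj₁ v))) (Sum.map₂ swap (interchange (inj₂ v)))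
  g (inj₁ _) = refl
  g (inj₂ _) = refl

σ-involutive-≅ : wire (swap {A = V} {B = W}) ∷∷ wire swap ≅ wire id
σ-involutive-≅ = wire-inverse {φ = swap} {ψ = swap} swap-involutive swap-involutive

1⊗wire : (φ : V → W) → rename interchange (wire {U} id ⊗ᵍ wire φ) ≅ wire (Sum.map₂ φ)
1⊗wire φ = wire-⊗ id φ

wire⊗1 : (φ : V → W) → rename interchange (wire φ ⊗ᵍ wire {U} id) ≅ wire (Sum.map₁ φ)
wire⊗1 φ = wire-⊗ φ id

-- Composites and tensors of wires are wires again, so this law and the next two become pointwise
-- equations between functions on sums.
triangle-≅ : wire assocʳ ∷∷ rename interchange (wire {A} id ⊗ᵍ wire (drop-left {B})) ≅
             rename interchange (wire (drop-right {A}) ⊗ᵍ wire {B} id)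
triangle-≅ {A} {B} =
  wire assocʳ ∷∷ rename interchange (wire id ⊗ᵍ wire drop-left)
    ≅⟨ ∷∷-cong {F = wire assocʳ} {wire assocʳ} {rename interchange (wire id ⊗ᵍ wire drop-left)} {wire (Sum.map₂ drop-left)}
         ≅-refl (1⊗wire drop-left) ⟩
  wire assocʳ ∷∷ wire (Sum.map₂ drop-left)
    ≅⟨ wire-∘ assocʳ (Sum.map₂ drop-left) ⟩
  wire (Sum.map₂ drop-left ∘ assocʳ)
    ≅⟨ wire-≗ {φ = Sum.map₂ drop-left ∘ assocʳ} {ψ = Sum.map₁ drop-right} (λ { (inj₁ (inj₁ _)) → refl ; (inj₂ _) → refl }) ⟩
  wire (Sum.map₁ drop-right)
    ≅⟨ ≅-sym (wire⊗1 drop-right) ⟩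
  rename interchange (wire drop-right ⊗ᵍ wire id) ≅∎

pentagon-≅ : wire (assocʳ {A = A ⊎ B} {B = C} {C = D}) ∷∷ wire assocʳ ≅
             (rename interchange (wire assocʳ ⊗ᵍ wire id) ∷∷ wire assocʳ) ∷∷ rename interchange (wire id ⊗ᵍ wire assocʳ)
pentagon-≅ =
  wire assocʳ ∷∷ wire assocʳ
    ≅⟨ wire-∘ assocʳ assocʳ ⟩
  wire (assocʳ ∘ assocʳ)
    ≅⟨ wire-≗ {φ = assocʳ ∘ assocʳ} {ψ = Sum.map₂ assocʳ ∘ assocʳ ∘ Sum.map₁ assocʳ}
         (λ { (inj₁ (inj₁ (inj₁ _))) → refl ; (inj₁ (inj₁ (inj₂ _))) → refl ; (inj₁ (inj₂ _)) → refl ; (inj₂ _) → refl }) ⟩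
  wire (Sum.map₂ assocʳ ∘ assocʳ ∘ Sum.map₁ assocʳ)
    ≅⟨ ≅-sym (wire-∘₃ (Sum.map₁ assocʳ) assocʳ (Sum.map₂ assocʳ)) ⟩
  wire (Sum.map₁ assocʳ) ∷∷ wire assocʳ ∷∷ wire (Sum.map₂ assocʳ)
    ≅⟨ ≅-sym (∷∷-cong {F = rename interchange (wire assocʳ ⊗ᵍ wire id) ∷∷ wire assocʳ} {wire (Sum.map₁ assocʳ) ∷∷ wire assocʳ}
                      {rename interchange (wire id ⊗ᵍ wire assocʳ)} {wire (Sum.map₂ assocʳ)}
         (∷∷-cong {F = rename interchange (wire assocʳ ⊗ᵍ wire id)} {wire (Sum.map₁ assocʳ)} {wire assocʳ} {wire assocʳ}
            (wire⊗1 assocʳ) ≅-refl) (1⊗wire assocʳ)) ⟩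
  (rename interchange (wire assocʳ ⊗ᵍ wire id) ∷∷ wire assocʳ) ∷∷ rename interchange (wire id ⊗ᵍ wire assocʳ) ≅∎

hexagon-≅ : (wire (assocʳ {A = A} {B = B} {C = C}) ∷∷ wire swap) ∷∷ wire assocʳ ≅
            (rename interchange (wire swap ⊗ᵍ wire id) ∷∷ wire assocʳ) ∷∷ rename interchange (wire id ⊗ᵍ wire swap)
hexagon-≅ =
  wire assocʳ ∷∷ wire swap ∷∷ wire assocʳ
    ≅⟨ wire-∘₃ assocʳ swap assocʳ ⟩
  wire (assocʳ ∘ swap ∘ assocʳ)
    ≅⟨ wire-≗ {φ = assocʳ ∘ swap ∘ assocʳ} {ψ = Sum.map₂ swap ∘ assocʳ ∘ Sum.map₁ swap}
         (λ { (inj₁ (inj₁ _)) → refl ; (inj₁ (inj₂ _)) → refl ; (inj₂ _) → refl }) ⟩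
  wire (Sum.map₂ swap ∘ assocʳ ∘ Sum.map₁ swap)
    ≅⟨ ≅-sym (wire-∘₃ (Sum.map₁ swap) assocʳ (Sum.map₂ swap)) ⟩
  wire (Sum.map₁ swap) ∷∷ wire assocʳ ∷∷ wire (Sum.map₂ swap)
    ≅⟨ ≅-sym (∷∷-cong {F = rename interchange (wire swap ⊗ᵍ wire id) ∷∷ wire assocʳ} {wire (Sum.map₁ swap) ∷∷ wire assocʳ}
                      {rename interchange (wire id ⊗ᵍ wire swap)} {wire (Sum.map₂ swap)}
         (∷∷-cong {F = rename interchange (wire swap ⊗ᵍ wire id)} {wire (Sum.map₁ swap)} {wire assocʳ} {wire assocʳ}
            (wire⊗1 swap) ≅-refl) (1⊗wire swap)) ⟩
  (rename interchange (wire swap ⊗ᵍ wire id) ∷∷ wire assocʳ) ∷∷ rename interchange (wire id ⊗ᵍ wire swap) ≅∎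

rename-inverse : (f : V → W) (g : W → V) (G : CohGraph V) → (∀ v → g (f v) ≡ v) → rename g (rename f G) ≅ G
rename-inverse f g G g∘f = rename-id {f = g ∘ f} G g∘f

rename-faithful : (f : V → W) (g : W → V) {G H : CohGraph V} → (∀ v → g (f v) ≡ v) → rename f G ≅ rename f H → G ≅ H
rename-faithful f g {G} {H} g∘f iso =
  G
    ≅⟨ ≅-sym (rename-inverse f g G g∘f) ⟩
  rename g (rename f G)
    ≅⟨ rename-cong g iso ⟩
  rename g (rename f H)
    ≅⟨ rename-inverse f g H g∘f ⟩
  H ≅∎

drop-left-∈ : (𝑨 : Conduct V) → wire drop-left ∈ carrier ((𝟏 ⊗ 𝑨) ⊸ 𝑨)
drop-left-∈ 𝑨 = wire-⊗-∈ 𝟏 𝑨 𝑨 drop-left λ u a _ a∈ → ⊥⊥⊆ 𝑨 λ t t∈ →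
  ⟂-map {j = id} {G′ = a} {H′ = t}
    (hom (λ { (inj₁ e) → ⊥-elim (source u e) ; (inj₂ e) → e })
         (λ { (inj₁ e) → ⊥-elim (source u e) ; (inj₂ e) → refl })
         (λ { (inj₁ e) → ⊥-elim (source u e) ; (inj₂ e) → refl })
         (λ { (inj₁ e) → ⊥-elim (source u e) ; (inj₂ _) (inj₁ e) → ⊥-elim (source u e) ; (inj₂ _) (inj₂ _) → id }))
    (≅⇒Hom ≅-refl) (⟂-sym {G = t} {a} (t∈ a a∈))

drop-right-∈ : (𝑨 : Conduct V) → wire drop-right ∈ carrier ((𝑨 ⊗ 𝟏) ⊸ 𝑨)
drop-right-∈ 𝑨 = wire-⊗-∈ 𝑨 𝟏 𝑨 drop-right λ a u a∈ _ → ⊥⊥⊆ 𝑨 λ t t∈ →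
  ⟂-map {j = id} {G′ = a} {H′ = t}
    (hom (λ { (inj₂ e) → ⊥-elim (source u e) ; (inj₁ e) → e })
         (λ { (inj₂ e) → ⊥-elim (source u e) ; (inj₁ e) → refl })
         (λ { (inj₂ e) → ⊥-elim (source u e) ; (inj₁ e) → refl })
         (λ { (inj₂ e) → ⊥-elim (source u e) ; (inj₁ _) (inj₂ e) → ⊥-elim (source u e) ; (inj₁ _) (inj₁ _) → id }))
    (≅⇒Hom ≅-refl) (⟂-sym {G = t} {a} (t∈ a a∈))

inj₂-∈ : (𝑨 : Conduct V) → wire inj₂ ∈ carrier (𝑨 ⊸ (𝟏 ⊗ 𝑨))
inj₂-∈ 𝑨 = wire-∈ 𝑨 (𝟏 ⊗ 𝑨) inj₂ λ a a∈ → ⊥⊥⊆ (𝟏 ⊗ 𝑨) λ t t∈ →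
  ⟂-map {j = id} {G′ = empty ⊗ᵍ a} {H′ = t} (hom inj₂ (λ _ → refl) (λ _ → refl) (λ _ _ → id)) (≅⇒Hom ≅-refl)
    (⟂-sym {G = t} {empty ⊗ᵍ a} (⊗^⊥-elim 𝟏 𝑨 t∈ empty a (𝟏-∈ empty) a∈))

inj₁-∈ : (𝑨 : Conduct V) → wire inj₁ ∈ carrier (𝑨 ⊸ (𝑨 ⊗ 𝟏))
inj₁-∈ 𝑨 = wire-∈ 𝑨 (𝑨 ⊗ 𝟏) inj₁ λ a a∈ → ⊥⊥⊆ (𝑨 ⊗ 𝟏) λ t t∈ →
  ⟂-map {j = id} {G′ = a ⊗ᵍ empty} {H′ = t} (hom inj₁ (λ _ → refl) (λ _ → refl) (λ _ _ → id)) (≅⇒Hom ≅-refl)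
    (⟂-sym {G = t} {a ⊗ᵍ empty} (⊗^⊥-elim 𝑨 𝟏 t∈ a empty a∈ (𝟏-∈ empty)))

swap-wire-∈ : (𝑨 : Conduct V) (𝑩 : Conduct W) → wire swap ∈ carrier ((𝑨 ⊗ 𝑩) ⊸ (𝑩 ⊗ 𝑨))
swap-wire-∈ 𝑨 𝑩 = wire-⊗-∈ 𝑨 𝑩 (𝑩 ⊗ 𝑨) swap λ a b a∈ b∈ → ⊥⊥⊆ (𝑩 ⊗ 𝑨) λ t t∈ →
  ⟂-sym {G = t} {rename swap (a ⊗ᵍ b)} (⟂-map {j = id} {G′ = t} {H′ = b ⊗ᵍ a} (≅⇒Hom ≅-refl)
    (hom swap [ (λ _ → refl) , (λ _ → refl) ] [ (λ _ → refl) , (λ _ → refl) ]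
      (λ { (inj₁ _) (inj₁ _) → id ; (inj₁ _) (inj₂ _) → id ; (inj₂ _) (inj₁ _) → id ; (inj₂ _) (inj₂ _) → id }))
    (⊗^⊥-elim 𝑩 𝑨 t∈ b a b∈ a∈))

identity-∈ : (𝑨 : Conduct V) → wire id ∈ carrier (𝑨 ⊸ 𝑨)
identity-∈ 𝑨 = wire-∈ 𝑨 𝑨 id λ _ a∈ → a∈

open Object

model : ModelOfMLL BiPrincipal
model = record
  { ⊗-closed         = biprincipal-⊗
  ; ⊥-closed         = biprincipal-^⊥
  ; execution-∈      = λ X Y Z (_ , F∈) (_ , G∈) → ∷∷-∈ (conduct X) (conduct Y) (conduct Z) F∈ G∈
  ; tensor-∈         = λ X Y X′ Y′ (_ , F∈) (_ , G∈) → ⊗ᵍ-∈ (conduct X) (conduct Y) (conduct X′) (conduct Y′) F∈ G∈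
  ; dual-∈           = λ X Y (_ , F∈) → swap-∈ (conduct X) (conduct Y) F∈
  ; isStarAutonomous = record
    { isCategory = record
      { ≈-equiv   = record { refl = ≅-refl ; sym = ≅-sym ; trans = ≅-trans }
      ; ∘-cong    = λ {_} {_} {_} {g} {g′} {f} {f′} g≅g′ f≅f′ →
          ∷∷-cong {F = proj₁ f} {proj₁ f′} {proj₁ g} {proj₁ g′} f≅f′ g≅g′
      -- Execution is in diagrammatic order, so the bracketing of a composite appears mirrored.
      ; ∘-assoc   = λ (H , _) (G , _) (F , _) → ∷∷-assoc F G H
      ; 1ₘ        = λ {X} → wire id , identity-∈ (conduct X)
      ; identityˡ = λ (F , _) → identityˡ-≅ F
      ; identityʳ = λ (F , _) → identityʳ-≅ F
      }
    ; ⊗-cong = λ {_} {_} {_} {_} {f} {g} {f′} {g′} → ⊗₁-cong {F = proj₁ f} {proj₁ g} {proj₁ f′} {proj₁ g′}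
    ; ⊗-1    = ⊗₁-1
    ; ⊗-∘    = λ (G , _) (F , _) (G′ , _) (F′ , _) → ⊗ᵍ-∷∷ F G F′ G′
    ; unit   = object 𝟏 𝟏-biprincipal
    ; α = λ X Y Z → record
      { fwd = wire assocʳ , assocʳ-∈ (conduct X) (conduct Y) (conduct Z)
      ; bwd = wire assocˡ , assocˡ-∈ (conduct X) (conduct Y) (conduct Z)
      ; isoˡ = wire-inverse {φ = assocʳ} {ψ = assocˡ} assocʳˡ assocˡʳ
      ; isoʳ = wire-inverse {φ = assocˡ} {ψ = assocʳ} assocˡʳ assocʳˡ
      }
    ; l = λ X → record
      { fwd = wire drop-left , drop-left-∈ (conduct X)
      ; bwd = wire inj₂ , inj₂-∈ (conduct X)
      ; isoˡ = wire-inverse {φ = drop-left} {ψ = inj₂} drop-left-section (λ _ → refl)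
      ; isoʳ = wire-inverse {φ = inj₂} {ψ = drop-left} (λ _ → refl) drop-left-section
      }
    ; r = λ X → record
      { fwd = wire drop-right , drop-right-∈ (conduct X)
      ; bwd = wire inj₁ , inj₁-∈ (conduct X)
      ; isoˡ = wire-inverse {φ = drop-right} {ψ = inj₁} drop-right-section (λ _ → refl)
      ; isoʳ = wire-inverse {φ = inj₁} {ψ = drop-right} (λ _ → refl) drop-right-section
      }
    ; σ = λ X Y → record
      { fwd = wire swap , swap-wire-∈ (conduct X) (conduct Y)
      ; bwd = wire swap , swap-wire-∈ (conduct Y) (conduct X)
      ; isoˡ = σ-involutive-≅
      ; isoʳ = σ-involutive-≅
      }
    ; α-natural = λ (F , _) (G , _) (H , _) → α-natural-≅ F G H
    ; l-natural = λ (F , _) → l-natural-≅ F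
    ; r-natural = λ (F , _) → r-natural-≅ F
    ; σ-natural = λ (F , _) (G , _) → σ-natural-≅ F G
    ; σ-involutive = λ _ _ → σ-involutive-≅
    ; triangle     = λ _ _ → triangle-≅
    ; pentagon     = λ _ _ _ _ → pentagon-≅
    ; hexagon      = λ _ _ _ → hexagon-≅
    ; *-cong       = λ {_} {_} {f} {g} → rename-cong swap {proj₁ f} {proj₁ g}
    ; *-1          = wire-swap {φ = id} {ψ = id} (λ _ → refl) (λ _ → refl)
    ; *-∘          = λ (G , _) (F , _) → rev-∷∷ F G
    ; *-faithful   = λ {_} {_} {f} {g} → rename-faithful swap swap {proj₁ f} {proj₁ g} swap-involutive
    ; *-full       = λ {X} {Y} (H , H∈) →
        (rename swap H , swap-∈⁻ (conduct X) (conduct Y) H∈) , rename-inverse swap swap H swap-involutive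
    ; curry        = λ {X} {Y} {Z} (F , F∈) → rename assocʳ F , curry-∈ (conduct X) (conduct Y) (conduct Z) F∈
    ; uncurry      = λ {X} {Y} {Z} (F , F∈) → rename assocˡ F , uncurry-∈ (conduct X) (conduct Y) (conduct Z) F∈
    ; curry-cong    = λ {_} {_} {_} {f} {g} → rename-cong assocʳ {proj₁ f} {proj₁ g}
    ; uncurry-cong  = λ {_} {_} {_} {f} {g} → rename-cong assocˡ {proj₁ f} {proj₁ g}
    ; uncurry-curry = λ (F , _) → rename-inverse assocʳ assocˡ F assocʳˡ
    ; curry-uncurry = λ (F , _) → rename-inverse assocˡ assocʳ F assocˡʳ
    ; curry-natural = λ (F , _) (X , _) (Y , _) (Z , _) → curry-∷∷ X Y Z F
    }
  }

-- Nonempty interpretations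

arc : V → W → CohGraph (V ⊎ W)
arc v w = record
  { Edge         = ⊤
  ; source       = λ _ → inj₁ v
  ; target       = λ _ → inj₂ w
  ; _⌢_          = λ _ _ → ⊤
  ; ⌢-refl       = tt
  ; ⌢-sym        = id
  ; ⌢-irrelevant = λ _ _ → refl
  }

-- The arc crosses to `W`, an edge of `H` stays there, and the arc cannot be taken again because it
-- starts in `V`: there is no way back.
arc-cycle : (v : V) (w : W) (G : CohGraph V) (H : CohGraph W) → ¬ PlugCycle (arc v w) (G ⊗ᵍ H)
arc-cycle v w G H cyc = [ visit-arc , visit-other ] (start-side cyc)
  where
  open Cycle cyc
  L = Link (arc v w) (G ⊗ᵍ H)

  visit-arc : inj₁ tt ∈ᴸ start ∷ rest → ⊥
  visit-arc x∈ with cycle-successor cyc x∈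
  ... | inj₁ _ , (_ , ()) , _
  ... | inj₂ (inj₁ _) , (() , _) , _
  ... | inj₂ (inj₂ _) , _ , y∈ with cycle-successor cyc y∈
  ...   | inj₁ _ , (() , _) , _
  ...   | inj₂ _ , (_ , ()) , _

  visit-other : (∃ λ e → inj₂ e ∈ᴸ start ∷ rest) → ⊥
  visit-other (_ , x∈) with cycle-successor cyc x∈
  ... | inj₁ _ , _ , y∈ = visit-arc y∈
  ... | inj₂ _ , (_ , ()) , _

  start-side : (c : PlugCycle (arc v w) (G ⊗ᵍ H)) → inj₁ tt ∈ᴸ Cycle.start c ∷ Cycle.rest c ⊎
                 ∃ λ e → inj₂ e ∈ᴸ Cycle.start c ∷ Cycle.rest c
  start-side (cycle {inj₁ _} _ _) = inj₁ (here refl)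
  start-side (cycle {inj₂ e} _ _) = inj₂ (e , here refl)

arc-∈ : (𝑨 : Conduct V) (𝑩 : Conduct W) (v : V) (w : W) → arc v w ∈ carrier (𝑨 ⅋ 𝑩)
arc-∈ 𝑨 𝑩 v w = ⊗^⊥-intro (𝑨 ^⊥) (𝑩 ^⊥) λ a b _ _ c → arc-cycle v w a b (toCycle (arc v w) (a ⊗ᵍ b) c)

-- Names of atoms are ignored, which is enough because all atoms receive the same interpretation.
#atom #natom : Formula → ℕ
#atom (atom _)  = 1
#atom (natom _) = 0
#atom (F ⊗ᶠ G)  = #atom F + #atom G
#atom (F ⅋ᶠ G)  = #atom F + #atom G
#natom (atom _)  = 0
#natom (natom _) = 1
#natom (F ⊗ᶠ G)  = #natom F + #natom G
#natom (F ⅋ᶠ G)  = #natom F + #natom G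

#atom-dual : ∀ F → #atom (dual F) ≡ #natom F
#atom-dual (atom _)  = refl
#atom-dual (natom _) = refl
#atom-dual (F ⊗ᶠ G)  = cong₂ _+_ (#atom-dual F) (#atom-dual G)
#atom-dual (F ⅋ᶠ G)  = cong₂ _+_ (#atom-dual F) (#atom-dual G)

#natom-dual : ∀ F → #natom (dual F) ≡ #atom F
#natom-dual (atom _)  = refl
#natom-dual (natom _) = refl
#natom-dual (F ⊗ᶠ G)  = cong₂ _+_ (#natom-dual F) (#natom-dual G)
#natom-dual (F ⅋ᶠ G)  = cong₂ _+_ (#natom-dual F) (#natom-dual G)

total : (Formula → ℕ) → List Formula → ℕ
total f Γ = sum (List.map f Γ)

total-++ : ∀ f Γ Δ → total f (Γ ++ Δ) ≡ total f Γ + total f Δ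
total-++ f Γ Δ = trans (cong sum (map-++ f Γ Δ)) (sum-++ (List.map f Γ) (List.map f Δ))

-- Here `a` and `n` count the positive and the negative atoms of the cut formula. Its dual exchanges
-- them, so adding the two premises leaves the common summand `a + n` to cancel.
cut-arithmetic : ∀ a n x x′ y y′ → a + x ≡ n + x′ → n + y ≡ a + y′ → x + y ≡ x′ + y′
cut-arithmetic a n x x′ y y′ p q = +-cancelˡ-≡ (a + n) _ _ (begin
  a + n + (x + y)      ≡⟨ shuffle a n x y ⟩
  (a + x) + (n + y)    ≡⟨ cong₂ _+_ p q ⟩
  (n + x′) + (a + y′)  ≡⟨ shuffle′ a n x′ y′ ⟩
  a + n + (x′ + y′)    ∎)
  where
  open ≡-Reasoning
  shuffle : ∀ a n x y → a + n + (x + y) ≡ (a + x) + (n + y)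
  shuffle = solve-∀
  shuffle′ : ∀ a n x y → (n + x) + (a + y) ≡ a + n + (x + y)
  shuffle′ = solve-∀

ten-arithmetic : ∀ f g x y f′ g′ x′ y′ → f + x ≡ f′ + x′ → g + y ≡ g′ + y′ → (f + g) + (x + y) ≡ (f′ + g′) + (x′ + y′)
ten-arithmetic f g x y f′ g′ x′ y′ p q = begin
  (f + g) + (x + y)      ≡⟨ shuffle f g x y ⟩
  (f + x) + (g + y)      ≡⟨ cong₂ _+_ p q ⟩
  (f′ + x′) + (g′ + y′)  ≡⟨ sym (shuffle f′ g′ x′ y′) ⟩
  (f′ + g′) + (x′ + y′)  ∎
  where
  open ≡-Reasoning
  shuffle : ∀ f g x y → (f + g) + (x + y) ≡ (f + x) + (g + y)
  shuffle = solve-∀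

balanced : ∀ {Γ} → ⊢ Γ → total #atom Γ ≡ total #natom Γ
balanced (ax F) rewrite #atom-dual F | #natom-dual F = swap-+ (#atom F) (#natom F)
  where
  swap-+ : ∀ a n → a + (n + 0) ≡ n + (a + 0)
  swap-+ = solve-∀
balanced (cut {Γ} {Δ} F p q) rewrite total-++ #atom Γ Δ | total-++ #natom Γ Δ =
  cut-arithmetic (#atom F) (#natom F) _ _ _ _ (balanced p)
    (subst₂ (λ a n → a + total #atom Δ ≡ n + total #natom Δ) (#atom-dual F) (#natom-dual F) (balanced q))
balanced (ex Γ↭Δ p) = trans (sum-↭ (↭-map⁺ #atom (↭-sym Γ↭Δ))) (trans (balanced p) (sum-↭ (↭-map⁺ #natom Γ↭Δ)))
balanced (ten {Γ} {Δ} F G p q) rewrite total-++ #atom Γ Δ | total-++ #natom Γ Δ =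
  ten-arithmetic (#atom F) (#atom G) _ _ (#natom F) (#natom G) _ _ (balanced p) (balanced q)
balanced (par {Γ} F G p) = trans (+-assoc (#atom F) (#atom G) (total #atom Γ))
  (trans (balanced p) (sym (+-assoc (#natom F) (#natom G) (total #natom Γ))))

private
  ρ : ℕ → ∃ Conduct
  ρ _ = ⊤ , 𝑺

-- Formulas have no units, so each has a vertex and an arc can be drawn in every par.
vertex : ∀ F → ∣_∣ ρ F
vertex (atom _)  = tt
vertex (natom _) = tt
vertex (F ⊗ᶠ _)  = inj₁ (vertex F)
vertex (F ⅋ᶠ _)  = inj₁ (vertex F)

⟦⟧-biprincipal : ∀ F → BiPrincipal (⟦_⟧ ρ F)
⟦⟧-biprincipal (atom _)  = 𝑺-biprincipal
⟦⟧-biprincipal (natom _) = biprincipal-^⊥ 𝑺 𝑺-biprincipal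
⟦⟧-biprincipal (F ⊗ᶠ G)  = biprincipal-⊗ (⟦_⟧ ρ F) (⟦_⟧ ρ G) (⟦⟧-biprincipal F) (⟦⟧-biprincipal G)
⟦⟧-biprincipal (F ⅋ᶠ G)  = biprincipal-⅋ (⟦_⟧ ρ F) (⟦_⟧ ρ G) (⟦⟧-biprincipal F) (⟦⟧-biprincipal G)

NonEmpty : ∀ {V} → Conduct V → Set₁
NonEmpty {V} 𝑨 = Σ[ G ∈ CohGraph V ] G ∈ carrier 𝑨 × Edge G

-- Counts instead of the shape of the formula describe the exceptional case, in the form that
-- `balanced` refutes. A par is never exceptional, because it contains an arc, and a tensor needs an
-- edge in one factor only.
nonempty? : ∀ F → NonEmpty (⟦_⟧ ρ F) ⊎ (#natom F ≡ 0 × 0 < #atom F)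
nonempty? (atom _)  = inj₂ (refl , s≤s z≤n)
nonempty? (natom _) = inj₁ (loop , 𝑺-dual loop , tt)
nonempty? (F ⅋ᶠ G)  = inj₁ (_ , arc-∈ (⟦_⟧ ρ F) (⟦_⟧ ρ G) (vertex F) (vertex G) , tt)
nonempty? (F ⊗ᶠ G) with nonempty? F | nonempty? G
... | inj₁ (a , a∈ , e) | _ = inj₁ (a ⊗ᵍ empty , product-∈ (⟦_⟧ ρ F) (⟦_⟧ ρ G) a∈ (empty-∈ (⟦_⟧ ρ G)) , inj₁ e)
... | inj₂ _ | inj₁ (b , b∈ , e) = inj₁ (empty ⊗ᵍ b , product-∈ (⟦_⟧ ρ F) (⟦_⟧ ρ G) (empty-∈ (⟦_⟧ ρ F)) b∈ , inj₂ e)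
... | inj₂ (p , f) | inj₂ (q , _) = inj₂ (cong₂ _+_ p q , m≤n⇒m≤n+o (#atom G) f)

provable⇒nonempty : ∀ F → Provable F → NonEmpty (⟦_⟧ ρ F)
provable⇒nonempty F p with nonempty? F
... | inj₁ n = n
... | inj₂ (#natom≡0 , 0<#atom) = ⊥-elim (<-irrefl (sym #atom≡0) 0<#atom)
  where
  #atom≡0 : #atom F ≡ 0
  #atom≡0 = trans (sym (+-identityʳ (#atom F))) (trans (balanced p) (trans (+-identityʳ (#natom F)) #natom≡0))

theorem35 : (∀ {V W : Set} (𝑨 : Conduct V) (𝑩 : Conduct W) → Principal 𝑨 → Principal 𝑩 → Principal (𝑨 ⊗ 𝑩) × Principal (𝑨 ⅋ 𝑩))
    × ModelOfMLL BiPrincipal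
    × (Σ[ 𝑺 ∈ Conduct ⊤ ]
    BiPrincipal 𝑺
    × (∀ G → G ∈ carrier 𝑺 → ¬ Edge G)
    × (∀ F → Provable F →
    BiPrincipal (⟦_⟧ (λ _ → ⊤ , 𝑺) F)
    × (Σ[ G ∈ CohGraph _ ] G ∈ carrier (⟦_⟧ (λ _ → ⊤ , 𝑺) F) × Edge G)))
    × (∀ {V : Set} (𝑨 : Conduct V) → BiPrincipal 𝑨 →
    Σ[ G ∈ CohGraph V ] Generator 𝑨 G × Simple G
    × (Edge G ↣ (V × V))
    × (∀ {n m : ℕ} → V ↔ Fin n → Fin m ↣ Edge G → m ≤ n * n))
theorem35 =
  (λ 𝑨 𝑩 p q → principal-⊗ 𝑨 𝑩 p q , principal-⅋ 𝑨 𝑩 p q) ,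
  model ,
  (𝑺 , 𝑺-biprincipal , 𝑺-edgeless , λ F p → ⟦⟧-biprincipal F , provable⇒nonempty F p) ,
  (λ { _ ((G , generator , simple) , _) → G , generator , simple , endpoints G simple , simple-bound G simple })
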